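{- Let $G$ be a random graph drawn under the $G(n,p)$ model, where $p=p(n)$ satisfies $\frac{2\log n}{n} < p < \frac{1}{\log^2 n}$. Then there is a constant $C>0$ such that, asymptotically almost surely, $$\varphi(G) \geq \hat{\varphi}(G) \geq \chi(G)\left(1-\frac{C}{\log (np)}\right).$$
   Context: All graphs are finite, simple and undirected. $\chi$ denotes the chromatic number. For a proper vertex coloring $c$ of $G$ and an induced subgraph $H$ of $G$, let $c(H)$ be the set of colors used by $c$ on the vertices of $H$. Define $\varphi_c(G)=\max_{H}\,(|c(H)|-\chi(H))$ over all induced subgraphs $H$ of $G$, and $\hat{\varphi}_c(G)$ as the same maximum taken only over all connected induced subgraphs $H$ of $G$. Define $\varphi(G)=\min_c \varphi_c(G)$ and $\hat{\varphi}(G)=\min_c \hat{\varphi}_c(G)$, the minima over all proper colorings $c$ of $G$ (with any number of colors). $G(n,p)$ is the Erdős–Rényi model: a random graph on $n$ labelled vertices in which each pair of vertices is an edge independently with probability $p$. An event occurs asymptotically almost surely (a.a.s.) if its probability tends to $1$ as $n\to\infty$. $\log$ is the natural logarithm and $\log^2 n=(\log n)^2$. -}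

module Defs where

open import Data.Bool.Base using (Bool; true; false; if_then_else_)
open import Data.Fin.Base using (Fin; zero; suc)
open import Data.Fin.Subset using (Subset; _∈_)
open import Data.Fin.Subset.Properties using (_∈?_)
open import Data.Integer.Base as ℤ using (ℤ; +_)
open import Data.List.Base as List using (List; []; _∷_; allFin; cartesianProductWith; deduplicate; filter; length)
open import Data.Nat.Base as ℕ using (ℕ; zero; suc; _!)
import Data.Nat.Properties as ℕₚ
open import Data.Product using (∃; ∃-syntax; Σ-syntax; _×_; _,_; proj₁; proj₂)
open import Data.Rational.Base as ℚ using (ℚ; 0ℚ; 1ℚ; ½; ∣_∣; _+_; _*_; _-_; -_; _≤_; _<_; 1/_)
import Data.Rational.Properties as ℚₚ
open import Data.Rational.Solver using (module +-*-Solver)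
open import Data.Vec.Base as Vec using (Vec; lookup)
open import Level using (0ℓ)
open import Relation.Binary.Core using (Rel)
open import Relation.Binary.Construct.Closure.ReflexiveTransitive using (Star)
open import Relation.Binary.PropositionalEquality using (_≡_; _≢_; refl; sym; trans; cong; cong₂; subst)
open import Relation.Nullary using (¬_)

-- Real numbers, as Cauchy sequences of rationals.  Equality of reals is
-- the relation _≃ᴿ_, not _≡_.

IsCauchy : (ℕ → ℚ) → Set
IsCauchy x = ∀ ε → 0ℚ < ε → ∃[ N ] (∀ m n → N ℕ.≤ m → N ℕ.≤ n → ∣ x m - x n ∣ ≤ ε)

record ℝ : Set where
  constructor mkℝ
  field
    seq    : ℕ → ℚ
    cauchy : IsCauchy seq

open ℝ public

private
  open +-*-Solver using (solve; _:=_; _:+_; _:*_; _:-_; :-_; con)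

  scale-pos : ∀ ε i → .{{_ : ℚ.Positive i}} → 0ℚ < ε → 0ℚ < ε * i
  scale-pos ε i 0<ε = subst (_< ε * i) (ℚₚ.*-zeroˡ i) (ℚₚ.*-monoˡ-<-pos i 0<ε)

  half+half : ∀ ε → ε * ½ + ε * ½ ≡ ε
  half+half ε = trans (sym (ℚₚ.*-distribˡ-+ ε ½ ½)) (ℚₚ.*-identityʳ ε)

  const-cauchy : ∀ q → IsCauchy (λ _ → q)
  const-cauchy q ε 0<ε = 0 , λ _ _ _ _ →
    subst (λ t → ∣ t ∣ ≤ ε) (sym (ℚₚ.+-inverseʳ q)) (ℚₚ.<⇒≤ 0<ε)

  neg-cauchy : ∀ {x} → IsCauchy x → IsCauchy (λ n → - x n)
  neg-cauchy {x} cx ε 0<ε with cx ε 0<ε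
  ... | N , h = N , λ m n N≤m N≤n → subst (_≤ ε)
    (trans (sym (ℚₚ.∣-p∣≡∣p∣ (x m - x n)))
           (cong ∣_∣ (solve 2 (λ a b → :- (a :- b) := :- a :- (:- b)) refl (x m) (x n))))
    (h m n N≤m N≤n)

  +-cauchy : ∀ {x y} → IsCauchy x → IsCauchy y → IsCauchy (λ n → x n + y n)
  +-cauchy {x} {y} cx cy ε 0<ε with cx (ε * ½) (scale-pos ε ½ 0<ε) | cy (ε * ½) (scale-pos ε ½ 0<ε)
  ... | N , h | M , k = N ℕ.⊔ M , λ m n m≥ n≥ → begin
    ∣ (x m + y m) - (x n + y n) ∣
      ≡⟨ cong ∣_∣ (solve 4 (λ a b c d → (a :+ b) :- (c :+ d) := (a :- c) :+ (b :- d)) refl (x m) (y m) (x n) (y n)) ⟩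
    ∣ (x m - x n) + (y m - y n) ∣
      ≤⟨ ℚₚ.∣p+q∣≤∣p∣+∣q∣ (x m - x n) (y m - y n) ⟩
    ∣ x m - x n ∣ + ∣ y m - y n ∣
      ≤⟨ ℚₚ.+-mono-≤ (h m n (ℕₚ.m⊔n≤o⇒m≤o N M m≥) (ℕₚ.m⊔n≤o⇒m≤o N M n≥))
                     (k m n (ℕₚ.m⊔n≤o⇒n≤o N M m≥) (ℕₚ.m⊔n≤o⇒n≤o N M n≥)) ⟩
    ε * ½ + ε * ½
      ≡⟨ half+half ε ⟩
    ε ∎
    where open ℚₚ.≤-Reasoning

  bounded : ∀ {x} → IsCauchy x → ∃[ N ] ∃[ B ] (0ℚ < B × (∀ n → N ℕ.≤ n → ∣ x n ∣ ≤ B))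
  bounded {x} cx with cx 1ℚ (ℚₚ.positive⁻¹ 1ℚ)
  ... | N , h = N , 1ℚ + ∣ x N ∣ ,
    ℚₚ.+-mono-<-≤ {0ℚ} {1ℚ} {0ℚ} {∣ x N ∣} (ℚₚ.positive⁻¹ 1ℚ) (ℚₚ.0≤∣p∣ (x N)) ,
    λ n N≤n → begin
      ∣ x n ∣
        ≡⟨ cong ∣_∣ (solve 2 (λ a b → a := (a :- b) :+ b) refl (x n) (x N)) ⟩
      ∣ (x n - x N) + x N ∣
        ≤⟨ ℚₚ.∣p+q∣≤∣p∣+∣q∣ (x n - x N) (x N) ⟩
      ∣ x n - x N ∣ + ∣ x N ∣
        ≤⟨ ℚₚ.+-monoˡ-≤ ∣ x N ∣ (h n N N≤n ℕₚ.≤-refl) ⟩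
      1ℚ + ∣ x N ∣ ∎
    where open ℚₚ.≤-Reasoning

  *-mono-∣∣ : ∀ {a b} p q → ∣ p ∣ ≤ a → ∣ q ∣ ≤ b → ∣ p * q ∣ ≤ a * b
  *-mono-∣∣ {a} {b} p q p≤a q≤b = begin
    ∣ p * q ∣      ≡⟨ ℚₚ.∣p*q∣≡∣p∣*∣q∣ p q ⟩
    ∣ p ∣ * ∣ q ∣  ≤⟨ ℚₚ.*-monoʳ-≤-nonNeg ∣ q ∣ {{ℚₚ.∣-∣-nonNeg q}} p≤a ⟩
    a * ∣ q ∣      ≤⟨ ℚₚ.*-monoˡ-≤-nonNeg a {{ℚ.nonNegative (ℚₚ.≤-trans (ℚₚ.0≤∣p∣ p) p≤a)}} q≤b ⟩
    a * b          ∎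
    where open ℚₚ.≤-Reasoning

  collect : ∀ A B ε i → A * (ε * i) + (ε * i) * B ≡ ε * (i * (A + B))
  collect = solve 4 (λ a b e i → a :* (e :* i) :+ (e :* i) :* b := e :* (i :* (a :+ b))) refl

  *-difference : ∀ a b c d → a * b - c * d ≡ a * (b - d) + (a - c) * d
  *-difference = solve 4 (λ a b c d → a :* b :- c :* d := a :* (b :- d) :+ (a :- c) :* d) refl

  split : ∀ A B ε → 0ℚ < A + B → 0ℚ < ε → ∃[ δ ] (0ℚ < δ × A * δ + δ * B ≡ ε)
  split A B ε 0<A+B 0<ε = ε * i , scale-pos ε i 0<ε ,
    trans (collect A B ε i) (trans (cong (ε *_) i*[A+B]≡1) (ℚₚ.*-identityʳ ε))
    where
    instance
      pos : ℚ.Positive (A + B)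
      pos = ℚ.positive 0<A+B
      nonZero : ℚ.NonZero (A + B)
      nonZero = ℚₚ.pos⇒nonZero (A + B)
    i : ℚ
    i = 1/ (A + B)
    i*[A+B]≡1 : i * (A + B) ≡ 1ℚ
    i*[A+B]≡1 = ℚₚ.*-inverseˡ (A + B)
    instance
      pos-i : ℚ.Positive i
      pos-i = ℚₚ.1/pos⇒pos (A + B)

  *-difference-bound : ∀ a b c d A B δ → ∣ a ∣ ≤ A → ∣ b - d ∣ ≤ δ → ∣ a - c ∣ ≤ δ → ∣ d ∣ ≤ B →
                       ∣ a * b - c * d ∣ ≤ A * δ + δ * B
  *-difference-bound a b c d A B δ a≤A bd≤δ ac≤δ d≤B = begin
    ∣ a * b - c * d ∣                  ≡⟨ cong ∣_∣ (*-difference a b c d) ⟩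
    ∣ a * (b - d) + (a - c) * d ∣      ≤⟨ ℚₚ.∣p+q∣≤∣p∣+∣q∣ (a * (b - d)) ((a - c) * d) ⟩
    ∣ a * (b - d) ∣ + ∣ (a - c) * d ∣  ≤⟨ ℚₚ.+-mono-≤ {∣ a * (b - d) ∣} {A * δ} {∣ (a - c) * d ∣} {δ * B}
                                            (*-mono-∣∣ {A} {δ} a (b - d) a≤A bd≤δ)
                                            (*-mono-∣∣ {δ} {B} (a - c) d ac≤δ d≤B) ⟩
    A * δ + δ * B                      ∎
    where open ℚₚ.≤-Reasoning

  *-cauchy : ∀ {x y} → IsCauchy x → IsCauchy y → IsCauchy (λ n → x n * y n)
  *-cauchy {x} {y} cx cy ε 0<ε =
    let N₁ , A , 0<A , hA = bounded {x} cx
        N₂ , B , 0<B , hB = bounded {y} cy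
        δ , 0<δ , sum-δ   = split A B ε (ℚₚ.+-mono-< {0ℚ} {A} {0ℚ} {B} 0<A 0<B) 0<ε
        N₃ , hx           = cx δ 0<δ
        N₄ , hy           = cy δ 0<δ
    in (N₁ ℕ.⊔ N₂) ℕ.⊔ (N₃ ℕ.⊔ N₄) , λ m n m≥ n≥ →
    let m≥₁₂ = ℕₚ.m⊔n≤o⇒m≤o (N₁ ℕ.⊔ N₂) (N₃ ℕ.⊔ N₄) m≥
        n≥₁₂ = ℕₚ.m⊔n≤o⇒m≤o (N₁ ℕ.⊔ N₂) (N₃ ℕ.⊔ N₄) n≥
        m≥₃₄ = ℕₚ.m⊔n≤o⇒n≤o (N₁ ℕ.⊔ N₂) (N₃ ℕ.⊔ N₄) m≥
        n≥₃₄ = ℕₚ.m⊔n≤o⇒n≤o (N₁ ℕ.⊔ N₂) (N₃ ℕ.⊔ N₄) n≥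
    in subst (λ e → ∣ x m * y m - x n * y n ∣ ≤ e) sum-δ
         (*-difference-bound (x m) (y m) (x n) (y n) A B δ
           (hA m (ℕₚ.m⊔n≤o⇒m≤o N₁ N₂ m≥₁₂))
           (hy m n (ℕₚ.m⊔n≤o⇒n≤o N₃ N₄ m≥₃₄) (ℕₚ.m⊔n≤o⇒n≤o N₃ N₄ n≥₃₄))
           (hx m n (ℕₚ.m⊔n≤o⇒m≤o N₃ N₄ m≥₃₄) (ℕₚ.m⊔n≤o⇒m≤o N₃ N₄ n≥₃₄))
           (hB n (ℕₚ.m⊔n≤o⇒n≤o N₁ N₂ n≥₁₂)))

infixl 6 _+ᴿ_ _-ᴿ_
infixl 7 _*ᴿ_
infixr 8 _^ᴿ_
infix  8 -ᴿ_
infix  4 _≤ᴿ_ _<ᴿ_ _≃ᴿ_ _⟶_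

fromℚ : ℚ → ℝ
fromℚ q = mkℝ (λ _ → q) (const-cauchy q)

fromℤ : ℤ → ℝ
fromℤ z = fromℚ (z ℚ./ 1)

fromℕ : ℕ → ℝ
fromℕ n = fromℤ (+ n)

0ᴿ 1ᴿ : ℝ
0ᴿ = fromℚ 0ℚ
1ᴿ = fromℚ 1ℚ

-ᴿ_ : ℝ → ℝ
-ᴿ x = mkℝ (λ n → - seq x n) (neg-cauchy {seq x} (cauchy x))

_+ᴿ_ _-ᴿ_ _*ᴿ_ : ℝ → ℝ → ℝ
x +ᴿ y = mkℝ (λ n → seq x n + seq y n) (+-cauchy {seq x} {seq y} (cauchy x) (cauchy y))
x -ᴿ y = x +ᴿ (-ᴿ y)
x *ᴿ y = mkℝ (λ n → seq x n * seq y n) (*-cauchy {seq x} {seq y} (cauchy x) (cauchy y))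

_^ᴿ_ : ℝ → ℕ → ℝ
x ^ᴿ zero  = 1ᴿ
x ^ᴿ suc n = x *ᴿ x ^ᴿ n

_≤ᴿ_ _<ᴿ_ _≃ᴿ_ : ℝ → ℝ → Set
x ≤ᴿ y = ∀ ε → 0ℚ < ε → ∃[ N ] (∀ n → N ℕ.≤ n → seq x n ≤ seq y n + ε)
x <ᴿ y = ∃[ δ ] (0ℚ < δ × ∃[ N ] (∀ n → N ℕ.≤ n → seq x n + δ ≤ seq y n))
x ≃ᴿ y = x ≤ᴿ y × y ≤ᴿ x

_⟶_ : (ℕ → ℝ) → ℝ → Set
u ⟶ x = ∀ ε → 0ℚ < ε → ∃[ N ] (∀ n → N ℕ.≤ n →
          u n ≤ᴿ x +ᴿ fromℚ ε × x ≤ᴿ u n +ᴿ fromℚ ε)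

-- "q = a / b", for a positive denominator b.
IsQuotient : (a b q : ℝ) → Set
IsQuotient a b q = 0ᴿ <ᴿ b × q *ᴿ b ≃ᴿ a

expPartialSum : ℝ → ℕ → ℝ
expPartialSum y zero    = 0ᴿ
expPartialSum y (suc k) = expPartialSum y k +ᴿ (y ^ᴿ k) *ᴿ fromℚ ((+ 1 ℚ./ (k !)) {{k ℕₚ.!≢0}})

-- "l = log x" for the natural logarithm, i.e. exp l = x.
IsLog : (x l : ℝ) → Set
IsLog x l = expPartialSum l ⟶ x

-- Minima and maxima.  A quantity defined as a minimum or maximum is
-- given by its graph: "m is the minimum of the elements satisfying P".

IsLeast : {A : Set} → Rel A 0ℓ → (A → Set) → A → Set
IsLeast _≼_ P m = P m × (∀ x → P x → m ≼ x)

IsGreatest : {A : Set} → Rel A 0ℓ → (A → Set) → A → Set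
IsGreatest _≼_ P m = P m × (∀ x → P x → x ≼ m)

record SimpleGraph (V : Set) : Set₁ where
  field
    Adj        : V → V → Set
    adj-sym    : ∀ {u v} → Adj u v → Adj v u
    adj-irrefl : ∀ {v} → ¬ Adj v v

open SimpleGraph public

Proper : {V K : Set} → SimpleGraph V → (V → K) → Set
Proper G c = ∀ u v → Adj G u v → c u ≢ c v

Connected : {V : Set} → SimpleGraph V → Set
Connected {V} G = V × (∀ u v → Star (Adj G) u v)

IsChromaticNumber : {V : Set} → SimpleGraph V → ℕ → Set
IsChromaticNumber {V} G = IsLeast ℕ._≤_ (λ k → ∃[ c ] Proper {V} {Fin k} G c)

Induced : ∀ {n} → SimpleGraph (Fin n) → (S : Subset n) → SimpleGraph (∃ (_∈ S))
Induced G S = record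
  { Adj        = λ u v → Adj G (proj₁ u) (proj₁ v)
  ; adj-sym    = adj-sym G
  ; adj-irrefl = adj-irrefl G
  }

-- |c(H)| for the subgraph H induced by S.  Colours are arbitrary natural
-- numbers, so the number of colours of a colouring is not restricted.
#colours : ∀ {n} → (Fin n → ℕ) → Subset n → ℕ
#colours {n} c S = length (deduplicate ℕₚ._≟_ (List.map c (filter (_∈? S) (allFin n))))

module _ {n : ℕ} (G : SimpleGraph (Fin n)) where

  -- "z = |c(H)| - χ(H)" for the subgraph H induced by S.
  IsExcess : (Fin n → ℕ) → Subset n → ℤ → Set
  IsExcess c S z = ∃[ k ] (IsChromaticNumber (Induced G S) k × z ≡ + #colours c S ℤ.- + k)

  -- The empty S, allowed in φ_c, has excess 0, as has every single
  -- vertex; by the definition of Connected it is not allowed in φ̂_c.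
  Isφ-of Isφ̂-of : (Fin n → ℕ) → ℤ → Set
  Isφ-of c = IsGreatest ℤ._≤_ (λ z → ∃[ S ] IsExcess c S z)
  Isφ̂-of c = IsGreatest ℤ._≤_ (λ z → ∃[ S ] (Connected (Induced G S) × IsExcess c S z))

  Isφ Isφ̂ : ℤ → Set
  Isφ = IsLeast ℤ._≤_ (λ z → ∃[ c ] (Proper G c × Isφ-of c z))
  Isφ̂ = IsLeast ℤ._≤_ (λ z → ∃[ c ] (Proper G c × Isφ̂-of c z))

-- One bit for each of the pairs of distinct vertices: the first row
-- lists the pairs {0,1}, {0,2}, …, the remaining rows the pairs among
-- the vertices 1, 2, ….  Each labelled graph arises from exactly one
-- outcome.
data Outcome : ℕ → Set where
  []  : Outcome 0
  _∷_ : ∀ {n} → Vec Bool n → Outcome n → Outcome (suc n)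

edge : ∀ {n} → Outcome n → Fin n → Fin n → Bool
edge (r ∷ ω) zero    zero    = false
edge (r ∷ ω) zero    (suc j) = lookup r j
edge (r ∷ ω) (suc i) zero    = lookup r i
edge (r ∷ ω) (suc i) (suc j) = edge ω i j

edge-sym : ∀ {n} (ω : Outcome n) i j → edge ω i j ≡ edge ω j i
edge-sym (r ∷ ω) zero    zero    = refl
edge-sym (r ∷ ω) zero    (suc j) = refl
edge-sym (r ∷ ω) (suc i) zero    = refl
edge-sym (r ∷ ω) (suc i) (suc j) = edge-sym ω i j

edge-irrefl : ∀ {n} (ω : Outcome n) i → edge ω i i ≢ true
edge-irrefl (r ∷ ω) zero    ()
edge-irrefl (r ∷ ω) (suc i) e = edge-irrefl ω i e

graph : ∀ {n} → Outcome n → SimpleGraph (Fin n)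
graph ω = record
  { Adj        = λ i j → edge ω i j ≡ true
  ; adj-sym    = λ {i} {j} e → trans (edge-sym ω j i) e
  ; adj-irrefl = λ {i} → edge-irrefl ω i
  }

allRows : ∀ n → List (Vec Bool n)
allRows zero    = Vec.[] ∷ []
allRows (suc n) = cartesianProductWith Vec._∷_ (true ∷ false ∷ []) (allRows n)

allOutcomes : ∀ n → List (Outcome n)
allOutcomes zero    = [] ∷ []
allOutcomes (suc n) = cartesianProductWith _∷_ (allRows n) (allOutcomes n)

module _ (p : ℝ) where

  rowProbability : ∀ {n} → Vec Bool n → ℝ
  rowProbability = Vec.foldr′ (λ b q → (if b then p else 1ᴿ -ᴿ p) *ᴿ q) 1ᴿ

  probability : ∀ {n} → Outcome n → ℝ
  probability []      = 1ᴿ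
  probability (r ∷ ω) = rowProbability r *ᴿ probability ω

  Pr : ∀ {n} → (Outcome n → Bool) → ℝ
  Pr {n} E = List.foldr (λ ω q → (if E ω then probability ω else 0ᴿ) +ᴿ q) 0ᴿ (allOutcomes n)

-- Q holds a.a.s. in G(n,p(n)).  Properties involving reals are not
-- decidable, so the probability is that of a decidable event contained
-- in Q; classically Q is itself such an event, and this says that the
-- probability of Q tends to 1.
AAS : (ℕ → ℝ) → (∀ n → SimpleGraph (Fin n) → Set) → Set
AAS p Q = Σ[ E ∈ (∀ n → Outcome n → Bool) ]
            ((∀ n ω → E n ω ≡ true → Q n (graph ω))
             × (λ n → Pr (p n) (E n)) ⟶ 1ᴿ)

{-# OPTIONS --safe #-}
-- Write p ≈ 1/w, np ≈ 2^t, a = 4tw and d = O(t).  With high probability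
--   (1) any two disjoint sets of a vertices are joined by an edge, and
--   (2) every nonempty set S of at most a vertices spans fewer than d|S|
--       edges, so that such sets are 2d-colourable by degeneracy.
-- Both are first moment estimates; for (2) the number of edges is replaced
-- by the exponential moment x^edges with x ≈ 2a/|S|.  By (1) independent
-- sets have at most 2a vertices, so χ(G) ≥ n/2a.  Also by (1), growing
-- connected sets greedily yields a connected D with exactly a vertices, and
-- the set R of the vertices outside D without a neighbour in D has at most a
-- vertices, so that G - R still needs χ(G) - 2d colours.  Given a proper
-- colouring c, add to D at most χ(G) vertices of new colours which are
-- dominated by D.  The result H is connected, |c(H)| ≥ χ(G) - 2d, and, as H
-- is covered by D and χ(G)/a + 1 further sets of at most a vertices,
-- χ(H) ≤ 2d(χ(G)/a + 2).  Since χ(G) ≥ n/2a ≥ Ω(2^t/t), t³ = O(2^t), and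
-- t = O(w) because p < 1/log² n, the loss is O(χ(G)/t).
module Submission where

-- The order of the reals is undecidable, but the event required by `AAS` is a Boolean function of
-- the outcome. The event chosen is that a rational weighted count of obstructions is below 1; it
-- involves p only through the integers w and t. These are read off one rational approximation of p,
-- with enough slack for the same inequalities to hold for all later approximations q. Since the
-- probability of an event is a polynomial in p, its approximations are exact probabilities in G(n,
-- q), so that only rational densities have to be analysed. As C is at our disposal, constant
-- factors are given away freely: binary logarithms replace natural ones by means of 2^T ≤ e^T and
-- e^(T/2) ≤ 2^T, and sums over weighted labellings replace binomial coefficients. The statement
-- also demands χ, φ, φ̂, log(np) and the quotient as witnesses. The extrema come from finite
-- searches, log(np) from a Cauchy sequence of grid points. In contrast log n is given by its series
-- only and could a priori be negative; excluding this takes an estimate of the exponential series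
-- at negative arguments.

-- Rational arithmetic, Bernoulli's inequality and powers of 1 + 1/n.

module Rationals where

  open import Data.Integer.Base as ℤ using (+_)
  open import Data.Nat.Base as ℕ using (ℕ; zero; suc)
  import Data.Nat.Properties as ℕₚ
  import Data.Integer.Properties as ℤₚ
  open import Data.Maybe.Base using (Maybe)
  open import Data.Product using (∃-syntax; _×_; _,_)
  open import Data.Sum using (inj₁; inj₂)
  open import Data.Rational.Base as ℚ using (ℚ; 0ℚ; 1ℚ; ½; _≤_; _<_; 1/_) public
  import Data.Rational.Unnormalised.Base as ℚᵘ
  import Data.Rational.Unnormalised.Properties as ℚᵘₚ
  import Data.Rational.Properties as ℚₚ
  open ℚₚ public using (≤-refl; ≤-reflexive; ≤-trans; ≤-total; <⇒≤; ≮⇒≥; ≰⇒>; <-irrefl; <-≤-trans; ≤-<-trans;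
    _≤?_; _<?_; positive⁻¹; nonNegative⁻¹; module ≤-Reasoning)
  import Algebra.Bundles as B
  import Algebra.Properties.AbelianGroup
  import Algebra.Solver.Ring as RingSolver
  import Algebra.Solver.Ring.AlmostCommutativeRing as ACR
  open import Relation.Binary.PropositionalEquality using (_≡_; refl; sym; trans; cong; cong₂; subst; subst₂)
  open import Algebra.Structures {A = ℚ} _≡_ using (IsCommutativeRing)
  open import Relation.Nullary using (¬_; yes; no; contradiction)
  open import Relation.Nullary.Decidable using (dec⇒maybe)

  infixl 6 _+_ _-_
  infixl 7 _*_
  infix  8 -_

  -- The rational operations are made opaque: unfolding them makes the
  -- comparison of arithmetical expressions unfeasible.
  opaque
    _+_ _*_ : ℚ → ℚ → ℚ
    _+_ = ℚ._+_
    _*_ = ℚ._*_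

    -_ : ℚ → ℚ
    -_ = ℚ.-_

    +≡ : ∀ a b → a ℚ.+ b ≡ a + b
    +≡ a b = refl

    *≡ : ∀ a b → a ℚ.* b ≡ a * b
    *≡ a b = refl

    -≡ : ∀ a → ℚ.- a ≡ - a
    -≡ a = refl

    isCommutativeRing : IsCommutativeRing _+_ _*_ -_ 0ℚ 1ℚ
    isCommutativeRing = ℚₚ.+-*-isCommutativeRing

    +-mono-≤ : ∀ {a b c d} → a ≤ b → c ≤ d → a + c ≤ b + d
    +-mono-≤ = ℚₚ.+-mono-≤

    +-monoˡ-< : ∀ c {a b} → a < b → a + c < b + c
    +-monoˡ-< c = ℚₚ.+-monoˡ-< c

    0≤* : ∀ {a b} → 0ℚ ≤ a → 0ℚ ≤ b → 0ℚ ≤ a * b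
    0≤* {a} {b} p q = nonNegative⁻¹ (a ℚ.* b) {{ℚₚ.nonNeg*nonNeg⇒nonNeg a {{ℚ.nonNegative p}} b {{ℚ.nonNegative q}}}}

    0<* : ∀ {a b} → 0ℚ < a → 0ℚ < b → 0ℚ < a * b
    0<* {a} {b} p q = positive⁻¹ (a ℚ.* b) {{ℚₚ.pos*pos⇒pos a {{ℚ.positive p}} b {{ℚ.positive q}}}}

    *-cancelʳ : ∀ {a b c} → 0ℚ < c → a * c ≤ b * c → a ≤ b
    *-cancelʳ {c = c} 0<c = ℚₚ.*-cancelʳ-≤-pos c {{ℚ.positive 0<c}}

    inv : ∀ {a} → 0ℚ < a → ∃[ b ] (0ℚ < b × b * a ≡ 1ℚ)
    inv {a} 0<a = (1/ a) , positive⁻¹ (1/ a) {{ℚₚ.1/pos⇒pos a}} , ℚₚ.*-inverseˡ a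
      where
      instance
        pos : ℚ.Positive a
        pos = ℚ.positive 0<a
        nonZero : ℚ.NonZero a
        nonZero = ℚₚ.pos⇒nonZero a

    ι : ℕ → ℚ
    ι n = + n ℚ./ 1

    ι≡ : ∀ n → + n ℚ./ 1 ≡ ι n
    ι≡ n = refl

    ι0≡0 : ι 0 ≡ 0ℚ
    ι0≡0 = refl

    ι2≡2 : ι 2 ≡ + 2 ℚ./ 1
    ι2≡2 = refl

    ι-suc : ∀ n → ι (suc n) ≡ 1ℚ + ι n
    ι-suc n = ℚₚ.toℚᵘ-injective (ℚᵘₚ.≃-trans (ℚₚ.toℚᵘ-fromℚᵘ (+ suc n ℚᵘ./ 1))
      (ℚᵘₚ.≃-sym (ℚᵘₚ.≃-trans (ℚₚ.toℚᵘ-homo-+ 1ℚ (ι n))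
        (ℚᵘₚ.≃-trans (ℚᵘₚ.+-congʳ (ℚ.toℚᵘ 1ℚ) (ℚₚ.toℚᵘ-fromℚᵘ (+ n ℚᵘ./ 1)))
          (ℚᵘ.*≡* (cong (ℤ._* + 1) (trans (cong (λ z → ℤ.1ℤ ℤ.+ z) (ℤₚ.*-identityʳ (+ n))) refl)))))))

    reciprocal : ∀ m .{{_ : ℕ.NonZero m}} → (+ 1 ℚ./ m) * ι m ≡ 1ℚ
    reciprocal (suc m) = ℚₚ.toℚᵘ-injective (ℚᵘₚ.≃-trans (ℚₚ.toℚᵘ-homo-* (+ 1 ℚ./ suc m) (ι (suc m)))
      (ℚᵘₚ.≃-trans (ℚᵘₚ.*-cong (ℚₚ.toℚᵘ-fromℚᵘ (+ 1 ℚᵘ./ suc m)) (ℚₚ.toℚᵘ-fromℚᵘ (+ suc m ℚᵘ./ 1)))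
        (ℚᵘ.*≡* (trans (ℤₚ.*-identityʳ _) (trans (ℤₚ.*-identityˡ (+ suc m)) (sym (trans (ℤₚ.*-identityˡ _) (ℤₚ.*-identityʳ (+ suc m)))))))))

    difference-≤ : ∀ a b z → + a ℤ.- + b ℤ.≤ z → ι a ≤ (z ℚ./ 1) + ι b
    difference-≤ a b z h = ℚₚ.toℚᵘ-cancel-≤ (ℚᵘₚ.≤-respʳ-≃ (ℚᵘₚ.≃-sym (ℚᵘₚ.≃-trans (ℚₚ.toℚᵘ-homo-+ (z ℚ./ 1) (ι b))
        (ℚᵘₚ.+-cong (ℚₚ.toℚᵘ-fromℚᵘ (z ℚᵘ./ 1)) (ℚₚ.toℚᵘ-fromℚᵘ (+ b ℚᵘ./ 1)))))
      (ℚᵘₚ.≤-respˡ-≃ (ℚᵘₚ.≃-sym (ℚₚ.toℚᵘ-fromℚᵘ (+ a ℚᵘ./ 1)))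
        (ℚᵘ.*≤* (subst₂ ℤ._≤_ (sym (ℤₚ.*-identityʳ (+ a)))
          (sym (trans (ℤₚ.*-identityʳ _) (cong₂ ℤ._+_ (ℤₚ.*-identityʳ z) (ℤₚ.*-identityʳ (+ b))))) a≤z+b))))
      where
      a≤z+b : + a ℤ.≤ z ℤ.+ + b
      a≤z+b = subst (ℤ._≤ z ℤ.+ + b) (trans (ℤₚ.+-assoc (+ a) (ℤ.- + b) (+ b))
        (trans (cong (ℤ._+_ (+ a)) (ℤₚ.+-inverseˡ (+ b))) (ℤₚ.+-identityʳ (+ a)))) (ℤₚ.+-monoˡ-≤ (+ b) h)

    private
      ≤∣∣ : ∀ a → a ≤ ℚ.∣ a ∣
      ≤∣∣ a with ≤-total 0ℚ a
      ... | inj₁ 0≤a = ≤-reflexive (sym (ℚₚ.0≤p⇒∣p∣≡p 0≤a))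
      ... | inj₂ a≤0 = ≤-trans a≤0 (ℚₚ.0≤∣p∣ a)

      negneg : ∀ b → ℚ.- (ℚ.- b) ≡ b
      negneg b = Algebra.Properties.AbelianGroup.⁻¹-involutive ℚₚ.+-0-abelianGroup b

      -flip : ∀ a b → ℚ.- (a ℚ.+ ℚ.- b) ≡ b ℚ.+ ℚ.- a
      -flip a b = trans (ℚₚ.neg-distrib-+ a (ℚ.- b)) (trans (cong (ℚ._+_ (ℚ.- a)) (negneg b)) (ℚₚ.+-comm (ℚ.- a) b))

      ≤-shift : ∀ {a b ε} → a ℚ.+ ℚ.- b ≤ ε → a ≤ b + ε
      ≤-shift {a} {b} {ε} h = subst₂ _≤_ eq (ℚₚ.+-comm ε b) (ℚₚ.+-monoˡ-≤ b h)
        where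
        eq : a ℚ.+ ℚ.- b ℚ.+ b ≡ a
        eq = trans (ℚₚ.+-assoc a (ℚ.- b) b) (trans (cong (ℚ._+_ a) (ℚₚ.+-inverseˡ b)) (ℚₚ.+-identityʳ a))

      ≤-unshift : ∀ {a b ε} → a ≤ b + ε → a ℚ.+ ℚ.- b ≤ ε
      ≤-unshift {a} {b} {ε} h = ≤-trans (ℚₚ.+-monoˡ-≤ (ℚ.- b) h) (≤-reflexive
        (trans (cong (ℚ._+ (ℚ.- b)) (ℚₚ.+-comm b ε)) (trans (ℚₚ.+-assoc ε b (ℚ.- b)) (trans (cong (ℚ._+_ ε) (ℚₚ.+-inverseʳ b)) (ℚₚ.+-identityʳ ε)))))

    ∣-∣≤⁻ : ∀ {a b ε} → ℚ.∣ a ℚ.- b ∣ ≤ ε → a ≤ b + ε × b ≤ a + ε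
    ∣-∣≤⁻ {a} {b} {ε} h = ≤-shift (≤-trans (≤∣∣ (a ℚ.- b)) h) ,
      ≤-shift (≤-trans (≤-reflexive (sym (-flip a b))) (≤-trans (≤∣∣ (ℚ.- (a ℚ.- b))) (≤-trans (≤-reflexive (ℚₚ.∣-p∣≡∣p∣ (a ℚ.- b))) h)))

    ∣-∣≤⁺ : ∀ {a b ε} → a ≤ b + ε → b ≤ a + ε → ℚ.∣ a ℚ.- b ∣ ≤ ε
    ∣-∣≤⁺ {a} {b} {ε} h k with ℚₚ.∣p∣≡p∨∣p∣≡-p (a ℚ.- b)
    ... | inj₁ eq = ≤-trans (≤-reflexive eq) (≤-unshift h)
    ... | inj₂ eq = ≤-trans (≤-reflexive (trans eq (-flip a b))) (≤-unshift k)

    -- The absolute value of the numerator suffices, since the denominator is at least 1.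
    archimedean : ∀ a → ∃[ n ] a ≤ ι n
    archimedean a = ℤ.∣ ℚ.↥ a ∣ , subst (_≤ ι m) (ℚₚ.↥p/↧p≡p a) bound
      where
      m : ℕ
      m = ℤ.∣ ℚ.↥ a ∣
      i≤∣i∣ : ∀ i → i ℤ.≤ + ℤ.∣ i ∣
      i≤∣i∣ (+ n)        = ℤₚ.≤-refl
      i≤∣i∣ (ℤ.-[1+ n ]) = ℤ.-≤+
      bound : ℚ.↥ a ℚ./ ℚ.↧ₙ a ≤ ι m
      bound = ℚₚ.toℚᵘ-cancel-≤ (ℚᵘₚ.≤-respʳ-≃ (ℚᵘₚ.≃-sym (ℚₚ.toℚᵘ-fromℚᵘ (+ m ℚᵘ./ 1)))
        (ℚᵘₚ.≤-respˡ-≃ (ℚᵘₚ.≃-sym (ℚₚ.toℚᵘ-fromℚᵘ (ℚ.↥ a ℚᵘ./ ℚ.↧ₙ a)))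
          (ℚᵘ.*≤* (ℤₚ.≤-trans (ℤₚ.≤-reflexive (ℤₚ.*-identityʳ (ℚ.↥ a)))
            (ℤₚ.≤-trans (i≤∣i∣ (ℚ.↥ a)) (subst (λ z → z ℤ.≤ (+ m) ℤ.* ℚ.↧ a) (ℤₚ.*-identityʳ (+ m))
              (ℤₚ.*-monoˡ-≤-nonNeg (+ m) (ℤ.+≤+ (ℕ.s≤s ℕ.z≤n)))))))))

  _-_ : ℚ → ℚ → ℚ
  a - b = a + (- b)

  commutativeRing : B.CommutativeRing _ _
  commutativeRing = record { isCommutativeRing = isCommutativeRing }

  open IsCommutativeRing isCommutativeRing public
    using (+-assoc; +-comm; +-identityˡ; +-identityʳ; *-assoc; *-comm; *-identityˡ; *-identityʳ; zeroˡ; zeroʳ)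
    renaming (distribˡ to *-distribˡ-+; distribʳ to *-distribʳ-+; -‿inverseʳ to +-inverseʳ)

  open import Algebra.Properties.CommutativeSemiring.Exp (B.CommutativeRing.commutativeSemiring commutativeRing) public
    using (_^_; ^-homo-*; ^-assocʳ; ^-distrib-*)

  private
    solverRing : ACR.AlmostCommutativeRing _ _
    solverRing = ACR.fromCommutativeRing commutativeRing

    -- The coefficients are the rationals with the transparent operations,
    -- so that they can be computed with.
    coefficients : B.CommutativeRing.rawRing ℚₚ.+-*-commutativeRing ACR.-Raw-AlmostCommutative⟶ solverRing
    coefficients = record { ⟦_⟧ = λ a → a ; +-homo = +≡ ; *-homo = *≡ ; -‿homo = -≡ ; 0-homo = refl ; 1-homo = refl }

    coefficient≟ : ∀ (a b : ℚ) → Maybe (a ≡ b)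
    coefficient≟ a b = dec⇒maybe (a ℚₚ.≟ b)

  open RingSolver (B.CommutativeRing.rawRing ℚₚ.+-*-commutativeRing) solverRing coefficients coefficient≟ public
    using (solve; _:=_; _:+_; _:*_; _:-_; :-_; con)

  2ℚ : ℚ
  2ℚ = + 2 ℚ./ 1

  0≤+ : ∀ {a b} → 0ℚ ≤ a → 0ℚ ≤ b → 0ℚ ≤ a + b
  0≤+ {a} {b} p q = subst (_≤ a + b) (+-identityˡ 0ℚ) (+-mono-≤ p q)

  +-monoʳ-≤ : ∀ c {a b} → a ≤ b → c + a ≤ c + b
  +-monoʳ-≤ c = +-mono-≤ (≤-refl {c})

  +-monoˡ-≤ : ∀ c {a b} → a ≤ b → a + c ≤ b + c
  +-monoˡ-≤ c a≤b = +-mono-≤ a≤b (≤-refl {c})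

  -- Most estimates below have this shape: the difference of the two sides is written as a sum of
  -- products of quantities known to be nonnegative, and the ring solver verifies the identity.
  ≤-cert : ∀ {a b} d → 0ℚ ≤ d → a + d ≡ b → a ≤ b
  ≤-cert {a} d 0≤d e = subst₂ _≤_ (+-identityʳ a) e (+-monoʳ-≤ a 0≤d)

  0≤- : ∀ {a b} → a ≤ b → 0ℚ ≤ b - a
  0≤- {a} {b} a≤b = subst (_≤ b - a) (+-inverseʳ a) (+-monoˡ-≤ (- a) a≤b)

  0≤2 : 0ℚ ≤ 2ℚ
  0≤2 = nonNegative⁻¹ 2ℚ

  0≤½ : 0ℚ ≤ ½
  0≤½ = nonNegative⁻¹ ½

  0≤1 : 0ℚ ≤ 1ℚ
  0≤1 = nonNegative⁻¹ 1ℚ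

  *-mono : ∀ {a b c d} → 0ℚ ≤ a → 0ℚ ≤ d → a ≤ b → c ≤ d → a * c ≤ b * d
  *-mono {a} {b} {c} {d} 0≤a 0≤d a≤b c≤d = ≤-cert ((b - a) * d + a * (d - c))
    (0≤+ (0≤* (0≤- a≤b) 0≤d) (0≤* 0≤a (0≤- c≤d)))
    (solve 4 (λ a b c d → a :* c :+ ((b :- a) :* d :+ a :* (d :- c)) := b :* d) refl a b c d)

  *-monoˡ : ∀ {a b c} → 0ℚ ≤ c → a ≤ b → c * a ≤ c * b
  *-monoˡ {a} {b} {c} 0≤c a≤b = ≤-cert (c * (b - a)) (0≤* 0≤c (0≤- a≤b))
    (solve 3 (λ a b c → c :* a :+ c :* (b :- a) := c :* b) refl a b c)

  *-monoʳ : ∀ {a b c} → 0ℚ ≤ c → a ≤ b → a * c ≤ b * c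
  *-monoʳ {a} {b} {c} 0≤c a≤b = subst₂ _≤_ (*-comm c a) (*-comm c b) (*-monoˡ 0≤c a≤b)

  ι1≡1 : ι 1 ≡ 1ℚ
  ι1≡1 = trans (ι-suc 0) (trans (cong (_+_ 1ℚ) ι0≡0) (+-identityʳ 1ℚ))

  ι-+ : ∀ m n → ι (m ℕ.+ n) ≡ ι m + ι n
  ι-+ zero    n = sym (trans (cong (_+ ι n) ι0≡0) (+-identityˡ (ι n)))
  ι-+ (suc m) n = trans (ι-suc (m ℕ.+ n)) (trans (cong (_+_ 1ℚ) (ι-+ m n))
    (trans (sym (+-assoc 1ℚ (ι m) (ι n))) (cong (_+ ι n) (sym (ι-suc m)))))

  ι-* : ∀ m n → ι (m ℕ.* n) ≡ ι m * ι n
  ι-* zero    n = trans ι0≡0 (sym (trans (cong (_* ι n) ι0≡0) (zeroˡ (ι n))))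
  ι-* (suc m) n = trans (ι-+ n (m ℕ.* n)) (trans (cong (_+_ (ι n)) (ι-* m n))
    (trans (solve 2 (λ m n → n :+ m :* n := (con 1ℚ :+ m) :* n) refl (ι m) (ι n))
           (cong (_* ι n) (sym (ι-suc m)))))

  ι-^ : ∀ m n → ι (m ℕ.^ n) ≡ ι m ^ n
  ι-^ m zero    = ι1≡1
  ι-^ m (suc n) = trans (ι-* m (m ℕ.^ n)) (cong (ι m *_) (ι-^ m n))

  0≤ι : ∀ n → 0ℚ ≤ ι n
  0≤ι zero    = ≤-reflexive (sym ι0≡0)
  0≤ι (suc n) = subst (0ℚ ≤_) (sym (ι-suc n)) (0≤+ 0≤1 (0≤ι n))

  ι-mono : ∀ {m n} → m ℕ.≤ n → ι m ≤ ι n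
  ι-mono {m} {n} m≤n with ℕₚ.m≤n⇒∃[o]m+o≡n m≤n
  ... | o , refl = ≤-cert (ι o) (0≤ι o) (sym (ι-+ m o))

  ι-mono-< : ∀ {m n} → m ℕ.< n → ι m < ι n
  ι-mono-< {m} {n} m<n = <-≤-trans
    (subst₂ _<_ (+-identityˡ (ι m)) (sym (ι-suc m)) (+-monoˡ-< (ι m) {0ℚ} {1ℚ} (positive⁻¹ 1ℚ))) (ι-mono m<n)

  ι-cancel-≤ : ∀ {m n} → ι m ≤ ι n → m ℕ.≤ n
  ι-cancel-≤ {m} {n} h with m ℕₚ.≤? n
  ... | yes m≤n = m≤n
  ... | no m≰n = contradiction (<-≤-trans (ι-mono-< (ℕₚ.≰⇒> m≰n)) h) (<-irrefl refl)

  ι-cancel-< : ∀ {m n} → ι m < ι n → m ℕ.< n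
  ι-cancel-< {m} {n} h with m ℕₚ.<? n
  ... | yes m<n = m<n
  ... | no m≮n = contradiction (<-≤-trans h (ι-mono (ℕₚ.≮⇒≥ m≮n))) (<-irrefl refl)

  0<ι : ∀ {n} → 0 ℕ.< n → 0ℚ < ι n
  0<ι {n} h = subst (_< ι n) ι0≡0 (ι-mono-< h)

  0≤^ : ∀ {a} n → 0ℚ ≤ a → 0ℚ ≤ a ^ n
  0≤^ zero    0≤a = 0≤1
  0≤^ (suc n) 0≤a = 0≤* 0≤a (0≤^ n 0≤a)

  0<^ : ∀ {a} n → 0ℚ < a → 0ℚ < a ^ n
  0<^ zero    0<a = positive⁻¹ 1ℚ
  0<^ (suc n) 0<a = 0<* 0<a (0<^ n 0<a)

  ^-mono : ∀ {a b} n → 0ℚ ≤ a → a ≤ b → a ^ n ≤ b ^ n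
  ^-mono zero    0≤a a≤b = ≤-refl
  ^-mono (suc n) 0≤a a≤b = *-mono 0≤a (0≤^ n (≤-trans 0≤a a≤b)) a≤b (^-mono n 0≤a a≤b)

  1^ : ∀ n → 1ℚ ^ n ≡ 1ℚ
  1^ zero    = refl
  1^ (suc n) = trans (*-identityˡ (1ℚ ^ n)) (1^ n)

  1≤^ : ∀ {a} n → 1ℚ ≤ a → 1ℚ ≤ a ^ n
  1≤^ {a} n 1≤a = subst (_≤ a ^ n) (1^ n) (^-mono n 0≤1 1≤a)

  ^≤1 : ∀ {a} n → 0ℚ ≤ a → a ≤ 1ℚ → a ^ n ≤ 1ℚ
  ^≤1 {a} n 0≤a a≤1 = subst (a ^ n ≤_) (1^ n) (^-mono n 0≤a a≤1)

  ^-monoʳ : ∀ {a m n} → 1ℚ ≤ a → m ℕ.≤ n → a ^ m ≤ a ^ n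
  ^-monoʳ {a} {m} {n} 1≤a m≤n with ℕₚ.m≤n⇒∃[o]m+o≡n m≤n
  ... | o , refl = subst₂ _≤_ (*-identityʳ (a ^ m)) (sym (^-homo-* a m o))
    (*-monoˡ (0≤^ m (≤-trans 0≤1 1≤a)) (1≤^ o 1≤a))

  ^-antimonoʳ : ∀ {a m n} → 0ℚ ≤ a → a ≤ 1ℚ → m ℕ.≤ n → a ^ n ≤ a ^ m
  ^-antimonoʳ {a} {m} {n} 0≤a a≤1 m≤n with ℕₚ.m≤n⇒∃[o]m+o≡n m≤n
  ... | o , refl = subst₂ _≤_ (sym (^-homo-* a m o)) (*-identityʳ (a ^ m))
    (*-monoˡ (0≤^ m 0≤a) (^≤1 o 0≤a a≤1))

  -- The induction step leaves the surplus n h², which is nonnegative whatever the sign of h.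
  -- Negative h do occur: `[1+h]^n≤4` needs the bound for powers of 1 - h/2.
  bernoulli : ∀ h n → 0ℚ ≤ 1ℚ + h → 1ℚ + ι n * h ≤ (1ℚ + h) ^ n
  bernoulli h zero    p = ≤-reflexive (trans (cong (λ s → 1ℚ + s * h) ι0≡0) (solve 1 (λ h → con 1ℚ :+ con 0ℚ :* h := con 1ℚ) refl h))
  bernoulli h (suc n) p = ≤-trans
    (≤-cert (ι n * (h * h)) (0≤* (0≤ι n) 0≤h²)
      (trans (cong (λ s → 1ℚ + s * h + ι n * (h * h)) (ι-suc n))
        (solve 2 (λ h n → con 1ℚ :+ (con 1ℚ :+ n) :* h :+ n :* (h :* h) := (con 1ℚ :+ h) :* (con 1ℚ :+ n :* h))
          refl h (ι n))))
    (*-monoˡ p (bernoulli h n p))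
    where
    0≤h² : 0ℚ ≤ h * h
    0≤h² with ≤-total 0ℚ h
    ... | inj₁ q = 0≤* q q
    ... | inj₂ q = subst (0ℚ ≤_) (solve 1 (λ h → (con 0ℚ :- h) :* (con 0ℚ :- h) := h :* h) refl h) (0≤* (0≤- q) (0≤- q))

  -- Split 1 + h ≤ (1 + h/2)² and use (1 + h/2)ⁿ (1 - h/2)ⁿ ≤ 1 with
  -- Bernoulli's (1 - h/2)ⁿ ≥ 1/2.
  [1+h]^n≤4 : ∀ h n → 0ℚ ≤ h → h ≤ 1ℚ → ι n * h ≤ 1ℚ → (1ℚ + h) ^ n ≤ ι 4
  [1+h]^n≤4 h n 0≤h h≤1 nh≤1 = begin
    (1ℚ + h) ^ n            ≤⟨ ^-mono n (0≤+ 0≤1 0≤h) (≤-cert (k * k) (0≤* 0≤k 0≤k)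
                                 (solve 1 (λ h → con 1ℚ :+ h :+ (h :* con ½) :* (h :* con ½)
                                   := (con 1ℚ :+ h :* con ½) :* (con 1ℚ :+ h :* con ½)) refl h)) ⟩
    ((1ℚ + k) * (1ℚ + k)) ^ n        ≡⟨ ^-distrib-* (1ℚ + k) (1ℚ + k) n ⟩
    (1ℚ + k) ^ n * (1ℚ + k) ^ n      ≤⟨ *-mono 0≤P 0≤2 P≤2 P≤2 ⟩
    2ℚ * 2ℚ                          ≡⟨ sym (trans (ι-* 2 2) (cong₂ _*_ ι2≡2 ι2≡2)) ⟩
    ι 4                              ∎
    where
    open ≤-Reasoning
    k = h * ½
    0≤k : 0ℚ ≤ k
    0≤k = 0≤* 0≤h 0≤½
    0≤1-k : 0ℚ ≤ 1ℚ - k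
    0≤1-k = subst (0ℚ ≤_) (solve 1 (λ h → con ½ :+ (con 1ℚ :- h) :* con ½ := con 1ℚ :- h :* con ½) refl h)
      (0≤+ 0≤½ (0≤* (0≤- h≤1) 0≤½))
    P = (1ℚ + k) ^ n
    0≤P : 0ℚ ≤ P
    0≤P = 0≤^ n (0≤+ 0≤1 0≤k)
    ½≤M : ½ ≤ (1ℚ - k) ^ n
    ½≤M = ≤-trans
      (≤-cert ((1ℚ - ι n * h) * ½) (0≤* (0≤- nh≤1) 0≤½)
        (solve 2 (λ h n → con ½ :+ (con 1ℚ :- n :* h) :* con ½ := con 1ℚ :+ n :* (:- (h :* con ½))) refl h (ι n)))
      (bernoulli (- k) n 0≤1-k)
    PM≤1 : P * (1ℚ - k) ^ n ≤ 1ℚ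
    PM≤1 = ≤-trans (≤-reflexive (sym (^-distrib-* (1ℚ + k) (1ℚ - k) n)))
      (^≤1 n (0≤* (0≤+ 0≤1 0≤k) 0≤1-k)
        (≤-cert (k * k) (0≤* 0≤k 0≤k) (solve 1 (λ k → (con 1ℚ :+ k) :* (con 1ℚ :- k) :+ k :* k := con 1ℚ) refl k)))
    P≤2 : P ≤ 2ℚ
    P≤2 = ≤-cert ((1ℚ - P * (1ℚ - k) ^ n) * 2ℚ + P * ((1ℚ - k) ^ n - ½) * 2ℚ)
      (0≤+ (0≤* (0≤- PM≤1) 0≤2) (0≤* (0≤* 0≤P (0≤- ½≤M)) 0≤2))
      (solve 2 (λ P M → P :+ ((con 1ℚ :- P :* M) :* con 2ℚ :+ P :* (M :- con ½) :* con 2ℚ) := con 2ℚ)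
        refl P ((1ℚ - k) ^ n))

  -- Read h as 1/n.

  [1+bh]^n≤4^b : ∀ h n b → 0ℚ ≤ h → h ≤ 1ℚ → ι n * h ≤ 1ℚ → (1ℚ + ι b * h) ^ n ≤ ι 4 ^ b
  [1+bh]^n≤4^b h n b 0≤h h≤1 nh≤1 = begin
    (1ℚ + ι b * h) ^ n    ≤⟨ ^-mono n (0≤+ 0≤1 (0≤* (0≤ι b) 0≤h)) (bernoulli h b (0≤+ 0≤1 0≤h)) ⟩
    ((1ℚ + h) ^ b) ^ n    ≡⟨ ^-assocʳ (1ℚ + h) b n ⟩
    (1ℚ + h) ^ (b ℕ.* n)  ≡⟨ cong ((1ℚ + h) ^_) (ℕₚ.*-comm b n) ⟩
    (1ℚ + h) ^ (n ℕ.* b)  ≡⟨ ^-assocʳ (1ℚ + h) n b ⟨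
    ((1ℚ + h) ^ n) ^ b    ≤⟨ ^-mono b (0≤^ n (0≤+ 0≤1 0≤h)) ([1+h]^n≤4 h n 0≤h h≤1 nh≤1) ⟩
    ι 4 ^ b               ∎
    where open ≤-Reasoning

  -- The product with (1 + q)^w is (1 - q²)^w ≤ 1, while (1 + q)^w ≥ 1 + wq ≥ 2 by Bernoulli's
  -- inequality.
  [1-q]^w≤½ : ∀ q w → 0ℚ ≤ q → q ≤ 1ℚ → 1ℚ ≤ ι w * q → (1ℚ - q) ^ w ≤ ½
  [1-q]^w≤½ q w 0≤q q≤1 1≤wq = ≤-cert ((1ℚ - M * P) * ½ + M * (P - 2ℚ) * ½)
      (0≤+ (0≤* (0≤- MP≤1) 0≤½) (0≤* (0≤* 0≤M (0≤- 2≤P)) 0≤½))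
      (solve 2 (λ P M → M :+ ((con 1ℚ :- M :* P) :* con ½ :+ M :* (P :- con 2ℚ) :* con ½) := con ½) refl P M)
    where
    P = (1ℚ + q) ^ w
    M = (1ℚ - q) ^ w
    0≤M : 0ℚ ≤ M
    0≤M = 0≤^ w (0≤- q≤1)
    2≤P : 2ℚ ≤ P
    2≤P = ≤-trans (≤-trans (≤-reflexive (+≡ 1ℚ 1ℚ)) (+-monoʳ-≤ 1ℚ 1≤wq)) (bernoulli q w (0≤+ 0≤1 0≤q))
    MP≤1 : M * P ≤ 1ℚ
    MP≤1 = ≤-trans (≤-reflexive (sym (^-distrib-* (1ℚ - q) (1ℚ + q) w)))
      (^≤1 w (0≤* (0≤- q≤1) (0≤+ 0≤1 0≤q))
        (≤-cert (q * q) (0≤* 0≤q 0≤q) (solve 1 (λ q → (con 1ℚ :- q) :* (con 1ℚ :+ q) :+ q :* q := con 1ℚ) refl q)))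

-- Partial sums of the exponential series at nonnegative arguments.

module Exponential where

  open Rationals
  import Data.Rational.Base as ℚ
  open import Data.Integer.Base using (+_)
  open import Data.Nat.Base as ℕ using (ℕ; zero; suc; _!)
  import Data.Nat.Properties as ℕₚ
  open import Data.Product using (∃-syntax; _×_; _,_; proj₁; proj₂)
  open import Relation.Binary.PropositionalEquality using (_≡_; refl; sym; trans; cong; cong₂)

  opaque
    1/! : ℕ → ℚ
    1/! k = (+ 1 ℚ./ (k !)) {{k ℕₚ.!≢0}}

    1/!≡ : ∀ k → (+ 1 ℚ./ (k !)) {{k ℕₚ.!≢0}} ≡ 1/! k
    1/!≡ k = refl

    1/!*! : ∀ k → 1/! k * ι (k !) ≡ 1ℚ
    1/!*! k = reciprocal (k !) {{k ℕₚ.!≢0}}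

    1/!-zero : 1/! 0 ≡ 1ℚ
    1/!-zero = refl

  1/!-suc : ∀ k → 1/! (suc k) * ι (suc k) ≡ 1/! k
  1/!-suc k = trans (sym (*-identityʳ _)) (trans (cong (1/! (suc k) * ι (suc k) *_) (trans (sym (1/!*! k)) (*-comm (1/! k) (ι (k !)))))
    (trans (solve 4 (λ a b c d → a :* b :* (c :* d) := a :* (b :* c) :* d) refl (1/! (suc k)) (ι (suc k)) (ι (k !)) (1/! k))
      (trans (cong (λ s → 1/! (suc k) * s * 1/! k) (sym (ι-* (suc k) (k !))))
        (trans (cong (_* 1/! k) (1/!*! (suc k))) (*-identityˡ (1/! k))))))

  0<! : ∀ k → 0ℚ < ι (k !)
  0<! k = 0<ι (ℕ.>-nonZero⁻¹ (k !) {{k ℕₚ.!≢0}})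

  0≤1/! : ∀ k → 0ℚ ≤ 1/! k
  0≤1/! k = *-cancelʳ (0<! k) (≤-trans (≤-reflexive (zeroˡ (ι (k !)))) (≤-trans 0≤1 (≤-reflexive (sym (1/!*! k)))))

  -- e N sums the terms of the exponential series below x^N.
  e : ℕ → ℚ → ℚ
  e zero    x = 0ℚ
  e (suc k) x = e k x + x ^ k * 1/! k

  -- Convexity: the graph of the power lies above its tangent at a. `^-upper` uses the tangent at b.
  -- The two take the place of the mean value theorem.
  ^-lower : ∀ {a b} k → 0ℚ ≤ a → a ≤ b → a ^ suc k + ι (suc k) * a ^ k * (b - a) ≤ b ^ suc k
  ^-lower {a} {b} zero    0≤a a≤b = ≤-reflexive (trans (cong (λ s → a * 1ℚ + s * 1ℚ * (b - a)) ι1≡1)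
    (solve 2 (λ a b → a :* con 1ℚ :+ con 1ℚ :* con 1ℚ :* (b :- a) := b :* con 1ℚ) refl a b))
  ^-lower {a} {b} (suc k) 0≤a a≤b = ≤-trans
    (≤-cert (ι (suc k) * (b - a) * a ^ k * (b - a)) (0≤* (0≤* (0≤* (0≤ι (suc k)) (0≤- a≤b)) (0≤^ k 0≤a)) (0≤- a≤b))
      (trans (cong (λ s → a * (a * a ^ k) + s * (a * a ^ k) * (b - a) + ι (suc k) * (b - a) * a ^ k * (b - a)) (ι-suc (suc k)))
        (solve 4 (λ a b p s → a :* (a :* p) :+ (con 1ℚ :+ s) :* (a :* p) :* (b :- a) :+ s :* (b :- a) :* p :* (b :- a)
          := b :* (a :* p :+ s :* p :* (b :- a))) refl a b (a ^ k) (ι (suc k)))))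
    (*-monoˡ (≤-trans 0≤a a≤b) (^-lower k 0≤a a≤b))

  ^-upper : ∀ {a b} k → 0ℚ ≤ a → a ≤ b → b ^ suc k ≤ a ^ suc k + ι (suc k) * b ^ k * (b - a)
  ^-upper {a} {b} zero    0≤a a≤b = ≤-reflexive (sym (trans (cong (λ s → a * 1ℚ + s * 1ℚ * (b - a)) ι1≡1)
    (solve 2 (λ a b → a :* con 1ℚ :+ con 1ℚ :* con 1ℚ :* (b :- a) := b :* con 1ℚ) refl a b)))
  ^-upper {a} {b} (suc k) 0≤a a≤b = ≤-cert
    (a * ((A + s * B * (b - a)) - b * B) + s * B * (b - a) * (b - a))
    (0≤+ (0≤* 0≤a (0≤- (^-upper k 0≤a a≤b))) (0≤* (0≤* (0≤* (0≤ι (suc k)) (0≤^ k (≤-trans 0≤a a≤b))) (0≤- a≤b)) (0≤- a≤b)))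
    (trans (solve 5 (λ a b A B s → b :* (b :* B) :+ (a :* ((A :+ s :* B :* (b :- a)) :- b :* B) :+ s :* B :* (b :- a) :* (b :- a))
        := a :* A :+ (con 1ℚ :+ s) :* (b :* B) :* (b :- a)) refl a b A B s)
      (cong (λ s → a * A + s * (b * B) * (b - a)) (sym (ι-suc (suc k)))))
    where
    A = a ^ suc k
    B = b ^ k
    s = ι (suc k)

  0≤e : ∀ {x} k → 0ℚ ≤ x → 0ℚ ≤ e k x
  0≤e zero    0≤x = ≤-refl
  0≤e (suc k) 0≤x = 0≤+ (0≤e k 0≤x) (0≤* (0≤^ k 0≤x) (0≤1/! k))

  -- The derivative of `e (suc N)` is `e N`, because x^(k+1)/(k+1)! has derivative x^k/k!. Adding up
  -- the tangent bounds of the terms bounds the increment from below by the slope at a, and in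
  -- `e-upper` from above by the slope at b.
  e-lower : ∀ {a b} N → 0ℚ ≤ a → a ≤ b → e (suc N) a + (b - a) * e N a ≤ e (suc N) b
  e-lower {a} {b} zero    0≤a a≤b = ≤-reflexive
    (solve 3 (λ a b f → (con 0ℚ :+ f) :+ (b :- a) :* con 0ℚ := con 0ℚ :+ f) refl a b (1ℚ * 1/! 0))
  e-lower {a} {b} (suc N) 0≤a a≤b = ≤-cert
    ((e (suc N) b - (e (suc N) a + (b - a) * e N a)) + (b ^ suc N - (a ^ suc N + ι (suc N) * a ^ N * (b - a))) * f)
    (0≤+ (0≤- (e-lower N 0≤a a≤b)) (0≤* (0≤- (^-lower N 0≤a a≤b)) (0≤1/! (suc N))))
    (trans (cong (λ F → (e (suc N) a + a ^ suc N * f) + (b - a) * (e N a + a ^ N * F) +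
              ((e (suc N) b - (e (suc N) a + (b - a) * e N a)) + (b ^ suc N - (a ^ suc N + ι (suc N) * a ^ N * (b - a))) * f)) (sym (1/!-suc N)))
      (solve 10 (λ a b f s ea ea′ eb p P R → (ea′ :+ P :* f) :+ (b :- a) :* (ea :+ p :* (f :* s)) :+ ((eb :- (ea′ :+ (b :- a) :* ea)) :+ (R :- (P :+ s :* p :* (b :- a))) :* f)
        := eb :+ R :* f) refl a b f (ι (suc N)) (e N a) (e (suc N) a) (e (suc N) b) (a ^ N) (a ^ suc N) (b ^ suc N)))
    where f = 1/! (suc N)

  e-upper : ∀ {a b} N → 0ℚ ≤ a → a ≤ b → e (suc N) b ≤ e (suc N) a + (b - a) * e N b
  e-upper {a} {b} zero    0≤a a≤b = ≤-reflexive (sym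
    (solve 3 (λ a b f → (con 0ℚ :+ f) :+ (b :- a) :* con 0ℚ := con 0ℚ :+ f) refl a b (1ℚ * 1/! 0)))
  e-upper {a} {b} (suc N) 0≤a a≤b = ≤-cert
    (((e (suc N) a + (b - a) * e N b) - e (suc N) b) + ((a ^ suc N + ι (suc N) * b ^ N * (b - a)) - b ^ suc N) * f)
    (0≤+ (0≤- (e-upper N 0≤a a≤b)) (0≤* (0≤- (^-upper N 0≤a a≤b)) (0≤1/! (suc N))))
    (trans (solve 10 (λ a b f s ea eb eb′ p P R → (eb′ :+ R :* f) :+ (((ea :+ (b :- a) :* eb) :- eb′) :+ ((P :+ s :* p :* (b :- a)) :- R) :* f)
        := (ea :+ P :* f) :+ (b :- a) :* (eb :+ p :* (f :* s))) refl a b f (ι (suc N)) (e (suc N) a) (e N b) (e (suc N) b) (b ^ N) (a ^ suc N) (b ^ suc N))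
      (cong (λ F → (e (suc N) a + a ^ suc N * f) + (b - a) * (e N b + b ^ N * F)) (1/!-suc N)))
    where f = 1/! (suc N)

  e-mono : ∀ {a b} N → 0ℚ ≤ a → a ≤ b → e N a ≤ e N b
  e-mono zero    0≤a a≤b = ≤-refl
  e-mono (suc N) 0≤a a≤b = +-mono-≤ (e-mono N 0≤a a≤b) (*-monoʳ (0≤1/! N) (^-mono N 0≤a a≤b))

  e-mono-index : ∀ {x M N} → 0ℚ ≤ x → M ℕ.≤ N → e M x ≤ e N x
  e-mono-index {x} {M} 0≤x M≤N with ℕₚ.m≤n⇒∃[o]m+o≡n M≤N
  ... | o , refl = go o
    where
    go : ∀ o → e M x ≤ e (M ℕ.+ o) x
    go zero    = ≤-reflexive (cong (λ k → e k x) (sym (ℕₚ.+-identityʳ M)))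
    go (suc o) = ≤-trans (go o) (≤-trans (≤-cert (x ^ (M ℕ.+ o) * 1/! (M ℕ.+ o)) (0≤* (0≤^ (M ℕ.+ o) 0≤x) (0≤1/! (M ℕ.+ o))) refl)
      (≤-reflexive (cong (λ k → e k x) (sym (ℕₚ.+-suc M o)))))

  e-zero : ∀ k → e (suc k) 0ℚ ≡ 1ℚ
  e-zero zero    = trans (+-identityˡ _) (trans (*-identityˡ (1/! 0)) 1/!-zero)
  e-zero (suc k) = trans (cong₂ _+_ (e-zero k) (trans (cong (_* 1/! (suc k)) (zeroˡ (0ℚ ^ k))) (zeroˡ (1/! (suc k))))) (+-identityʳ 1ℚ)

  1≤e : ∀ {x} k → 0ℚ ≤ x → 1ℚ ≤ e (suc k) x
  1≤e k 0≤x = ≤-trans (≤-reflexive (sym (e-zero k))) (e-mono (suc k) ≤-refl 0≤x)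

  -- The slope is at least 1 at nonnegative arguments. Arguments therefore differ by no more than
  -- the values do, which makes the approximate logarithms below converge.
  e-slope : ∀ {a b} N → 0ℚ ≤ a → a ≤ b → e (suc (suc N)) a + (b - a) ≤ e (suc (suc N)) b
  e-slope {a} {b} N 0≤a a≤b = ≤-trans (+-monoʳ-≤ (e (suc (suc N)) a)
    (≤-trans (≤-reflexive (sym (*-identityʳ (b - a)))) (*-monoˡ (0≤- a≤b) (1≤e N 0≤a)))) (e-lower (suc N) 0≤a a≤b)

  -- Over an interval of length 1 the sum gains at least its value at the left end, so it doubles.
  -- The derivative has one term fewer, hence one more term is taken at each step.
  2^≤e : ∀ m → ι 2 ^ m ≤ e (suc m) (ι m)
  2^≤e zero    = 1≤e 0 (0≤ι 0)
  2^≤e (suc m) = ≤-trans (≤-trans (*-monoˡ (0≤ι 2) (2^≤e m)) (≤-reflexive (trans (cong (_* E) ι2≡2)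
      (solve 1 (λ E → con 2ℚ :* E := E :+ con 1ℚ :* E) refl E))))
    (≤-trans (+-mono-≤ (e-mono-index (0≤ι m) (ℕₚ.n≤1+n (suc m))) (≤-reflexive (cong (_* E) (sym diff))))
      (e-lower (suc m) (0≤ι m) (ι-mono (ℕₚ.n≤1+n m))))
    where
    E = e (suc m) (ι m)
    diff : ι (suc m) - ι m ≡ 1ℚ
    diff = trans (cong (_- ι m) (ι-suc m)) (solve 1 (λ m → (con 1ℚ :+ m) :- m := con 1ℚ) refl (ι m))

  -- One step of length 1/2 at most doubles: e(x + 1/2) ≤ e(x) + e(x + 1/2)/2.
  e≤2^ : ∀ N m → e N (ι m * ½) ≤ ι 2 ^ m
  e≤2^ N zero    = ≤-trans (≤-reflexive (cong (e N) (trans (cong (_* ½) ι0≡0) (zeroˡ ½)))) (at-zero N)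
    where
    at-zero : ∀ N → e N 0ℚ ≤ 1ℚ
    at-zero zero    = 0≤1
    at-zero (suc N) = ≤-reflexive (e-zero N)
  e≤2^ zero    (suc m) = 0≤^ (suc m) (0≤ι 2)
  e≤2^ (suc N) (suc m) = ≤-trans
    (≤-cert (((e (suc N) a + (b - a) * e N b) - e (suc N) b) * 2ℚ + (e (suc N) b - e N b))
      (0≤+ (0≤* (0≤- (e-upper N 0≤a a≤b)) 0≤2) (0≤- (e-mono-index (≤-trans 0≤a a≤b) (ℕₚ.n≤1+n N))))
      (trans (cong (λ d → e (suc N) b + (((e (suc N) a + d * e N b) - e (suc N) b) * 2ℚ + (e (suc N) b - e N b))) diff)
        (solve 3 (λ x y z → x :+ (((y :+ con ½ :* z) :- x) :* con 2ℚ :+ (x :- z)) := con 2ℚ :* y) refl (e (suc N) b) (e (suc N) a) (e N b))))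
    (≤-trans (*-monoˡ 0≤2 (e≤2^ (suc N) m)) (≤-reflexive (cong (_* ι 2 ^ m) (sym ι2≡2))))
    where
    a b : ℚ
    a = ι m * ½
    b = ι (suc m) * ½
    0≤a : 0ℚ ≤ a
    0≤a = 0≤* (0≤ι m) 0≤½
    a≤b : a ≤ b
    a≤b = *-monoʳ 0≤½ (ι-mono (ℕₚ.n≤1+n m))
    diff : b - a ≡ ½
    diff = trans (cong (λ s → s * ½ - a) (ι-suc m)) (solve 1 (λ m → (con 1ℚ :+ m) :* con ½ :- m :* con ½ := con ½) refl (ι m))

  module Tail (X : ℕ) (1≤X : 1 ℕ.≤ X) where

    u : ℕ → ℚ
    u k = ι X ^ k * 1/! k

    0≤u : ∀ k → 0ℚ ≤ u k
    0≤u k = 0≤* (0≤^ k (0≤ι X)) (0≤1/! k)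

    u-halves : ∀ k → 2 ℕ.* X ℕ.≤ k → u (suc k) * 2ℚ ≤ u k
    u-halves k 2X≤k = *-cancelʳ (0<ι 1≤X) (≤-trans (≤-reflexive
        (trans (solve 2 (λ u x → u :* con 2ℚ :* x := u :* (con 2ℚ :* x)) refl (u (suc k)) (ι X))
          (cong (u (suc k) *_) (trans (cong (_* ι X) (sym ι2≡2)) (sym (ι-* 2 X))))))
      (≤-trans (*-monoˡ (0≤u (suc k)) (ι-mono (ℕₚ.m≤n⇒m≤1+n 2X≤k))) (≤-reflexive
        (trans (solve 4 (λ x p f s → x :* p :* f :* s := p :* (f :* s) :* x) refl (ι X) (ι X ^ k) (1/! (suc k)) (ι (suc k)))
          (cong (λ F → ι X ^ k * F * ι X) (1/!-suc k))))))

    -- From index 2X on each term at X is at most half the preceding one, so `e k x + u k * 2ℚ` does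
    -- not increase with k.
    tail : ∀ {x N M} → 0ℚ ≤ x → x ≤ ι X → 2 ℕ.* X ℕ.≤ N → N ℕ.≤ M → e M x ≤ e N x + u N * 2ℚ
    tail {x} {N} 0≤x x≤X 2X≤N N≤M with ℕₚ.m≤n⇒∃[o]m+o≡n N≤M
    ... | o , refl = ≤-trans (≤-cert (u (N ℕ.+ o) * 2ℚ) (0≤* (0≤u (N ℕ.+ o)) 0≤2) refl) (go o)
      where
      step : ∀ k → 2 ℕ.* X ℕ.≤ k → e (suc k) x + u (suc k) * 2ℚ ≤ e k x + u k * 2ℚ
      step k 2X≤k = ≤-trans (+-mono-≤ (+-monoʳ-≤ (e k x) (*-monoʳ (0≤1/! k) (^-mono k 0≤x x≤X))) (u-halves k 2X≤k))
        (≤-reflexive (solve 2 (λ e u → e :+ u :+ u := e :+ u :* con 2ℚ) refl (e k x) (u k)))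
      go : ∀ o → e (N ℕ.+ o) x + u (N ℕ.+ o) * 2ℚ ≤ e N x + u N * 2ℚ
      go zero    = ≤-reflexive (cong (λ k → e k x + u k * 2ℚ) (ℕₚ.+-identityʳ N))
      go (suc o) = ≤-trans (≤-reflexive (cong (λ k → e k x + u k * 2ℚ) (ℕₚ.+-suc N o)))
        (≤-trans (step (N ℕ.+ o) (ℕₚ.≤-trans 2X≤N (ℕₚ.m≤m+n N o))) (go o))

    u-antimono : ∀ {N M} → 2 ℕ.* X ℕ.≤ N → N ℕ.≤ M → u M ≤ u N
    u-antimono {N} 2X≤N N≤M with ℕₚ.m≤n⇒∃[o]m+o≡n N≤M
    ... | o , refl = go o
      where
      go : ∀ o → u (N ℕ.+ o) ≤ u N
      go zero    = ≤-reflexive (cong u (ℕₚ.+-identityʳ N))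
      go (suc o) = ≤-trans (≤-reflexive (cong u (ℕₚ.+-suc N o))) (≤-trans
        (≤-cert (u (suc (N ℕ.+ o))) (0≤u (suc (N ℕ.+ o))) (solve 1 (λ u → u :+ u := u :* con 2ℚ) refl (u (suc (N ℕ.+ o)))))
        (≤-trans (u-halves (N ℕ.+ o) (ℕₚ.≤-trans 2X≤N (ℕₚ.m≤m+n N o))) (go o)))

    u-small : ∀ ε → 0ℚ < ε → ∃[ N ] (2 ℕ.* X ℕ.≤ N × (∀ M → N ℕ.≤ M → u M ≤ ε))
    u-small ε 0<ε = N , ℕₚ.m≤m+n (2 ℕ.* X) K , λ M N≤M → ≤-trans (u-antimono (ℕₚ.m≤m+n (2 ℕ.* X) K) N≤M) uN≤ε
      where
      δ : ℚ
      δ = proj₁ (inv 0<ε)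
      δε≡1 : δ * ε ≡ 1ℚ
      δε≡1 = proj₂ (proj₂ (inv 0<ε))
      u₀ : ℚ
      u₀ = u (2 ℕ.* X)
      K N : ℕ
      -- As δ = 1/ε, this gives u₀ ≤ Kε, and K further halvings divide u₀ by 2^K ≥ K + 1.
      K = proj₁ (archimedean (u₀ * δ))
      N = 2 ℕ.* X ℕ.+ K
      u₀≤Kε : u₀ ≤ ι K * ε
      u₀≤Kε = ≤-trans (≤-reflexive (sym (trans (*-assoc u₀ δ ε) (trans (cong (u₀ *_) δε≡1) (*-identityʳ u₀)))))
        (*-monoʳ (<⇒≤ 0<ε) (proj₂ (archimedean (u₀ * δ))))
      halved : ∀ o → u (2 ℕ.* X ℕ.+ o) * 2ℚ ^ o ≤ u₀
      halved zero    = ≤-reflexive (trans (*-identityʳ _) (cong u (ℕₚ.+-identityʳ (2 ℕ.* X))))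
      halved (suc o) = ≤-trans (≤-reflexive (trans (cong (λ k → u k * (2ℚ * 2ℚ ^ o)) (ℕₚ.+-suc (2 ℕ.* X) o)) (sym (*-assoc _ 2ℚ (2ℚ ^ o)))))
        (≤-trans (*-monoʳ (0≤^ o 0≤2) (u-halves (2 ℕ.* X ℕ.+ o) (ℕₚ.m≤m+n (2 ℕ.* X) o))) (halved o))
      K+1≤2^K : ι (suc K) ≤ 2ℚ ^ K
      K+1≤2^K = ≤-trans (≤-reflexive (trans (ι-suc K) (cong (_+_ 1ℚ) (sym (*-identityʳ (ι K)))))) (≤-trans (bernoulli 1ℚ K (0≤+ 0≤1 0≤1))
        (≤-reflexive (cong (_^ K) (sym (+≡ 1ℚ 1ℚ)))))
      uN≤ε : u N ≤ ε
      uN≤ε = *-cancelʳ (0<ι {suc K} (ℕ.s≤s ℕ.z≤n)) (≤-trans (*-monoˡ (0≤u N) K+1≤2^K) (≤-trans (halved K) (≤-trans u₀≤Kε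
        (≤-trans (*-monoʳ (<⇒≤ 0<ε) (ι-mono (ℕₚ.n≤1+n K))) (≤-reflexive (*-comm (ι (suc K)) ε))))))

-- An upper bound for the exponential series at negative arguments.

module NegativeExponential where

  open Rationals
  open Exponential
  import Data.Rational.Base as ℚ
  open import Data.Integer.Base using (+_)
  open import Data.Nat.Base as ℕ using (ℕ; zero; suc)
  import Data.Nat.Properties as ℕₚ
  open import Data.Product using (∃-syntax; _×_; _,_; proj₁; proj₂)
  open import Relation.Binary.PropositionalEquality using (_≡_; refl; sym; trans; cong; cong₂; subst; subst₂)

  ¼ : ℚ
  ¼ = ½ ℚ.* ½

  0<¼ : 0ℚ < ¼
  0<¼ = positive⁻¹ ¼

  -- The absolute value of d is at most c, split into two inequalities that suit the certificates.
  Within : ℚ → ℚ → Set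
  Within c d = d ≤ c × 0ℚ ≤ c + d

  -- Twice Yc - bd is (Y - b)(c + d) + (Y + b)(c - d), and twice Yc + bd is (Y + b)(c + d) + (Y -
  -- b)(c - d).
  Within-* : ∀ {Y b c d} → Within Y b → Within c d → Within (Y * c) (b * d)
  Within-* {Y} {b} {c} {d} (b≤Y , 0≤Y+b) (d≤c , 0≤c+d) =
    ≤-cert (½ * ((Y - b) * (c + d) + (Y + b) * (c - d)))
      (0≤* 0≤½ (0≤+ (0≤* (0≤- b≤Y) 0≤c+d) (0≤* 0≤Y+b (0≤- d≤c))))
      (solve 4 (λ Y b c d → b :* d :+ con ½ :* ((Y :- b) :* (c :+ d) :+ (Y :+ b) :* (c :- d)) := Y :* c) refl Y b c d) ,
    subst (0ℚ ≤_) (solve 4 (λ Y b c d → con ½ :* ((Y :+ b) :* (c :+ d) :+ (Y :- b) :* (c :- d)) := Y :* c :+ b :* d) refl Y b c d)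
      (0≤* 0≤½ (0≤+ (0≤* 0≤Y+b 0≤c+d) (0≤* (0≤- b≤Y) (0≤- d≤c))))

  Within-+ : ∀ {a b c d} → Within a b → Within c d → Within (a + c) (b + d)
  Within-+ {a} {b} {c} {d} (p , q) (r , s) = +-mono-≤ p r ,
    subst (0ℚ ≤_) (solve 4 (λ a b c d → (a :+ b) :+ (c :+ d) := (a :+ c) :+ (b :+ d)) refl a b c d) (0≤+ q s)

  Within-nonNeg : ∀ {c} → 0ℚ ≤ c → Within c c
  Within-nonNeg 0≤c = ≤-refl , 0≤+ 0≤c 0≤c

  Within-^ : ∀ {Y b} k → Within Y b → Within (Y ^ k) (b ^ k)
  Within-^ zero    w = Within-nonNeg 0≤1
  Within-^ (suc k) w = Within-* w (Within-^ k w)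

  -- The exponential at negative arguments is approached by Euler steps of
  -- length h; the coefficients below bound the error h² of one step.
  module Negative (X : ℕ) (1≤X : 1 ℕ.≤ X) where
    open Tail X 1≤X

    C : ℕ → ℚ
    C zero    = 0ℚ
    C (suc k) = ι X * C k + ι (suc k) * ι X ^ k

    0≤C : ∀ k → 0ℚ ≤ C k
    0≤C zero    = ≤-refl
    0≤C (suc k) = 0≤+ (0≤* (0≤ι X) (0≤C k)) (0≤* (0≤ι (suc k)) (0≤^ k (0≤ι X)))

    B : ℕ → ℚ
    B zero    = 0ℚ
    B (suc N) = B N + C N * 1/! (suc N)

    0≤B : ∀ N → 0ℚ ≤ B N
    0≤B zero    = ≤-refl
    0≤B (suc N) = 0≤+ (0≤B N) (0≤* (0≤C N) (0≤1/! (suc N)))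

    module _ (a h : ℚ) (0≤h : 0ℚ ≤ h) (Xa : Within (ι X) a) (Xb : Within (ι X) (a - h)) where

      b : ℚ
      b = a - h

      Δ : ℕ → ℚ
      Δ k = b ^ suc k - a ^ suc k + ι (suc k) * a ^ k * h

      -- Δ k is the remainder of the first-order expansion of (a - h)^(k+1) at a. It satisfies Δ
      -- (k+1) = b Δ k + (k+1) aᵏ h², which is the recursion of `C` with a and b replaced by X.
      power-step : ∀ k → Within (C k * (h * h)) (Δ k)
      power-step zero    = subst₂ Within (sym (zeroˡ (h * h))) (sym Δ₀) (Within-nonNeg ≤-refl)
        where
        Δ₀ : Δ 0 ≡ 0ℚ
        Δ₀ = trans (cong (λ s → (a - h) * 1ℚ - a * 1ℚ + s * 1ℚ * h) ι1≡1)
          (solve 2 (λ a h → (a :- h) :* con 1ℚ :- a :* con 1ℚ :+ con 1ℚ :* con 1ℚ :* h := con 0ℚ) refl a h)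
      power-step (suc k) = subst₂ Within
        (solve 5 (λ x c h s p → x :* (c :* (h :* h)) :+ s :* p :* (h :* h) := (x :* c :+ s :* p) :* (h :* h)) refl (ι X) (C k) h (ι (suc k)) (ι X ^ k))
        (trans (solve 5 (λ a h s p B → (a :- h) :* (B :- a :* p :+ s :* p :* h) :+ s :* p :* (h :* h)
             := (a :- h) :* B :- a :* (a :* p) :+ (con 1ℚ :+ s) :* (a :* p) :* h) refl a h (ι (suc k)) (a ^ k) (b ^ suc k))
          (cong (λ s → b * b ^ suc k - a * (a * a ^ k) + s * (a * a ^ k) * h) (sym (ι-suc (suc k)))))
        (Within-+ (Within-* Xb (power-step k)) (Within-* (Within-* (Within-nonNeg (0≤ι (suc k))) (Within-^ k Xa)) (Within-nonNeg (0≤* 0≤h 0≤h))))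

      e-step : ∀ N → e (suc N) b ≤ e (suc N) a - h * e N a + B N * (h * h)
      e-step zero    = ≤-reflexive (solve 2 (λ h f → con 0ℚ :+ f := con 0ℚ :+ f :- h :* con 0ℚ :+ con 0ℚ :* (h :* h)) refl h (1ℚ * 1/! 0))
      e-step (suc N) = ≤-cert
        (((e (suc N) a - h * e N a + B N * (h * h)) - e (suc N) b) + (C N * (h * h) - Δ N) * f)
        (0≤+ (0≤- (e-step N)) (0≤* (0≤- (proj₁ (power-step N))) (0≤1/! (suc N))))
        (trans (solve 11 (λ h f s ea ea′ eb p P R β c →
              (eb :+ R :* f) :+ (((ea :- h :* ea′ :+ β :* (h :* h)) :- eb) :+ (c :* (h :* h) :- (R :- P :+ s :* p :* h)) :* f)
              := (ea :+ P :* f) :- h :* (ea′ :+ p :* (f :* s)) :+ (β :+ c :* f) :* (h :* h))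
            refl h f (ι (suc N)) (e (suc N) a) (e N a) (e (suc N) b) (a ^ N) (a ^ suc N) (b ^ suc N) (B N) (C N))
          (cong (λ F → (e (suc N) a + a ^ suc N * f) - h * (e N a + a ^ N * F) + (B N + C N * f) * (h * h)) (1/!-suc N)))
        where f = 1/! (suc N)

    module _ (N : ℕ) (small : ι X * u N ≤ ¼) (y : ℚ) (0≤y : 0ℚ ≤ y) (y≤X : y ≤ ι X) where

      private
        K M : ℕ
        K = proj₁ (archimedean (B N * (ι X * ι X) * ι 4))
        -- The number of Euler steps: X of them make the step length h at most 1, and K of them make
        -- the second-order errors at most 1/4 in total.
        M = suc (X ℕ.+ K)
        0<M : 0ℚ < ι M
        0<M = 0<ι {M} (ℕ.s≤s ℕ.z≤n)
        g h δ : ℚ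
        g = proj₁ (inv 0<M)
        h = y * g
        δ = h * u N + B N * (h * h)
        gM≡1 : g * ι M ≡ 1ℚ
        gM≡1 = proj₂ (proj₂ (inv 0<M))
        0≤g : 0ℚ ≤ g
        0≤g = <⇒≤ (proj₁ (proj₂ (inv 0<M)))
        0≤h : 0ℚ ≤ h
        0≤h = 0≤* 0≤y 0≤g
        Mh≡y : ι M * h ≡ y
        Mh≡y = trans (solve 3 (λ m y g → m :* (y :* g) := y :* (g :* m)) refl (ι M) y g) (trans (cong (y *_) gM≡1) (*-identityʳ y))
        h≤1 : h ≤ 1ℚ
        h≤1 = ≤-trans (*-monoʳ 0≤g (≤-trans y≤X (ι-mono (ℕₚ.m≤n⇒m≤1+n (ℕₚ.m≤m+n X K))))) (≤-reflexive (trans (*-comm (ι M) g) gM≡1))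
        0≤δ : 0ℚ ≤ δ
        0≤δ = 0≤+ (0≤* 0≤h (0≤u N)) (0≤* (0≤B N) (0≤* 0≤h 0≤h))
        a : ℕ → ℚ
        a j = 0ℚ - ι j * h
        a-within : ∀ j → j ℕ.≤ M → Within (ι X) (a j)
        a-within j j≤M = ≤-trans (≤-cert (ι j * h) (0≤* (0≤ι j) 0≤h) (solve 1 (λ s → (con 0ℚ :- s) :+ s := con 0ℚ) refl (ι j * h))) (0≤ι X) ,
          subst (0ℚ ≤_) (solve 2 (λ x s → x :- s := x :+ (con 0ℚ :- s)) refl (ι X) (ι j * h))
            (0≤- (≤-trans (*-monoʳ 0≤h (ι-mono j≤M)) (≤-trans (≤-reflexive Mh≡y) y≤X)))
        a-suc : ∀ j → a (suc j) ≡ a j - h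
        a-suc j = trans (cong (λ s → 0ℚ - s * h) (ι-suc j)) (solve 2 (λ s h → con 0ℚ :- (con 1ℚ :+ s) :* h := (con 0ℚ :- s :* h) :- h) refl (ι j) h)
        -- The slope `e N` differs from `e (suc N)` by the last term, which is at most u N. A step
        -- thus turns the value E into at most (1 - h) E + δ, and 1 + jδ into at most 1 + (j+1)δ.
        climb : ∀ j → j ℕ.≤ M → e (suc N) (a j) ≤ 1ℚ + ι j * δ
        climb zero    _   = ≤-trans (≤-reflexive (trans (cong (e (suc N)) (trans (cong (λ s → 0ℚ - s * h) ι0≡0) (solve 1 (λ h → con 0ℚ :- con 0ℚ :* h := con 0ℚ) refl h))) (e-zero N)))
          (≤-cert (ι 0 * δ) (0≤* (0≤ι 0) 0≤δ) refl)
        climb (suc j) j<M = ≤-trans (≤-reflexive (cong (e (suc N)) (a-suc j)))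
          (≤-trans (e-step (a j) h 0≤h (a-within j (ℕₚ.<⇒≤ j<M)) (subst (Within (ι X)) (a-suc j) (a-within (suc j) j<M)) N)
          (≤-cert (((1ℚ + ι j * δ) - E) * (1ℚ - h) + h * (1ℚ + ι j * δ) + h * (u N - t))
            (0≤+ (0≤+ (0≤* (0≤- (climb j (ℕₚ.<⇒≤ j<M))) (0≤- h≤1)) (0≤* 0≤h (0≤+ 0≤1 (0≤* (0≤ι j) 0≤δ)))) (0≤* 0≤h (0≤- t≤u)))
            (trans (solve 7 (λ ea t h τ β J E′ → (ea :+ t :- h :* ea :+ β :* (h :* h)) :+ (((con 1ℚ :+ J :* (h :* τ :+ β :* (h :* h))) :- (ea :+ t)) :* (con 1ℚ :- h)
                 :+ h :* (con 1ℚ :+ J :* (h :* τ :+ β :* (h :* h))) :+ h :* (τ :- t)) := con 1ℚ :+ (con 1ℚ :+ J) :* (h :* τ :+ β :* (h :* h)))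
               refl (e N (a j)) t h (u N) (B N) (ι j) E)
              (cong (λ s → 1ℚ + s * δ) (sym (ι-suc j))))))
          where
          t E : ℚ
          t = a j ^ N * 1/! N
          E = e (suc N) (a j)
          t≤u : t ≤ u N
          t≤u = *-monoʳ (0≤1/! N) (proj₁ (Within-^ N (a-within j (ℕₚ.<⇒≤ j<M))))

      e-negative : e (suc N) (0ℚ - y) ≤ 1ℚ + ½
      e-negative = ≤-trans (≤-reflexive (cong (λ s → e (suc N) (0ℚ - s)) (sym Mh≡y))) (≤-trans (climb M ℕₚ.≤-refl) (+-monoʳ-≤ 1ℚ Mδ≤½))
        where
        BX²g≤¼ : B N * (ι X * ι X) * g ≤ ¼
        BX²g≤¼ = *-cancelʳ {c = ι 4} (0<ι {4} (ℕ.s≤s ℕ.z≤n)) (≤-trans (≤-reflexive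
            (solve 3 (λ b g f → b :* g :* f := (b :* f) :* g) refl (B N * (ι X * ι X)) g (ι 4)))
          (≤-trans (*-monoʳ 0≤g (≤-trans (proj₂ (archimedean (B N * (ι X * ι X) * ι 4))) (ι-mono (ℕₚ.m≤n⇒m≤1+n (ℕₚ.m≤n+m K X)))))
            (≤-reflexive (trans (trans (*-comm (ι M) g) gM≡1) (sym (trans (cong (¼ *_) (trans (ι-* 2 2) (cong₂ _*_ ι2≡2 ι2≡2))) quarter))))))
          where
          quarter : ¼ * (2ℚ * 2ℚ) ≡ 1ℚ
          quarter = trans (cong (¼ *_) (sym (*≡ 2ℚ 2ℚ))) (sym (*≡ ¼ (2ℚ ℚ.* 2ℚ)))
        Mδ≤½ : ι M * δ ≤ ½
        Mδ≤½ = ≤-trans (≤-reflexive (trans (solve 5 (λ m h τ β y → m :* (h :* τ :+ β :* (h :* h)) := m :* h :* τ :+ β :* (m :* h :* h)) refl (ι M) h (u N) (B N) y)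
            (cong (λ s → s * u N + B N * (s * h)) Mh≡y)))
          (≤-trans (+-mono-≤ (≤-trans (*-monoʳ (0≤u N) y≤X) small)
            (≤-trans (≤-trans (*-monoˡ (0≤B N) (≤-trans (≤-reflexive (sym (*-assoc y y g))) (*-monoʳ 0≤g (*-mono 0≤y (0≤ι X) y≤X y≤X))))
              (≤-reflexive (sym (*-assoc (B N) (ι X * ι X) g)))) BX²g≤¼)) (≤-reflexive (sym (+≡ ¼ ¼))))

    -- The threshold depends on X alone, so the number of terms can be fixed before the
    -- approximations of a real argument are inspected.
    eventually-e-negative : ∃[ N₀ ] (∀ N → N₀ ℕ.≤ N → ∀ y → 0ℚ ≤ y → y ≤ ι X → e (suc N) (0ℚ - y) ≤ 1ℚ + ½)
    eventually-e-negative = proj₁ chosen , λ N N≥ y 0≤y y≤X → e-negative N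
      (≤-trans (*-monoˡ (0≤ι X) (proj₂ (proj₂ chosen) N N≥)) (≤-reflexive
        (trans (solve 3 (λ x q g → x :* (q :* g) := q :* (g :* x)) refl (ι X) ¼ g) (trans (cong (¼ *_) gX≡1) (*-identityʳ ¼))))) y 0≤y y≤X
      where
      g : ℚ
      g = proj₁ (inv (0<ι 1≤X))
      gX≡1 : g * ι X ≡ 1ℚ
      gX≡1 = proj₂ (proj₂ (inv (0<ι 1≤X)))
      chosen : ∃[ N ] (2 ℕ.* X ℕ.≤ N × (∀ M → N ℕ.≤ M → u M ≤ ¼ * g))
      chosen = u-small (¼ * g) (0<* 0<¼ (proj₁ (proj₂ (inv (0<ι 1≤X)))))

-- Expectations in G(n, q) for rational q.

module Probability where

  open import Defs using (Outcome; []; _∷_; allRows; allOutcomes; ℝ; seq; Pr; probability; rowProbability; _+ᴿ_; 0ᴿ)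
  open Rationals
  open import Data.Bool.Base using (Bool; true; false; if_then_else_)
  open import Data.Fin.Base using (zero; suc)
  open import Data.List.Base as List using (List; []; _∷_; _++_; cartesianProductWith; foldr)
  open import Data.List.Membership.Propositional using (_∈_)
  open import Data.List.Membership.Propositional.Properties using (∈-cartesianProductWith⁺)
  open import Data.List.Relation.Unary.Any using (here; there)
  open import Data.Nat.Base using (ℕ; zero; suc)
  open import Data.Product using (∃-syntax)
  import Data.Rational.Base as ℚ
  open import Data.Vec.Base as Vec using (Vec; []; _∷_)
  open import Relation.Binary.PropositionalEquality using (_≡_; refl; sym; trans; cong; cong₂; module ≡-Reasoning)

  private variable
    A A′ A″ : Set
    n : ℕ

  sumL : (A → ℚ) → List A → ℚ
  sumL f = foldr (λ x s → f x + s) 0ℚ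

  sumL-++ : ∀ (f : A → ℚ) xs ys → sumL f (xs ++ ys) ≡ sumL f xs + sumL f ys
  sumL-++ f []       ys = sym (+-identityˡ (sumL f ys))
  sumL-++ f (x ∷ xs) ys = trans (cong (f x +_) (sumL-++ f xs ys)) (sym (+-assoc (f x) (sumL f xs) (sumL f ys)))

  sumL-map : ∀ (f : A → ℚ) (h : A′ → A) xs → sumL f (List.map h xs) ≡ sumL (λ x → f (h x)) xs
  sumL-map f h []       = refl
  sumL-map f h (x ∷ xs) = cong (f (h x) +_) (sumL-map f h xs)

  sumL-cartesianProductWith : ∀ (f : A″ → ℚ) (h : A → A′ → A″) xs ys →
    sumL f (cartesianProductWith h xs ys) ≡ sumL (λ x → sumL (λ y → f (h x y)) ys) xs
  sumL-cartesianProductWith f h []       ys = refl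
  sumL-cartesianProductWith f h (x ∷ xs) ys = trans (sumL-++ f (List.map (h x) ys) _)
    (cong₂ _+_ (sumL-map f (h x) ys) (sumL-cartesianProductWith f h xs ys))

  sumL-cong : ∀ {f g : A → ℚ} → (∀ x → f x ≡ g x) → ∀ xs → sumL f xs ≡ sumL g xs
  sumL-cong e []       = refl
  sumL-cong e (x ∷ xs) = cong₂ _+_ (e x) (sumL-cong e xs)

  sumL-mono : ∀ {f g : A → ℚ} → (∀ x → f x ≤ g x) → ∀ xs → sumL f xs ≤ sumL g xs
  sumL-mono h []       = ≤-refl
  sumL-mono h (x ∷ xs) = +-mono-≤ (h x) (sumL-mono h xs)

  sumL-*ˡ : ∀ c (f : A → ℚ) xs → sumL (λ x → c * f x) xs ≡ c * sumL f xs
  sumL-*ˡ c f []       = sym (zeroʳ c)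
  sumL-*ˡ c f (x ∷ xs) = trans (cong (c * f x +_) (sumL-*ˡ c f xs)) (sym (*-distribˡ-+ c (f x) (sumL f xs)))

  0≤sumL : ∀ {f : A → ℚ} → (∀ x → 0ℚ ≤ f x) → ∀ xs → 0ℚ ≤ sumL f xs
  0≤sumL h []       = ≤-refl
  0≤sumL h (x ∷ xs) = 0≤+ (h x) (0≤sumL h xs)

  term≤sumL : ∀ {f : A → ℚ} → (∀ x → 0ℚ ≤ f x) → ∀ {x xs} → x ∈ xs → f x ≤ sumL f xs
  term≤sumL {f = f} h {x} {y ∷ xs} (here refl)  = ≤-cert (sumL f xs) (0≤sumL h xs) refl
  term≤sumL {f = f} h {x} {y ∷ xs} (there x∈xs) = ≤-trans (term≤sumL h x∈xs)
    (≤-cert (f y) (h y) (+-comm (sumL f xs) (f y)))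

  vecs : List A → ∀ n → List (Vec A n)
  vecs ls zero    = [] ∷ []
  vecs ls (suc n) = cartesianProductWith _∷_ ls (vecs ls n)

  ∈-vecs : {ls : List A} → (∀ l → l ∈ ls) → (v : Vec A n) → v ∈ vecs ls n
  ∈-vecs all []      = here refl
  ∈-vecs all (l ∷ v) = ∈-cartesianProductWith⁺ _∷_ (all l) (∈-vecs all v)

  prodV : (A → ℚ) → Vec A n → ℚ
  prodV u []      = 1ℚ
  prodV u (l ∷ v) = u l * prodV u v

  -- Distributivity. This replaces binomial coefficients in the union bounds: a sum over labellings
  -- with prescribed class sizes is dominated by a weighted sum over all labellings, which is a
  -- power.
  sum-vecs : ∀ (u : A → ℚ) ls n → sumL (prodV u) (vecs ls n) ≡ sumL u ls ^ n
  sum-vecs u ls zero    = +-identityʳ 1ℚ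
  sum-vecs u ls (suc n) = begin
    sumL (prodV u) (vecs ls (suc n))                              ≡⟨ sumL-cartesianProductWith (prodV u) _∷_ ls (vecs ls n) ⟩
    sumL (λ l → sumL (λ v → u l * prodV u v) (vecs ls n)) ls      ≡⟨ sumL-cong (λ l → trans (sumL-*ˡ (u l) (prodV u) (vecs ls n))
                                                                       (trans (cong (u l *_) (sum-vecs u ls n)) (*-comm (u l) _))) ls ⟩
    sumL (λ l → sumL u ls ^ n * u l) ls                           ≡⟨ sumL-*ˡ (sumL u ls ^ n) u ls ⟩
    sumL u ls ^ n * sumL u ls                                     ≡⟨ *-comm (sumL u ls ^ n) (sumL u ls) ⟩
    sumL u ls * sumL u ls ^ n                                     ∎
    where open ≡-Reasoning

  -- `W` multiplies a factor for every edge of the outcome, depending on the labels of its ends.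
  -- Both the indicator of a hole and the exponential moment of the number of edges are of this
  -- form.
  module Weight {L : Set} (g : L → L → ℚ) where

    rowW : ∀ {n} → L → Vec L n → Vec Bool n → ℚ
    rowW l []       []      = 1ℚ
    rowW l (m ∷ ls) (b ∷ r) = (if b then g l m else 1ℚ) * rowW l ls r

    W : ∀ {n} → Vec L n → Outcome n → ℚ
    W []       []      = 1ℚ
    W (l ∷ ls) (r ∷ ω) = rowW l ls r * W ls ω

  module Expectation (q : ℚ) where

    -- Averaging one bit after the other makes linearity and independence simple inductions;
    -- `sum-outcomes` identifies the result with the sum over all outcomes.
    Exr : ∀ {n} → (Vec Bool n → ℚ) → ℚ
    Exr {zero}  f = f []
    Exr {suc n} f = q * Exr (λ v → f (true ∷ v)) + (1ℚ - q) * Exr (λ v → f (false ∷ v))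

    Ex : ∀ {n} → (Outcome n → ℚ) → ℚ
    Ex {zero}  f = f []
    Ex {suc n} f = Exr (λ r → Ex (λ ω → f (r ∷ ω)))

    Exr-cong : ∀ {n} {f g : Vec Bool n → ℚ} → (∀ v → f v ≡ g v) → Exr f ≡ Exr g
    Exr-cong {zero}  e = e []
    Exr-cong {suc n} e = cong₂ _+_ (cong (q *_) (Exr-cong (λ v → e (true ∷ v))))
                                   (cong ((1ℚ - q) *_) (Exr-cong (λ v → e (false ∷ v))))

    Ex-cong : ∀ {n} {f g : Outcome n → ℚ} → (∀ ω → f ω ≡ g ω) → Ex f ≡ Ex g
    Ex-cong {zero}  e = e []
    Ex-cong {suc n} e = Exr-cong (λ r → Ex-cong (λ ω → e (r ∷ ω)))

    Exr-+ : ∀ {n} (f g : Vec Bool n → ℚ) → Exr (λ v → f v + g v) ≡ Exr f + Exr g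
    Exr-+ {zero}  f g = refl
    Exr-+ {suc n} f g = trans
      (cong₂ (λ a b → q * a + (1ℚ - q) * b) (Exr-+ (λ v → f (true ∷ v)) (λ v → g (true ∷ v)))
                                            (Exr-+ (λ v → f (false ∷ v)) (λ v → g (false ∷ v))))
      (solve 6 (λ q p a b c d → q :* (a :+ b) :+ p :* (c :+ d) := (q :* a :+ p :* c) :+ (q :* b :+ p :* d))
        refl q (1ℚ - q) (Exr (λ v → f (true ∷ v))) (Exr (λ v → g (true ∷ v)))
                        (Exr (λ v → f (false ∷ v))) (Exr (λ v → g (false ∷ v))))

    Exr-* : ∀ {n} c (f : Vec Bool n → ℚ) → Exr (λ v → c * f v) ≡ c * Exr f
    Exr-* {zero}  c f = refl
    Exr-* {suc n} c f = trans
      (cong₂ (λ a b → q * a + (1ℚ - q) * b) (Exr-* c (λ v → f (true ∷ v))) (Exr-* c (λ v → f (false ∷ v))))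
      (solve 5 (λ q p c a b → q :* (c :* a) :+ p :* (c :* b) := c :* (q :* a :+ p :* b))
        refl q (1ℚ - q) c (Exr (λ v → f (true ∷ v))) (Exr (λ v → f (false ∷ v))))

    Ex-+ : ∀ {n} (f g : Outcome n → ℚ) → Ex (λ v → f v + g v) ≡ Ex f + Ex g
    Ex-+ {zero}  f g = refl
    Ex-+ {suc n} f g = trans (Exr-cong (λ r → Ex-+ (λ ω → f (r ∷ ω)) (λ ω → g (r ∷ ω))))
                             (Exr-+ (λ r → Ex (λ ω → f (r ∷ ω))) (λ r → Ex (λ ω → g (r ∷ ω))))

    Ex-* : ∀ {n} c (f : Outcome n → ℚ) → Ex (λ v → c * f v) ≡ c * Ex f
    Ex-* {zero}  c f = refl
    Ex-* {suc n} c f = trans (Exr-cong (λ r → Ex-* c (λ ω → f (r ∷ ω)))) (Exr-* c (λ r → Ex (λ ω → f (r ∷ ω))))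

    Exr-const : ∀ n c → Exr {n} (λ _ → c) ≡ c
    Exr-const zero    c = refl
    Exr-const (suc n) c = trans (cong₂ (λ a b → q * a + (1ℚ - q) * b) (Exr-const n c) (Exr-const n c))
      (solve 2 (λ q c → q :* c :+ (con 1ℚ :- q) :* c := c) refl q c)

    Ex-const : ∀ n c → Ex {n} (λ _ → c) ≡ c
    Ex-const zero    c = refl
    Ex-const (suc n) c = trans (Exr-cong {n} (λ _ → Ex-const n c)) (Exr-const n c)

    Ex-sumL : ∀ {n} (f : A → Outcome n → ℚ) xs → Ex (λ ω → sumL (λ x → f x ω) xs) ≡ sumL (λ x → Ex (f x)) xs
    Ex-sumL {n = n} f []       = Ex-const n 0ℚ
    Ex-sumL         f (x ∷ xs) = trans (Ex-+ (f x) (λ ω → sumL (λ x → f x ω) xs)) (cong (Ex (f x) +_) (Ex-sumL f xs))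

    module _ (0≤q : 0ℚ ≤ q) (q≤1 : q ≤ 1ℚ) where

      Exr-mono : ∀ {n} {f g : Vec Bool n → ℚ} → (∀ v → f v ≤ g v) → Exr f ≤ Exr g
      Exr-mono {zero}  h = h []
      Exr-mono {suc n} h = +-mono-≤ (*-monoˡ 0≤q (Exr-mono (λ v → h (true ∷ v))))
                                    (*-monoˡ (0≤- q≤1) (Exr-mono (λ v → h (false ∷ v))))

      Ex-mono : ∀ {n} {f g : Outcome n → ℚ} → (∀ ω → f ω ≤ g ω) → Ex f ≤ Ex g
      Ex-mono {zero}  h = h []
      Ex-mono {suc n} h = Exr-mono (λ r → Ex-mono (λ ω → h (r ∷ ω)))

    rowProb : ∀ {n} → Vec Bool n → ℚ
    rowProb []      = 1ℚ
    rowProb (b ∷ r) = (if b then q else 1ℚ - q) * rowProb r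

    prob : ∀ {n} → Outcome n → ℚ
    prob []      = 1ℚ
    prob (r ∷ ω) = rowProb r * prob ω

    sum-rows : ∀ {n} (f : Vec Bool n → ℚ) → sumL (λ r → rowProb r * f r) (allRows n) ≡ Exr f
    sum-rows {zero}  f = trans (+-identityʳ (1ℚ * f [])) (*-identityˡ (f []))
    sum-rows {suc n} f = begin
      sumL (λ r → rowProb r * f r) (allRows (suc n))
        ≡⟨ sumL-cartesianProductWith (λ r → rowProb r * f r) _∷_ (true ∷ false ∷ []) (allRows n) ⟩
      S true + (S false + 0ℚ)
        ≡⟨ cong₂ _+_ (step true) (trans (+-identityʳ (S false)) (step false)) ⟩
      q * Exr (λ v → f (true ∷ v)) + (1ℚ - q) * Exr (λ v → f (false ∷ v)) ∎
      where
      open ≡-Reasoning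
      S : Bool → ℚ
      S b = sumL (λ r → rowProb (b ∷ r) * f (b ∷ r)) (allRows n)
      step : ∀ b → S b ≡ (if b then q else 1ℚ - q) * Exr (λ v → f (b ∷ v))
      step b = trans (sumL-cong (λ r → *-assoc (if b then q else 1ℚ - q) (rowProb r) (f (b ∷ r))) (allRows n))
        (trans (sumL-*ˡ (if b then q else 1ℚ - q) (λ r → rowProb r * f (b ∷ r)) (allRows n))
               (cong ((if b then q else 1ℚ - q) *_) (sum-rows (λ v → f (b ∷ v)))))

    sum-outcomes : ∀ {n} (f : Outcome n → ℚ) → sumL (λ ω → prob ω * f ω) (allOutcomes n) ≡ Ex f
    sum-outcomes {zero}  f = trans (+-identityʳ (1ℚ * f [])) (*-identityˡ (f []))
    sum-outcomes {suc n} f = begin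
      sumL (λ ω → prob ω * f ω) (allOutcomes (suc n))
        ≡⟨ sumL-cartesianProductWith (λ ω → prob ω * f ω) _∷_ (allRows n) (allOutcomes n) ⟩
      sumL (λ r → sumL (λ ω → (rowProb r * prob ω) * f (r ∷ ω)) (allOutcomes n)) (allRows n)
        ≡⟨ sumL-cong (λ r → trans (sumL-cong (λ ω → *-assoc (rowProb r) (prob ω) (f (r ∷ ω))) (allOutcomes n))
             (trans (sumL-*ˡ (rowProb r) (λ ω → prob ω * f (r ∷ ω)) (allOutcomes n))
                    (cong (rowProb r *_) (sum-outcomes (λ ω → f (r ∷ ω)))))) (allRows n) ⟩
      sumL (λ r → rowProb r * Ex (λ ω → f (r ∷ ω))) (allRows n)
        ≡⟨ sum-rows (λ r → Ex (λ ω → f (r ∷ ω))) ⟩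
      Ex f ∎
      where open ≡-Reasoning

    module Mean {L : Set} (g : L → L → ℚ) where
      open Weight g

      rowMean : ∀ {n} → L → Vec L n → ℚ
      rowMean l ls = prodV (λ m → q * g l m + (1ℚ - q)) ls

      mean : ∀ {n} → Vec L n → ℚ
      mean []       = 1ℚ
      mean (l ∷ ls) = rowMean l ls * mean ls

      Exr-rowW : ∀ {n} l (ls : Vec L n) → Exr (rowW l ls) ≡ rowMean l ls
      Exr-rowW l []       = refl
      Exr-rowW l (m ∷ ls) = trans
        (cong₂ (λ a b → q * a + (1ℚ - q) * b) (trans (Exr-* (g l m) (rowW l ls)) (cong (g l m *_) (Exr-rowW l ls)))
                                              (trans (Exr-* 1ℚ (rowW l ls)) (cong (1ℚ *_) (Exr-rowW l ls))))
        (solve 4 (λ q p g R → q :* (g :* R) :+ p :* (con 1ℚ :* R) := (q :* g :+ p) :* R)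
          refl q (1ℚ - q) (g l m) (rowMean l ls))

      -- The bits are independent, so the mean of the product is the product of the means q g + (1 -
      -- q) of its factors.
      Ex-W : ∀ {n} (ls : Vec L n) → Ex (W ls) ≡ mean ls
      Ex-W []       = refl
      Ex-W (l ∷ ls) = begin
        Exr (λ r → Ex (λ ω → rowW l ls r * W ls ω))  ≡⟨ Exr-cong (λ r → trans (Ex-* (rowW l ls r) (W ls)) (*-comm (rowW l ls r) (Ex (W ls)))) ⟩
        Exr (λ r → Ex (W ls) * rowW l ls r)          ≡⟨ Exr-* (Ex (W ls)) (rowW l ls) ⟩
        Ex (W ls) * Exr (rowW l ls)                  ≡⟨ cong₂ _*_ (Ex-W ls) (Exr-rowW l ls) ⟩
        mean ls * rowMean l ls                       ≡⟨ *-comm (mean ls) (rowMean l ls) ⟩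
        rowMean l ls * mean ls                       ∎
        where open ≡-Reasoning

  module _ (p : ℝ) (i : ℕ) where
    open Expectation (seq p i)

    seq-rowProbability : ∀ {n} (r : Vec Bool n) → seq (rowProbability p r) i ≡ rowProb r
    seq-rowProbability []          = refl
    seq-rowProbability (true ∷ r)  = trans (*≡ (seq p i) _) (cong (seq p i *_) (seq-rowProbability r))
    seq-rowProbability (false ∷ r) = trans (*≡ _ (seq (rowProbability p r) i))
      (cong₂ _*_ (trans (+≡ 1ℚ (ℚ.- seq p i)) (cong (1ℚ +_) (-≡ (seq p i)))) (seq-rowProbability r))

    seq-probability : ∀ {n} (ω : Outcome n) → seq (probability p ω) i ≡ prob ω
    seq-probability []      = refl
    seq-probability (r ∷ ω) = trans (*≡ (seq (rowProbability p r) i) (seq (probability p ω) i))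
      (cong₂ _*_ (seq-rowProbability r) (seq-probability ω))

    -- Sums and products of reals are formed termwise, so the i-th approximation of the probability
    -- is exactly the probability at density `seq p i`.
    seq-Pr : ∀ {n} (E : Outcome n → Bool) → seq (Pr p E) i ≡ Ex (λ ω → if E ω then 1ℚ else 0ℚ)
    seq-Pr {n} E = trans (lemma (allOutcomes n)) (sum-outcomes (λ ω → if E ω then 1ℚ else 0ℚ))
      where
      Σᴿ : List (Outcome n) → ℝ
      Σᴿ = foldr (λ ω x → (if E ω then probability p ω else 0ᴿ) +ᴿ x) 0ᴿ
      term : ∀ ω b → seq (if b then probability p ω else 0ᴿ) i ≡ prob ω * (if b then 1ℚ else 0ℚ)
      term ω true  = trans (seq-probability ω) (sym (*-identityʳ (prob ω)))
      term ω false = sym (zeroʳ (prob ω))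
      lemma : ∀ ωs → seq (Σᴿ ωs) i ≡ sumL (λ ω → prob ω * (if E ω then 1ℚ else 0ℚ)) ωs
      lemma []       = refl
      lemma (ω ∷ ωs) = trans (+≡ (seq (if E ω then probability p ω else 0ᴿ) i) (seq (Σᴿ ωs) i))
        (cong₂ _+_ (term ω (E ω)) (lemma ωs))

-- Weighted counts of the holes and of the dense sets.

module Obstructions where

  open import Defs using (Outcome; []; _∷_)
  open Rationals
  open Probability
  open import Data.Bool.Base using (Bool; true; false; if_then_else_; _∧_)
  open import Data.Fin.Base using (zero; suc)
  open import Data.Fin.Subset using (Subset; _∩_) renaming (∣_∣ to #_)
  open import Data.List.Base as List using (List; []; _∷_; downFrom)
  open import Data.List.Membership.Propositional using (_∈_)
  open import Data.List.Membership.Propositional.Properties using (∈-downFrom⁺)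
  open import Data.List.Relation.Unary.Any using (here; there)
  open import Data.Nat.Base as ℕ using (ℕ; zero; suc; _≡ᵇ_)
  import Data.Nat.Properties as ℕₚ
  open import Data.Product using (∃-syntax; proj₁; proj₂)
  open import Data.Vec.Base as Vec using (Vec; []; _∷_)
  open import Relation.Binary.PropositionalEquality using (_≡_; refl; sym; trans; cong; cong₂; subst)
  open import Relation.Nullary using (¬_; yes; no; contradiction)

  -- A vector of parts encodes an ordered pair of disjoint vertex sets, so that all such pairs are
  -- enumerated by `vecs`.
  data Part : Set where
    left right neither : Part

  parts : List Part
  parts = left ∷ right ∷ neither ∷ []

  ∈-parts : ∀ l → l ∈ parts
  ∈-parts left    = here refl
  ∈-parts right   = there (here refl)
  ∈-parts neither = there (there (here refl))

  bools : List Bool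
  bools = true ∷ false ∷ []

  ∈-bools : ∀ b → b ∈ bools
  ∈-bools true  = here refl
  ∈-bools false = there (here refl)

  #left #right : ∀ {n} → Vec Part n → ℕ
  #left []             = 0
  #left (left ∷ v)     = suc (#left v)
  #left (right ∷ v)    = #left v
  #left (neither ∷ v)  = #left v
  #right []            = 0
  #right (left ∷ v)    = #right v
  #right (right ∷ v)   = suc (#right v)
  #right (neither ∷ v) = #right v

  forbidCross : Part → Part → ℚ
  forbidCross left  right = 0ℚ
  forbidCross right left  = 0ℚ
  forbidCross _     _     = 1ℚ

  -- The indicator of the event that no edge joins the left to the right vertices.
  hole : ∀ {n} → Vec Part n → Outcome n → ℚ
  hole = Weight.W forbidCross

  perInnerEdge : ℚ → Bool → Bool → ℚ
  perInnerEdge x true true = x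
  perInnerEdge x _    _    = 1ℚ

  #edges : ∀ {n} → Subset n → Outcome n → ℕ
  #edges []          []      = 0
  #edges (true ∷ S)  (r ∷ ω) = # (S ∩ r) ℕ.+ #edges S ω
  #edges (false ∷ S) (r ∷ ω) = #edges S ω

  edgeWeight : ∀ {n} → ℚ → Subset n → Outcome n → ℚ
  edgeWeight x = Weight.W (perInnerEdge x)

  edgeWeight≡ : ∀ x {n} (S : Subset n) ω → edgeWeight x S ω ≡ x ^ #edges S ω
  edgeWeight≡ x []          []      = refl
  edgeWeight≡ x (true ∷ S)  (r ∷ ω) = trans (cong₂ _*_ (row S r) (edgeWeight≡ x S ω)) (sym (^-homo-* x (# (S ∩ r)) (#edges S ω)))
    where
    row : ∀ {n} (S : Subset n) r → Weight.rowW (perInnerEdge x) true S r ≡ x ^ # (S ∩ r)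
    row []          []          = refl
    row (true ∷ S)  (true ∷ r)  = cong (x *_) (row S r)
    row (true ∷ S)  (false ∷ r) = trans (*-identityˡ _) (row S r)
    row (false ∷ S) (true ∷ r)  = trans (*-identityˡ _) (row S r)
    row (false ∷ S) (false ∷ r) = trans (*-identityˡ _) (row S r)
  edgeWeight≡ x (false ∷ S) (r ∷ ω) = trans (cong₂ _*_ (row S r) (edgeWeight≡ x S ω)) (*-identityˡ (x ^ #edges S ω))
    where
    row : ∀ {n} (S : Subset n) r → Weight.rowW (perInnerEdge x) false S r ≡ 1ℚ
    row []      []          = refl
    row (b ∷ S) (true ∷ r)  = trans (*-identityˡ _) (row S r)
    row (b ∷ S) (false ∷ r) = trans (*-identityˡ _) (row S r)

  0≤hole : ∀ {n} (v : Vec Part n) ω → 0ℚ ≤ hole v ω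
  0≤hole []      []      = 0≤1
  0≤hole (l ∷ v) (r ∷ ω) = 0≤* (row v r) (0≤hole v ω)
    where
    0≤forbidCross : ∀ l m → 0ℚ ≤ forbidCross l m
    0≤forbidCross left    left    = 0≤1
    0≤forbidCross left    right   = ≤-refl
    0≤forbidCross left    neither = 0≤1
    0≤forbidCross right   left    = ≤-refl
    0≤forbidCross right   right   = 0≤1
    0≤forbidCross right   neither = 0≤1
    0≤forbidCross neither m       = 0≤1
    row : ∀ {n} (v : Vec Part n) r → 0ℚ ≤ Weight.rowW forbidCross l v r
    row []      []          = 0≤1
    row (m ∷ v) (true ∷ r)  = 0≤* (0≤forbidCross l m) (row v r)
    row (m ∷ v) (false ∷ r) = 0≤* 0≤1 (row v r)

  indicator : Bool → ℚ
  indicator b = if b then 1ℚ else 0ℚ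

  0≤indicator : ∀ b → 0ℚ ≤ indicator b
  0≤indicator true  = 0≤1
  0≤indicator false = ≤-refl

  -- For s = suc j the bias is 2a/s rounded up to an even number, so that
  -- 2a ≤ bias · s ≤ 4a if s ≤ a.
  bias : ℕ → ℕ → ℕ
  bias a j = 2 ℕ.* suc (a ℕ./ suc j)

  0<bias : ∀ a j → 0ℚ < ι (bias a j)
  0<bias a j = 0<ι {bias a j} (ℕ.s≤s ℕ.z≤n)

  bias⁻¹ : ℕ → ℕ → ℚ
  bias⁻¹ a j = proj₁ (inv (0<bias a j))

  holeTerm : ∀ {n} → ℕ → Vec Part n → Outcome n → ℚ
  holeTerm a v ω = indicator ((#left v ≡ᵇ a) ∧ (#right v ≡ᵇ a)) * hole v ω

  -- For a set of s = j + 1 vertices this is `bias` to the power (number of inner edges) - ds, hence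
  -- at least 1 if there are ds inner edges.
  denseTerm : ∀ {n} → ℕ → ℕ → ℕ → Subset n → Outcome n → ℚ
  denseTerm a d j S ω = indicator (# S ≡ᵇ suc j) * (bias⁻¹ a j ^ (d ℕ.* suc j) * edgeWeight (ι (bias a j)) S ω)

  -- A weighted count of the obstructions: it is at least 1 as soon as
  -- there is one.
  badness : ∀ {n} → ℕ → ℕ → Outcome n → ℚ
  badness {n} a d ω = sumL (λ v → holeTerm a v ω) (vecs parts n)
                    + sumL (λ j → sumL (λ S → denseTerm a d j S ω) (vecs bools n)) (downFrom a)

  0≤bias⁻¹ : ∀ a j → 0ℚ ≤ bias⁻¹ a j
  0≤bias⁻¹ a j = <⇒≤ (proj₁ (proj₂ (inv (0<bias a j))))

  bias⁻¹*bias : ∀ a j → bias⁻¹ a j * ι (bias a j) ≡ 1ℚ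
  bias⁻¹*bias a j = proj₂ (proj₂ (inv (0<bias a j)))

  module _ {n : ℕ} (a d : ℕ) (ω : Outcome n) where

    0≤holeTerm : ∀ v → 0ℚ ≤ holeTerm a v ω
    0≤holeTerm v = 0≤* (0≤indicator ((#left v ≡ᵇ a) ∧ (#right v ≡ᵇ a))) (0≤hole v ω)

    0≤denseTerm : ∀ j S → 0ℚ ≤ denseTerm a d j S ω
    0≤denseTerm j S = 0≤* (0≤indicator (# S ≡ᵇ suc j)) (0≤* (0≤^ (d ℕ.* suc j) (0≤bias⁻¹ a j))
      (subst (0ℚ ≤_) (sym (edgeWeight≡ (ι (bias a j)) S ω)) (0≤^ (#edges S ω) (0≤ι (bias a j)))))

    holes denses : ℚ
    holes  = sumL (λ v → holeTerm a v ω) (vecs parts n)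
    denses = sumL (λ j → sumL (λ S → denseTerm a d j S ω) (vecs bools n)) (downFrom a)

    0≤holes : 0ℚ ≤ holes
    0≤holes = 0≤sumL 0≤holeTerm (vecs parts n)

    0≤dense : ∀ j → 0ℚ ≤ sumL (λ S → denseTerm a d j S ω) (vecs bools n)
    0≤dense j = 0≤sumL (0≤denseTerm j) (vecs bools n)

    0≤denses : 0ℚ ≤ denses
    0≤denses = 0≤sumL 0≤dense (downFrom a)

    0≤badness : 0ℚ ≤ badness a d ω
    0≤badness = 0≤+ 0≤holes 0≤denses

    ≡ᵇ-refl : ∀ m → (m ≡ᵇ m) ≡ true
    ≡ᵇ-refl zero    = refl
    ≡ᵇ-refl (suc m) = ≡ᵇ-refl m

    module _ (good : badness a d ω < 1ℚ) where

      no-hole : ∀ v → #left v ≡ a → #right v ≡ a → ¬ (hole v ω ≡ 1ℚ)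
      no-hole v refl eq h = <-irrefl refl (≤-<-trans 1≤badness good)
        where
        term≡1 : holeTerm a v ω ≡ 1ℚ
        term≡1 = trans (cong₂ _*_ (cong indicator (cong₂ _∧_ (≡ᵇ-refl a) (trans (cong (_≡ᵇ a) eq) (≡ᵇ-refl a)))) h) (*-identityˡ 1ℚ)
        1≤badness : 1ℚ ≤ badness a d ω
        1≤badness = ≤-trans (≤-reflexive (sym term≡1))
          (≤-trans (term≤sumL 0≤holeTerm (∈-vecs ∈-parts v)) (≤-cert denses 0≤denses refl))

      sparse : ∀ S j → # S ≡ suc j → j ℕ.< a → #edges S ω ℕ.< d ℕ.* # S
      sparse S j eq j<a with #edges S ω ℕₚ.<? d ℕ.* # S
      ... | yes e<ds = e<ds
      ... | no  e≮ds = contradiction (≤-<-trans 1≤badness good) (<-irrefl refl)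
        where
        x = ι (bias a j)
        r = bias⁻¹ a j
        s = d ℕ.* suc j
        s≤e : s ℕ.≤ #edges S ω
        s≤e = subst (λ k → d ℕ.* k ℕ.≤ #edges S ω) eq (ℕₚ.≮⇒≥ e≮ds)
        1≤term : 1ℚ ≤ denseTerm a d j S ω
        1≤term = begin
          1ℚ                              ≡⟨ sym (trans (sym (^-distrib-* r x s)) (trans (cong (_^ s) (bias⁻¹*bias a j)) (1^ s))) ⟩
          r ^ s * x ^ s                   ≤⟨ *-monoˡ (0≤^ s (0≤bias⁻¹ a j)) (^-monoʳ (subst (_≤ x) ι1≡1 (ι-mono {1} {bias a j} (ℕ.s≤s ℕ.z≤n))) s≤e) ⟩
          r ^ s * x ^ #edges S ω          ≡⟨ cong (r ^ s *_) (sym (edgeWeight≡ x S ω)) ⟩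
          r ^ s * edgeWeight x S ω        ≡⟨ sym (*-identityˡ _) ⟩
          1ℚ * (r ^ s * edgeWeight x S ω) ≡⟨ cong (λ b → indicator b * (r ^ s * edgeWeight x S ω))
                                               (sym (trans (cong (_≡ᵇ suc j) eq) (≡ᵇ-refl (suc j)))) ⟩
          denseTerm a d j S ω             ∎
          where open ≤-Reasoning
        1≤badness : 1ℚ ≤ badness a d ω
        1≤badness = ≤-trans 1≤term (≤-trans (term≤sumL (0≤denseTerm j) (∈-vecs ∈-bools S))
          (≤-trans (term≤sumL 0≤dense (∈-downFrom⁺ j<a)) (≤-cert holes 0≤holes (+-comm denses holes))))

-- First moments of the obstruction counts.

module ObstructionMeans where

  open import Defs using (Outcome; []; _∷_)
  open Rationals
  open Probability
  open Obstructions
  open import Data.Bool.Base using (Bool; true; false; if_then_else_)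
  open import Data.Fin.Subset using (Subset) renaming (∣_∣ to #_)
  open import Data.List.Base as List using ([]; _∷_)
  open import Data.Nat.Base as ℕ using (ℕ; zero; suc; _≡ᵇ_)
  import Data.Nat.Properties as ℕₚ
  open import Data.Product using (∃-syntax)
  open import Data.Vec.Base as Vec using (Vec; []; _∷_)
  open import Relation.Binary.PropositionalEquality using (_≡_; refl; sym; trans; cong; cong₂; subst)

  ½≤1 : ½ ≤ 1ℚ
  ½≤1 = ≤-cert ½ 0≤½ (sym (+≡ ½ ½))

  ½^*2^ : ∀ n → ½ ^ n * ι 2 ^ n ≡ 1ℚ
  ½^*2^ n = trans (sym (^-distrib-* ½ (ι 2) n)) (trans (cong (_^ n) (trans (cong (½ *_) ι2≡2) (sym (*≡ ½ 2ℚ)))) (1^ n))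

  4^≡2^ : ∀ n → ι 4 ^ n ≡ ι 2 ^ (2 ℕ.* n)
  4^≡2^ n = trans (cong (_^ n) (trans (ι-* 2 2) (cong (ι 2 *_) (sym (*-identityʳ (ι 2)))))) (^-assocʳ (ι 2) 2 n)

  ≡ᵇ⇒≡ : ∀ m n → (m ≡ᵇ n) ≡ true → m ≡ n
  ≡ᵇ⇒≡ zero    zero    e = refl
  ≡ᵇ⇒≡ (suc m) (suc n) e = cong suc (≡ᵇ⇒≡ m n e)

  module _ (q : ℚ) (0≤q : 0ℚ ≤ q) (q≤1 : q ≤ 1ℚ) where
    open Expectation q

    prodV-1 : ∀ {L : Set} {u : L → ℚ} → (∀ l → u l ≡ 1ℚ) → ∀ {n} (v : Vec L n) → prodV u v ≡ 1ℚ
    prodV-1 e []      = refl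
    prodV-1 {u = u} e (l ∷ v) = trans (cong (_* prodV u v) (e l)) (trans (*-identityˡ _) (prodV-1 e v))

    -- Only pairs with one end on each side have a mean other than 1, namely 1 - q.
    mean-hole : ∀ {n} (v : Vec Part n) → Mean.mean forbidCross v ≡ (1ℚ - q) ^ (#left v ℕ.* #right v)
    mean-hole []            = refl
    mean-hole (left ∷ v)    = trans (cong₂ _*_ (row v) (mean-hole v)) (sym (^-homo-* (1ℚ - q) (#right v) (#left v ℕ.* #right v)))
      where
      row : ∀ {n} (v : Vec Part n) → Mean.rowMean forbidCross left v ≡ (1ℚ - q) ^ #right v
      row []            = refl
      row (left ∷ v)    = trans (cong₂ _*_ (solve 1 (λ q → q :* con 1ℚ :+ (con 1ℚ :- q) := con 1ℚ) refl q) (row v)) (*-identityˡ _)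
      row (right ∷ v)   = cong₂ _*_ (solve 1 (λ q → q :* con 0ℚ :+ (con 1ℚ :- q) := con 1ℚ :- q) refl q) (row v)
      row (neither ∷ v) = trans (cong₂ _*_ (solve 1 (λ q → q :* con 1ℚ :+ (con 1ℚ :- q) := con 1ℚ) refl q) (row v)) (*-identityˡ _)
    mean-hole (right ∷ v)   = trans (cong₂ _*_ (row v) (mean-hole v))
      (trans (sym (^-homo-* (1ℚ - q) (#left v) (#left v ℕ.* #right v))) (cong ((1ℚ - q) ^_) (sym (ℕₚ.*-suc (#left v) (#right v)))))
      where
      row : ∀ {n} (v : Vec Part n) → Mean.rowMean forbidCross right v ≡ (1ℚ - q) ^ #left v
      row []            = refl
      row (left ∷ v)    = cong₂ _*_ (solve 1 (λ q → q :* con 0ℚ :+ (con 1ℚ :- q) := con 1ℚ :- q) refl q) (row v)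
      row (right ∷ v)   = trans (cong₂ _*_ (solve 1 (λ q → q :* con 1ℚ :+ (con 1ℚ :- q) := con 1ℚ) refl q) (row v)) (*-identityˡ _)
      row (neither ∷ v) = trans (cong₂ _*_ (solve 1 (λ q → q :* con 1ℚ :+ (con 1ℚ :- q) := con 1ℚ) refl q) (row v)) (*-identityˡ _)
    mean-hole (neither ∷ v) = trans (cong₂ _*_ (prodV-1 (λ { left → e ; right → e ; neither → e }) v) (mean-hole v)) (*-identityˡ _)
      where
      e : q * 1ℚ + (1ℚ - q) ≡ 1ℚ
      e = solve 1 (λ q → q :* con 1ℚ :+ (con 1ℚ :- q) := con 1ℚ) refl q

    module _ (x : ℚ) (0≤x : 0ℚ ≤ x) where

      0≤xq : 0ℚ ≤ x * q
      0≤xq = 0≤* 0≤x 0≤q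

      1≤1+xq : 1ℚ ≤ 1ℚ + x * q
      1≤1+xq = ≤-cert (x * q) 0≤xq refl

      0≤1+xq : 0ℚ ≤ 1ℚ + x * q
      0≤1+xq = ≤-trans 0≤1 1≤1+xq

      0≤mean : ∀ {n} (S : Subset n) → 0ℚ ≤ Mean.mean (perInnerEdge x) S
      0≤mean []      = 0≤1
      0≤mean (b ∷ S) = 0≤* (row S) (0≤mean S)
        where
        0≤weight : ∀ b c → 0ℚ ≤ perInnerEdge x b c
        0≤weight true  true  = 0≤x
        0≤weight true  false = 0≤1
        0≤weight false c     = 0≤1
        row : ∀ {n} (S : Subset n) → 0ℚ ≤ Mean.rowMean (perInnerEdge x) b S
        row []      = 0≤1
        row (c ∷ S) = 0≤* (0≤+ (0≤* 0≤q (0≤weight b c)) (0≤- q≤1)) (row S)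

      -- An inner pair has the mean 1 + (x - 1)q ≤ 1 + xq. The number of inner pairs is rounded up
      -- to the square of the size.
      mean-dense : ∀ {n} (S : Subset n) → Mean.mean (perInnerEdge x) S ≤ (1ℚ + x * q) ^ (# S ℕ.* # S)
      mean-dense []          = ≤-refl
      mean-dense (true ∷ S)  = ≤-trans (*-mono (0≤row S) (0≤^ (# S ℕ.* # S) 0≤1+xq) (row S) (mean-dense S))
        (≤-trans (≤-reflexive (sym (^-homo-* (1ℚ + x * q) (# S) (# S ℕ.* # S))))
          (^-monoʳ 1≤1+xq (ℕₚ.+-mono-≤ (ℕₚ.n≤1+n (# S)) (ℕₚ.*-monoʳ-≤ (# S) (ℕₚ.n≤1+n (# S))))))
        where
        0≤row : ∀ {n} (S : Subset n) → 0ℚ ≤ Mean.rowMean (perInnerEdge x) true S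
        0≤row []          = 0≤1
        0≤row (true ∷ S)  = 0≤* (0≤+ (0≤* 0≤q 0≤x) (0≤- q≤1)) (0≤row S)
        0≤row (false ∷ S) = 0≤* (0≤+ (0≤* 0≤q 0≤1) (0≤- q≤1)) (0≤row S)
        row : ∀ {n} (S : Subset n) → Mean.rowMean (perInnerEdge x) true S ≤ (1ℚ + x * q) ^ # S
        row []          = ≤-refl
        row (true ∷ S)  = *-mono (0≤+ (0≤* 0≤q 0≤x) (0≤- q≤1)) (0≤^ (# S) 0≤1+xq)
          (≤-cert q 0≤q (solve 2 (λ q x → (q :* x :+ (con 1ℚ :- q)) :+ q := con 1ℚ :+ x :* q) refl q x)) (row S)
        row (false ∷ S) = ≤-trans (≤-reflexive (trans (cong (_* Mean.rowMean (perInnerEdge x) true S)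
          (solve 1 (λ q → q :* con 1ℚ :+ (con 1ℚ :- q) := con 1ℚ) refl q)) (*-identityˡ _))) (row S)
      mean-dense (false ∷ S) = ≤-trans (≤-reflexive (trans (cong (_* Mean.mean (perInnerEdge x) S)
        (prodV-1 (λ c → solve 1 (λ q → q :* con 1ℚ :+ (con 1ℚ :- q) := con 1ℚ) refl q) S)) (*-identityˡ _))) (mean-dense S)

    partWeight : ℚ → Part → ℚ
    partWeight y neither = 1ℚ
    partWeight y _       = y

    prodV-parts : ∀ y {n} (v : Vec Part n) →
      prodV (partWeight y) v ≡ y ^ (#left v ℕ.+ #right v)
    prodV-parts y []            = refl
    prodV-parts y (left ∷ v)    = cong (y *_) (prodV-parts y v)
    prodV-parts y (right ∷ v)   = trans (cong (y *_) (prodV-parts y v)) (cong (y ^_) (sym (ℕₚ.+-suc (#left v) (#right v))))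
    prodV-parts y (neither ∷ v) = trans (*-identityˡ _) (prodV-parts y v)

    prodV-bools : ∀ y {n} (S : Subset n) → prodV (λ b → if b then y else 1ℚ) S ≡ y ^ # S
    prodV-bools y []          = refl
    prodV-bools y (true ∷ S)  = cong (y *_) (prodV-bools y S)
    prodV-bools y (false ∷ S) = trans (*-identityˡ _) (prodV-bools y S)

    module _ (n : ℕ) (h : ℚ) (0≤h : 0ℚ ≤ h) (h≤1 : h ≤ 1ℚ) (nh≤1 : ι n * h ≤ 1ℚ) where

      -- For h = 1/n the numbers y = a/n and z = n/a are inverse to each other. Inserting 1 = z^(2a)
      -- y^(2a) and then dropping the condition on the sizes bounds the number of pairs by z^(2a) (1
      -- + 2a/n)^n ≤ (4n/a)^(2a).
      holes-bound : ∀ a z → 0ℚ ≤ z → z * (ι a * h) ≡ 1ℚ →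
        Ex {n} (λ ω → sumL (λ v → holeTerm a v ω) (vecs parts n)) ≤ (1ℚ - q) ^ (a ℕ.* a) * z ^ (a ℕ.+ a) * ι 4 ^ (a ℕ.+ a)
      holes-bound a z 0≤z zy≡1 = begin
        Ex {n} (λ ω → sumL (λ v → holeTerm a v ω) (vecs parts n))  ≡⟨ Ex-sumL (holeTerm a) (vecs parts n) ⟩
        sumL (λ v → Ex (holeTerm a v)) (vecs parts n)              ≤⟨ sumL-mono term (vecs parts n) ⟩
        sumL (λ v → M * prodV u v) (vecs parts n)                  ≡⟨ sumL-*ˡ M (prodV u) (vecs parts n) ⟩
        M * sumL (prodV u) (vecs parts n)                          ≡⟨ cong (M *_) (sum-vecs u parts n) ⟩
        M * (y + (y + (1ℚ + 0ℚ))) ^ n                              ≡⟨ cong (λ b → M * b ^ n) sum-u ⟩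
        M * (1ℚ + ι (a ℕ.+ a) * h) ^ n                             ≤⟨ *-monoˡ 0≤M ([1+bh]^n≤4^b h n (a ℕ.+ a) 0≤h h≤1 nh≤1) ⟩
        M * ι 4 ^ (a ℕ.+ a)                                        ∎
        where
        open ≤-Reasoning
        y = ι a * h
        M = (1ℚ - q) ^ (a ℕ.* a) * z ^ (a ℕ.+ a)
        u : Part → ℚ
        u = partWeight y
        0≤y : 0ℚ ≤ y
        0≤y = 0≤* (0≤ι a) 0≤h
        0≤M : 0ℚ ≤ M
        0≤M = 0≤* (0≤^ (a ℕ.* a) (0≤- q≤1)) (0≤^ (a ℕ.+ a) 0≤z)
        sum-u : y + (y + (1ℚ + 0ℚ)) ≡ 1ℚ + ι (a ℕ.+ a) * h
        sum-u = trans (solve 2 (λ a h → a :* h :+ (a :* h :+ (con 1ℚ :+ con 0ℚ)) := con 1ℚ :+ (a :+ a) :* h) refl (ι a) h)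
                      (cong (λ b → 1ℚ + b * h) (sym (ι-+ a a)))
        0≤term : ∀ v → 0ℚ ≤ M * prodV u v
        0≤term v = 0≤* 0≤M (subst (0ℚ ≤_) (sym (prodV-parts y v)) (0≤^ (#left v ℕ.+ #right v) 0≤y))
        term : ∀ v → Ex (holeTerm a v) ≤ M * prodV u v
        term v with #left v ≡ᵇ a in eql | #right v ≡ᵇ a in eqr
        ... | false | _     = ≤-trans (≤-reflexive (trans (Ex-* 0ℚ (hole v)) (zeroˡ (Ex (hole v))))) (0≤term v)
        ... | true  | false = ≤-trans (≤-reflexive (trans (Ex-* 0ℚ (hole v)) (zeroˡ (Ex (hole v))))) (0≤term v)
        ... | true  | true  = ≤-reflexive (begin-equality
          Ex (λ ω → 1ℚ * hole v ω)                  ≡⟨ trans (Ex-* 1ℚ (hole v)) (*-identityˡ (Ex (hole v))) ⟩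
          Ex (hole v)                               ≡⟨ Mean.Ex-W forbidCross v ⟩
          Mean.mean forbidCross v                   ≡⟨ mean-hole v ⟩
          (1ℚ - q) ^ (#left v ℕ.* #right v)         ≡⟨ cong₂ (λ b c → (1ℚ - q) ^ (b ℕ.* c)) #l #r ⟩
          (1ℚ - q) ^ (a ℕ.* a)                      ≡⟨ sym (*-identityʳ _) ⟩
          (1ℚ - q) ^ (a ℕ.* a) * 1ℚ                 ≡⟨ cong ((1ℚ - q) ^ (a ℕ.* a) *_) (sym (trans (sym (^-distrib-* z y (a ℕ.+ a)))
                                                         (trans (cong (_^ (a ℕ.+ a)) zy≡1) (1^ (a ℕ.+ a))))) ⟩
          (1ℚ - q) ^ (a ℕ.* a) * (z ^ (a ℕ.+ a) * y ^ (a ℕ.+ a)) ≡⟨ sym (*-assoc ((1ℚ - q) ^ (a ℕ.* a)) (z ^ (a ℕ.+ a)) (y ^ (a ℕ.+ a))) ⟩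
          M * y ^ (a ℕ.+ a)                         ≡⟨ cong (M *_) (sym (trans (prodV-parts y v) (cong₂ (λ b c → y ^ (b ℕ.+ c)) #l #r))) ⟩
          M * prodV u v                             ∎)
          where
          #l : #left v ≡ a
          #l = ≡ᵇ⇒≡ (#left v) a eql
          #r : #right v ≡ a
          #r = ≡ᵇ⇒≡ (#right v) a eqr

      -- The same device with a single class: a vertex of S has weight s/n, and the number of sets
      -- enters as (4n/s)^s.
      dense-bound : ∀ a d j z → 0ℚ ≤ z → z * (ι (suc j) * h) ≡ 1ℚ → let s = suc j in
        Ex {n} (λ ω → sumL (λ S → denseTerm a d j S ω) (vecs bools n)) ≤
          bias⁻¹ a j ^ (d ℕ.* s) * (1ℚ + ι (bias a j) * q) ^ (s ℕ.* s) * z ^ s * ι 4 ^ s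
      dense-bound a d j z 0≤z zy≡1 = begin
        Ex {n} (λ ω → sumL (λ S → denseTerm a d j S ω) (vecs bools n)) ≡⟨ Ex-sumL (denseTerm a d j) (vecs bools n) ⟩
        sumL (λ S → Ex (denseTerm a d j S)) (vecs bools n)         ≤⟨ sumL-mono term (vecs bools n) ⟩
        sumL (λ S → M * prodV u S) (vecs bools n)                  ≡⟨ sumL-*ˡ M (prodV u) (vecs bools n) ⟩
        M * sumL (prodV u) (vecs bools n)                          ≡⟨ cong (M *_) (sum-vecs u bools n) ⟩
        M * (y + (1ℚ + 0ℚ)) ^ n                                    ≡⟨ cong (λ b → M * b ^ n) (trans (cong (y +_) (+-identityʳ 1ℚ)) (+-comm y 1ℚ)) ⟩
        M * (1ℚ + ι s * h) ^ n                                     ≤⟨ *-monoˡ 0≤M ([1+bh]^n≤4^b h n s 0≤h h≤1 nh≤1) ⟩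
        M * ι 4 ^ s                                                ∎
        where
        open ≤-Reasoning
        s = suc j
        y = ι s * h
        x = ι (bias a j)
        r = bias⁻¹ a j
        M = r ^ (d ℕ.* s) * (1ℚ + x * q) ^ (s ℕ.* s) * z ^ s
        u : Bool → ℚ
        u = λ b → if b then y else 1ℚ
        0≤y : 0ℚ ≤ y
        0≤y = 0≤* (0≤ι s) 0≤h
        0≤r^ : 0ℚ ≤ r ^ (d ℕ.* s)
        0≤r^ = 0≤^ (d ℕ.* s) (0≤bias⁻¹ a j)
        0≤M : 0ℚ ≤ M
        0≤M = 0≤* (0≤* 0≤r^ (0≤^ (s ℕ.* s) (0≤1+xq x (0≤ι (bias a j))))) (0≤^ s 0≤z)
        0≤term : ∀ S → 0ℚ ≤ M * prodV u S
        0≤term S = 0≤* 0≤M (subst (0ℚ ≤_) (sym (prodV-bools y S)) (0≤^ (# S) 0≤y))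
        F : Subset n → Outcome n → ℚ
        F S ω = r ^ (d ℕ.* s) * edgeWeight x S ω
        term : ∀ S → Ex (denseTerm a d j S) ≤ M * prodV u S
        term S with # S ≡ᵇ s in eq
        ... | false = ≤-trans (≤-reflexive (trans (Ex-* 0ℚ (F S)) (zeroˡ (Ex (F S))))) (0≤term S)
        ... | true  = begin
          Ex (λ ω → 1ℚ * F S ω)                     ≡⟨ trans (Ex-* 1ℚ (F S)) (*-identityˡ (Ex (F S))) ⟩
          Ex (F S)                                  ≡⟨ Ex-* (r ^ (d ℕ.* s)) (edgeWeight x S) ⟩
          r ^ (d ℕ.* s) * Ex (edgeWeight x S)       ≡⟨ cong (r ^ (d ℕ.* s) *_) (Mean.Ex-W (perInnerEdge x) S) ⟩
          r ^ (d ℕ.* s) * Mean.mean (perInnerEdge x) S ≤⟨ *-monoˡ 0≤r^ (mean-dense x (0≤ι (bias a j)) S) ⟩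
          r ^ (d ℕ.* s) * (1ℚ + x * q) ^ (# S ℕ.* # S) ≡⟨ cong (λ b → r ^ (d ℕ.* s) * (1ℚ + x * q) ^ (b ℕ.* b)) #S ⟩
          r ^ (d ℕ.* s) * (1ℚ + x * q) ^ (s ℕ.* s)  ≡⟨ sym (*-identityʳ _) ⟩
          r ^ (d ℕ.* s) * (1ℚ + x * q) ^ (s ℕ.* s) * 1ℚ ≡⟨ cong (r ^ (d ℕ.* s) * (1ℚ + x * q) ^ (s ℕ.* s) *_) (sym (trans (sym (^-distrib-* z y s))
                                                         (trans (cong (_^ s) zy≡1) (1^ s)))) ⟩
          r ^ (d ℕ.* s) * (1ℚ + x * q) ^ (s ℕ.* s) * (z ^ s * y ^ s) ≡⟨ sym (*-assoc (r ^ (d ℕ.* s) * (1ℚ + x * q) ^ (s ℕ.* s)) (z ^ s) (y ^ s)) ⟩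
          M * y ^ s                                 ≡⟨ cong (M *_) (sym (trans (prodV-bools y S) (cong (y ^_) #S))) ⟩
          M * prodV u S                             ∎
          where
          #S : # S ≡ s
          #S = ≡ᵇ⇒≡ (# S) s eq

-- The failure probability is at most 2 / 2^t.

module FailureProbability where

  open import Defs using (Outcome)
  open Rationals
  open Probability
  open Obstructions
  open ObstructionMeans
  open import Data.Bool.Base using (Bool; true; false; if_then_else_)
  open import Data.List.Base as List using (downFrom)
  open import Data.Nat.Base as ℕ using (ℕ; zero; suc)
  import Data.Nat.Properties as ℕₚ
  import Data.Nat.DivMod as ℕ/
  import Data.Nat.Solver as ℕS
  open import Data.Product using (∃-syntax; proj₁; proj₂)
  open import Relation.Binary.PropositionalEquality using (_≡_; refl; sym; trans; cong; cong₂; subst)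
  open import Relation.Nullary using (Dec; yes; no; does)

  -- A comparison of rationals, hence decidable, in which the density does not occur.
  good : ∀ {n} → ℕ → ℕ → Outcome n → Bool
  good a d ω = does (badness a d ω <? 1ℚ)

  good⇒badness<1 : ∀ {n} a d (ω : Outcome n) → good a d ω ≡ true → badness a d ω < 1ℚ
  good⇒badness<1 a d ω = split (badness a d ω <? 1ℚ)
    where
    split : {b : ℚ} (b<1? : Dec (b < 1ℚ)) → does b<1? ≡ true → b < 1ℚ
    split (yes b<1) _ = b<1

  ½^[m+k]*2^k : ∀ m k → ½ ^ (m ℕ.+ k) * ι 2 ^ k ≡ ½ ^ m
  ½^[m+k]*2^k m k = trans (cong (_* ι 2 ^ k) (^-homo-* ½ m k))
    (trans (*-assoc (½ ^ m) (½ ^ k) (ι 2 ^ k)) (trans (cong (½ ^ m *_) (½^*2^ k)) (*-identityʳ (½ ^ m))))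

  sum-½^ : ∀ a → sumL (λ j → ½ ^ suc j) (downFrom a) ≤ 1ℚ
  sum-½^ a = ≤-cert (½ ^ a) (0≤^ a 0≤½) (total a)
    where
    total : ∀ a → sumL (λ j → ½ ^ suc j) (downFrom a) + ½ ^ a ≡ 1ℚ
    total zero    = +-identityˡ 1ℚ
    total (suc a) = trans (solve 2 (λ b s → (con ½ :* b :+ s) :+ con ½ :* b := s :+ b) refl (½ ^ a) (sumL (λ j → ½ ^ suc j) (downFrom a))) (total a)

  module _ (q : ℚ) (0≤q : 0ℚ ≤ q) (q≤1 : q ≤ 1ℚ) where
    open Expectation q

    markov : ∀ {n} a d → 1ℚ ≤ Ex {n} (λ ω → if good a d ω then 1ℚ else 0ℚ) + Ex {n} (badness a d)
    markov {n} a d = ≤-trans (≤-reflexive (sym (Ex-const n 1ℚ)))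
      (≤-trans (Ex-mono 0≤q q≤1 {n} {λ _ → 1ℚ} pointwise)
        (≤-reflexive (Ex-+ {n} (λ ω → if good a d ω then 1ℚ else 0ℚ) (badness a d))))
      where
      pointwise : ∀ ω → 1ℚ ≤ (if good a d ω then 1ℚ else 0ℚ) + badness a d ω
      pointwise ω = split (badness a d ω) (0≤badness a d ω) (badness a d ω <? 1ℚ)
        where
        split : ∀ b → 0ℚ ≤ b → (b<1? : Dec (b < 1ℚ)) → 1ℚ ≤ (if does b<1? then 1ℚ else 0ℚ) + b
        split b 0≤b (yes b<1) = ≤-cert b 0≤b refl
        split b 0≤b (no  b≮1) = subst (1ℚ ≤_) (sym (+-identityˡ b)) (≮⇒≥ b≮1)

    good≤1 : ∀ {n} a d → Ex {n} (λ ω → if good a d ω then 1ℚ else 0ℚ) ≤ 1ℚ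
    good≤1 {n} a d = subst (Ex {n} (λ ω → if good a d ω then 1ℚ else 0ℚ) ≤_) (Ex-const n 1ℚ)
      (Ex-mono 0≤q q≤1 {n} {g = λ _ → 1ℚ} (λ ω → indicator≤1 (good a d ω)))
      where
      indicator≤1 : ∀ b → (if b then 1ℚ else 0ℚ) ≤ 1ℚ
      indicator≤1 true  = ≤-refl
      indicator≤1 false = 0≤1

  module Failure (q : ℚ) (0≤q : 0ℚ ≤ q) (q≤1 : q ≤ 1ℚ) (n w t : ℕ)
    (1≤n : 1 ℕ.≤ n) (1≤w : 1 ℕ.≤ w) (1≤t : 1 ℕ.≤ t) (n≤w2^t : n ℕ.≤ w ℕ.* 2 ℕ.^ t)
    (1≤wq : 1ℚ ≤ ι w * q) (wq≤5 : ι w * q ≤ ι 5) where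
    open Expectation q

    -- In a factor of the dense sets bias⁻ᵈ has to absorb 4^(80t) from the
    -- edge weights and 2^t · bias from the number of sets, leaving 2^(-2t).
    a d : ℕ
    a = 4 ℕ.* t ℕ.* w
    d = 163 ℕ.* t ℕ.+ 1

    1≤a : 1 ℕ.≤ a
    1≤a = ℕₚ.*-mono-≤ (ℕₚ.*-mono-≤ {1} {4} (ℕ.s≤s ℕ.z≤n) 1≤t) 1≤w

    h : ℚ
    h = proj₁ (inv (0<ι 1≤n))
    hn≡1 : h * ι n ≡ 1ℚ
    hn≡1 = proj₂ (proj₂ (inv (0<ι 1≤n)))
    0≤h : 0ℚ ≤ h
    0≤h = <⇒≤ (proj₁ (proj₂ (inv (0<ι 1≤n))))
    nh≤1 : ι n * h ≤ 1ℚ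
    nh≤1 = ≤-reflexive (trans (*-comm (ι n) h) hn≡1)
    h≤1 : h ≤ 1ℚ
    h≤1 = ≤-trans (subst (_≤ h * ι n) (trans (cong (h *_) ι1≡1) (*-identityʳ h)) (*-monoˡ 0≤h (ι-mono 1≤n))) (≤-reflexive hn≡1)

    module Inverse (m : ℕ) (1≤m : 1 ℕ.≤ m) where
      g : ℚ
      g = proj₁ (inv (0<ι 1≤m))
      gm≡1 : g * ι m ≡ 1ℚ
      gm≡1 = proj₂ (proj₂ (inv (0<ι 1≤m)))
      0≤g : 0ℚ ≤ g
      0≤g = <⇒≤ (proj₁ (proj₂ (inv (0<ι 1≤m))))
      z : ℚ
      z = ι n * g
      0≤z : 0ℚ ≤ z
      0≤z = 0≤* (0≤ι n) 0≤g
      zm≡n : z * ι m ≡ ι n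
      zm≡n = trans (*-assoc (ι n) g (ι m)) (trans (cong (ι n *_) gm≡1) (*-identityʳ (ι n)))
      zmh≡1 : z * (ι m * h) ≡ 1ℚ
      zmh≡1 = trans (sym (*-assoc z (ι m) h)) (trans (cong (_* h) zm≡n) (trans (*-comm (ι n) h) hn≡1))
      4z≤ : ∀ b → 4 ℕ.* n ℕ.≤ b ℕ.* m → z * ι 4 ≤ ι b
      4z≤ b 4n≤bm = *-cancelʳ (0<ι 1≤m) (≤-trans (≤-reflexive
        (trans (solve 3 (λ z m f → z :* f :* m := f :* (z :* m)) refl z (ι m) (ι 4))
          (trans (cong (ι 4 *_) zm≡n) (sym (ι-* 4 n)))))
        (≤-trans (ι-mono 4n≤bm) (≤-reflexive (ι-* b m))))

    private module N = ℕS.+-*-Solver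

    -- Since a = 4tw and (1 - q)^w ≤ 1/2, a given pair is a hole with probability at most 2^(-4ta).
    -- There are at most (4n/a)^(2a) ≤ 2^(2ta) pairs, because 4n ≤ 2^t a.
    holes-fail : Ex {n} (λ ω → sumL (λ v → holeTerm a v ω) (vecs parts n)) ≤ ½ ^ t
    holes-fail = begin
      Ex {n} (λ ω → sumL (λ v → holeTerm a v ω) (vecs parts n))  ≤⟨ holes-bound q 0≤q q≤1 n h 0≤h h≤1 nh≤1 a z 0≤z zmh≡1 ⟩
      (1ℚ - q) ^ (a ℕ.* a) * z ^ b * ι 4 ^ b                     ≡⟨ *-assoc ((1ℚ - q) ^ (a ℕ.* a)) (z ^ b) (ι 4 ^ b) ⟩
      (1ℚ - q) ^ (a ℕ.* a) * (z ^ b * ι 4 ^ b)                   ≡⟨ cong₂ _*_ (trans (cong ((1ℚ - q) ^_) aa) (sym (^-assocʳ (1ℚ - q) w (e ℕ.+ e)))) (sym (^-distrib-* z (ι 4) b)) ⟩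
      ((1ℚ - q) ^ w) ^ (e ℕ.+ e) * (z * ι 4) ^ b                 ≤⟨ *-mono (0≤^ (e ℕ.+ e) (0≤^ w (0≤- q≤1))) (0≤^ b (0≤ι (2 ℕ.^ t)))
                                                                      (^-mono (e ℕ.+ e) (0≤^ w (0≤- q≤1)) ([1-q]^w≤½ q w 0≤q q≤1 1≤wq))
                                                                      (^-mono b (0≤* 0≤z (0≤ι 4)) (4z≤ (2 ℕ.^ t) 4n≤)) ⟩
      ½ ^ (e ℕ.+ e) * ι (2 ℕ.^ t) ^ b                            ≡⟨ cong (½ ^ (e ℕ.+ e) *_) (trans (cong (_^ b) (ι-^ 2 t)) (trans (^-assocʳ (ι 2) t b) (cong (ι 2 ^_) tb))) ⟩
      ½ ^ (e ℕ.+ e) * ι 2 ^ e                                    ≡⟨ ½^[m+k]*2^k e e ⟩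
      ½ ^ e                                                      ≤⟨ ^-antimonoʳ 0≤½ ½≤1 t≤e ⟩
      ½ ^ t                                                      ∎
      where
      open ≤-Reasoning
      open Inverse a 1≤a
      b = a ℕ.+ a
      e = 2 ℕ.* t ℕ.* a
      aa : a ℕ.* a ≡ w ℕ.* (e ℕ.+ e)
      aa = N.solve 3 (λ t w a → N.con 4 N.:* t N.:* w N.:* a N.:= w N.:* (N.con 2 N.:* t N.:* a N.:+ N.con 2 N.:* t N.:* a)) refl t w a
      tb : t ℕ.* b ≡ e
      tb = N.solve 2 (λ t a → t N.:* (a N.:+ a) N.:= N.con 2 N.:* t N.:* a) refl t a
      t≤e : t ℕ.≤ e
      t≤e = subst (ℕ._≤ e) (ℕₚ.*-identityʳ t) (ℕₚ.*-mono-≤ (ℕₚ.m≤m+n t (t ℕ.+ 0)) 1≤a)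
      4n≤ : 4 ℕ.* n ℕ.≤ 2 ℕ.^ t ℕ.* a
      4n≤ = ℕₚ.≤-trans (ℕₚ.*-monoʳ-≤ 4 n≤w2^t) (ℕₚ.≤-trans (ℕₚ.m≤n*m (4 ℕ.* (w ℕ.* 2 ℕ.^ t)) t {{ℕ.>-nonZero 1≤t}})
        (ℕₚ.≤-reflexive (N.solve 3 (λ t w x → t N.:* (N.con 4 N.:* (w N.:* x)) N.:= x N.:* (N.con 4 N.:* t N.:* w)) refl t w (2 ℕ.^ t))))

    -- The bound is the s-th power of r^d Y^s (4z), and `inner` puts this base below 2^(-2t). As 2ts
    -- ≥ t + s, a factor 2^(-s) remains, which makes the sum over all sizes converge.
    dense-fail : ∀ j → j ℕ.< a → Ex {n} (λ ω → sumL (λ S → denseTerm a d j S ω) (vecs bools n)) ≤ ½ ^ t * ½ ^ suc j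
    dense-fail j j<a = begin
      Ex {n} (λ ω → sumL (λ S → denseTerm a d j S ω) (vecs bools n)) ≤⟨ dense-bound q 0≤q q≤1 n h 0≤h h≤1 nh≤1 a d j z 0≤z zmh≡1 ⟩
      r ^ (d ℕ.* s) * Y ^ (s ℕ.* s) * z ^ s * ι 4 ^ s            ≡⟨ regroup ⟩
      (r ^ d * Y ^ s * (z * ι 4)) ^ s                            ≤⟨ ^-mono s (0≤* (0≤* (0≤^ d 0≤r) (0≤^ s 0≤Y)) (0≤* 0≤z (0≤ι 4))) inner ⟩
      (½ ^ (2 ℕ.* t)) ^ s                                        ≡⟨ ^-assocʳ ½ (2 ℕ.* t) s ⟩
      ½ ^ (2 ℕ.* t ℕ.* s)                                        ≤⟨ ^-antimonoʳ 0≤½ ½≤1 t+s≤2ts ⟩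
      ½ ^ (t ℕ.+ s)                                              ≡⟨ ^-homo-* ½ t s ⟩
      ½ ^ t * ½ ^ s                                              ∎
      where
      open ≤-Reasoning
      s = suc j
      open Inverse s (ℕ.s≤s ℕ.z≤n)
      x : ℕ
      x = bias a j
      r Y : ℚ
      r = bias⁻¹ a j
      Y = 1ℚ + ι x * q
      0≤r : 0ℚ ≤ r
      0≤r = 0≤bias⁻¹ a j
      rx≡1 : r * ι x ≡ 1ℚ
      rx≡1 = bias⁻¹*bias a j
      0≤Y : 0ℚ ≤ Y
      0≤Y = 0≤+ 0≤1 (0≤* (0≤ι x) 0≤q)
      t+s≤2ts : t ℕ.+ s ℕ.≤ 2 ℕ.* t ℕ.* s
      t+s≤2ts = ℕₚ.≤-trans (ℕₚ.+-mono-≤ (ℕₚ.m≤m*n t s) (ℕₚ.m≤n*m s t {{ℕ.>-nonZero 1≤t}}))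
        (ℕₚ.≤-reflexive (N.solve 2 (λ t s → t N.:* s N.:+ t N.:* s N.:= N.con 2 N.:* t N.:* s) refl t s))
      regroup : r ^ (d ℕ.* s) * Y ^ (s ℕ.* s) * z ^ s * ι 4 ^ s ≡ (r ^ d * Y ^ s * (z * ι 4)) ^ s
      regroup = trans (*-assoc (r ^ (d ℕ.* s) * Y ^ (s ℕ.* s)) (z ^ s) (ι 4 ^ s))
        (trans (cong₂ _*_ (trans (cong₂ _*_ (sym (^-assocʳ r d s)) (sym (^-assocʳ Y s s))) (sym (^-distrib-* (r ^ d) (Y ^ s) s)))
                          (sym (^-distrib-* z (ι 4) s)))
               (sym (^-distrib-* (r ^ d * Y ^ s) (z * ι 4) s)))
      2a≤xs : 2 ℕ.* a ℕ.≤ x ℕ.* s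
      2a≤xs = ℕₚ.≤-trans (ℕₚ.*-monoʳ-≤ 2 (ℕₚ.≤-trans (ℕₚ.≤-reflexive (ℕ/.m≡m%n+[m/n]*n a s))
          (ℕₚ.+-monoˡ-≤ (a ℕ./ s ℕ.* s) (ℕₚ.<⇒≤ (ℕ/.m%n<n a s)))))
        (ℕₚ.≤-reflexive (sym (ℕₚ.*-assoc 2 (suc (a ℕ./ s)) s)))
      xs≤4a : x ℕ.* s ℕ.≤ 4 ℕ.* a
      xs≤4a = ℕₚ.≤-trans (ℕₚ.≤-reflexive (ℕₚ.*-assoc 2 (suc (a ℕ./ s)) s))
        (ℕₚ.≤-trans (ℕₚ.*-monoʳ-≤ 2 (ℕₚ.+-mono-≤ j<a (ℕ/.m/n*n≤m a s)))
          (ℕₚ.≤-reflexive (N.solve 1 (λ a → N.con 2 N.:* (a N.:+ a) N.:= N.con 4 N.:* a) refl a)))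
      4n≤ : 4 ℕ.* n ℕ.≤ (2 ℕ.^ t ℕ.* x) ℕ.* s
      4n≤ = ℕₚ.≤-trans (ℕₚ.*-monoʳ-≤ 4 n≤w2^t) (ℕₚ.≤-trans
          (ℕₚ.m≤n*m (4 ℕ.* (w ℕ.* 2 ℕ.^ t)) (2 ℕ.* t) {{ℕ.>-nonZero (ℕₚ.≤-trans 1≤t (ℕₚ.m≤m+n t (t ℕ.+ 0)))}})
        (ℕₚ.≤-trans (ℕₚ.≤-reflexive (N.solve 3 (λ t w y → (N.con 2 N.:* t) N.:* (N.con 4 N.:* (w N.:* y)) N.:= y N.:* (N.con 2 N.:* (N.con 4 N.:* t N.:* w))) refl t w (2 ℕ.^ t)))
        (ℕₚ.≤-trans (ℕₚ.*-monoʳ-≤ (2 ℕ.^ t) 2a≤xs) (ℕₚ.≤-reflexive (sym (ℕₚ.*-assoc (2 ℕ.^ t) x s))))))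
      -- 80 = 16 · 5: the bias times s is at most 4a = 16tw, and wq ≤ 5. Hence Y is at most 1 +
      -- 80t/s, and its s-th power at most 4^(80t).
      xq≤ : ι x * q ≤ ι (80 ℕ.* t) * g
      xq≤ = begin
        ι x * q                          ≡⟨ sym (*-identityˡ (ι x * q)) ⟩
        1ℚ * (ι x * q)                   ≡⟨ cong (_* (ι x * q)) (sym gm≡1) ⟩
        g * ι s * (ι x * q)              ≡⟨ solve 4 (λ g s x q → g :* s :* (x :* q) := x :* s :* (q :* g)) refl g (ι s) (ι x) q ⟩
        ι x * ι s * (q * g)              ≡⟨ cong (_* (q * g)) (sym (ι-* x s)) ⟩
        ι (x ℕ.* s) * (q * g)            ≤⟨ *-monoʳ (0≤* 0≤q 0≤g) (ι-mono (ℕₚ.≤-trans xs≤4a (ℕₚ.≤-reflexive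
                                              (N.solve 2 (λ t w → N.con 4 N.:* (N.con 4 N.:* t N.:* w) N.:= N.con 16 N.:* t N.:* w) refl t w)))) ⟩
        ι (16 ℕ.* t ℕ.* w) * (q * g)     ≡⟨ cong (_* (q * g)) (ι-* (16 ℕ.* t) w) ⟩
        ι (16 ℕ.* t) * ι w * (q * g)     ≡⟨ solve 4 (λ b w q g → b :* w :* (q :* g) := (w :* q) :* (b :* g)) refl (ι (16 ℕ.* t)) (ι w) q g ⟩
        (ι w * q) * (ι (16 ℕ.* t) * g)   ≤⟨ *-monoʳ (0≤* (0≤ι (16 ℕ.* t)) 0≤g) wq≤5 ⟩
        ι 5 * (ι (16 ℕ.* t) * g)         ≡⟨ sym (*-assoc (ι 5) (ι (16 ℕ.* t)) g) ⟩
        ι 5 * ι (16 ℕ.* t) * g           ≡⟨ cong (_* g) (trans (sym (ι-* 5 (16 ℕ.* t))) (cong ι (sym (ℕₚ.*-assoc 5 16 t)))) ⟩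
        ι (80 ℕ.* t) * g                 ∎
      Y^s≤ : Y ^ s ≤ ι 2 ^ (160 ℕ.* t)
      Y^s≤ = ≤-trans (^-mono s 0≤Y (+-monoʳ-≤ 1ℚ xq≤))
        (≤-trans ([1+bh]^n≤4^b g s (80 ℕ.* t) 0≤g g≤1 (≤-reflexive (trans (*-comm (ι s) g) gm≡1)))
          (≤-reflexive (trans (4^≡2^ (80 ℕ.* t)) (cong (ι 2 ^_) (sym (ℕₚ.*-assoc 2 80 t))))))
        where
        g≤1 : g ≤ 1ℚ
        g≤1 = ≤-trans (subst (_≤ g * ι s) (trans (cong (g *_) ι1≡1) (*-identityʳ g)) (*-monoˡ 0≤g (ι-mono {1} {s} (ℕ.s≤s ℕ.z≤n)))) (≤-reflexive gm≡1)
      r≤½ : r ≤ ½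
      r≤½ = *-cancelʳ {c = ι x} (0<bias a j) (≤-trans (≤-reflexive (trans rx≡1 (trans (*≡ ½ 2ℚ) (cong (½ *_) (sym ι2≡2)))))
        (*-monoˡ {ι 2} {ι x} {½} 0≤½ (ι-mono {2} {x} (ℕₚ.m≤m*n 2 (suc (a ℕ./ s))))))
      inner : r ^ d * Y ^ s * (z * ι 4) ≤ ½ ^ (2 ℕ.* t)
      inner = begin
        r ^ d * Y ^ s * (z * ι 4)
          ≤⟨ *-mono (0≤* (0≤^ d 0≤r) (0≤^ s 0≤Y)) (0≤ι (2 ℕ.^ t ℕ.* x)) (*-monoˡ (0≤^ d 0≤r) Y^s≤) (4z≤ (2 ℕ.^ t ℕ.* x) 4n≤) ⟩
        r ^ d * ι 2 ^ (160 ℕ.* t) * ι (2 ℕ.^ t ℕ.* x)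
          ≡⟨ cong₂ (λ u v → u * ι 2 ^ (160 ℕ.* t) * v) (trans (^-homo-* r (163 ℕ.* t) 1) (cong (r ^ (163 ℕ.* t) *_) (*-identityʳ r)))
               (trans (ι-* (2 ℕ.^ t) x) (cong (_* ι x) (ι-^ 2 t))) ⟩
        r ^ (163 ℕ.* t) * r * ι 2 ^ (160 ℕ.* t) * (ι 2 ^ t * ι x)
          ≡⟨ solve 5 (λ R r U V x → R :* r :* U :* (V :* x) := R :* (U :* V) :* (r :* x)) refl
               (r ^ (163 ℕ.* t)) r (ι 2 ^ (160 ℕ.* t)) (ι 2 ^ t) (ι x) ⟩
        r ^ (163 ℕ.* t) * (ι 2 ^ (160 ℕ.* t) * ι 2 ^ t) * (r * ι x)
          ≡⟨ trans (cong (r ^ (163 ℕ.* t) * (ι 2 ^ (160 ℕ.* t) * ι 2 ^ t) *_) rx≡1) (*-identityʳ _) ⟩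
        r ^ (163 ℕ.* t) * (ι 2 ^ (160 ℕ.* t) * ι 2 ^ t)
          ≤⟨ *-monoʳ (0≤* (0≤^ (160 ℕ.* t) (0≤ι 2)) (0≤^ t (0≤ι 2))) (^-mono (163 ℕ.* t) 0≤r r≤½) ⟩
        ½ ^ (163 ℕ.* t) * (ι 2 ^ (160 ℕ.* t) * ι 2 ^ t)
          ≡⟨ cong₂ _*_ (cong (½ ^_) (N.solve 1 (λ t → N.con 163 N.:* t N.:= N.con 2 N.:* t N.:+ (N.con 160 N.:* t N.:+ t)) refl t))
               (sym (^-homo-* (ι 2) (160 ℕ.* t) t)) ⟩
        ½ ^ (2 ℕ.* t ℕ.+ (160 ℕ.* t ℕ.+ t)) * ι 2 ^ (160 ℕ.* t ℕ.+ t)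
          ≡⟨ ½^[m+k]*2^k (2 ℕ.* t) (160 ℕ.* t ℕ.+ t) ⟩
        ½ ^ (2 ℕ.* t) ∎

    denses-fail : ∀ b → b ℕ.≤ a →
      Ex {n} (λ ω → sumL (λ j → sumL (λ S → denseTerm a d j S ω) (vecs bools n)) (downFrom b)) ≤ ½ ^ t * sumL (λ j → ½ ^ suc j) (downFrom b)
    denses-fail zero    _   = ≤-reflexive (trans (Ex-const n 0ℚ) (sym (zeroʳ (½ ^ t))))
    denses-fail (suc b) b<a = ≤-trans
      (≤-reflexive (Ex-+ (λ ω → sumL (λ S → denseTerm a d b S ω) (vecs bools n))
                         (λ ω → sumL (λ j → sumL (λ S → denseTerm a d j S ω) (vecs bools n)) (downFrom b))))
      (≤-trans (+-mono-≤ (dense-fail b b<a) (denses-fail b (ℕₚ.<⇒≤ b<a)))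
        (≤-reflexive (sym (*-distribˡ-+ (½ ^ t) (½ ^ suc b) (sumL (λ j → ½ ^ suc j) (downFrom b))))))

    Ex-badness : Ex {n} (badness a d) ≤ ½ ^ t + ½ ^ t
    Ex-badness = ≤-trans
      (≤-reflexive (Ex-+ {n} (λ ω → sumL (λ v → holeTerm a v ω) (vecs parts n))
                         (λ ω → sumL (λ j → sumL (λ S → denseTerm a d j S ω) (vecs bools n)) (downFrom a))))
      (+-mono-≤ holes-fail (≤-trans (denses-fail a ℕₚ.≤-refl)
        (≤-trans (*-monoˡ (0≤^ t 0≤½) (sum-½^ a)) (≤-reflexive (*-identityʳ (½ ^ t))))))

    Ex-good : 1ℚ ≤ Ex {n} (λ ω → if good a d ω then 1ℚ else 0ℚ) + (½ ^ t + ½ ^ t)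
    Ex-good = ≤-trans (markov q 0≤q q≤1 {n} a d) (+-monoʳ-≤ (Ex {n} (λ ω → if good a d ω then 1ℚ else 0ℚ)) Ex-badness)

-- Induced degrees and colourings of sparse sets.

module Degeneracy where

  open import Defs using (Outcome; []; _∷_; edge; edge-sym; edge-irrefl)
  open Obstructions using (#edges)
  open import Data.Bool.Base using (Bool; true; false; _∧_)
  import Data.Bool.Properties as Bool
  open import Data.Empty using (⊥; ⊥-elim)
  open import Data.Fin.Base using (Fin; zero; suc)
  import Data.Fin.Properties as Fin
  open import Data.Fin.Subset using (Subset; _∈_; _∉_; _⊆_; _∩_; _∪_; _─_; _-_; ⁅_⁆) renaming (∣_∣ to #_; ⊥ to ∅)
  open import Data.Fin.Subset.Properties
  open import Data.Nat.Base
  open import Data.Nat.Properties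
  open import Data.Nat.Solver using (module +-*-Solver)
  open import Data.Product using (∃-syntax; _×_; _,_)
  open import Data.Sum using (inj₁; inj₂; [_,_]′)
  open import Data.Vec.Base using ([]; _∷_; tabulate; lookup; here; there)
  open import Data.Vec.Properties using (lookup∘tabulate; tabulate∘lookup; []=⇒lookup; lookup⇒[]=)
  open import Function.Base using (_∘_)
  open import Relation.Binary.PropositionalEquality
  open import Relation.Nullary using (¬_; Dec; yes; no; does; contradiction; _×-dec_)
  open import Relation.Nullary.Decidable using (dec-true)

  private variable
    n : ℕ

  Disjoint : Subset n → Subset n → Set
  Disjoint A B = ∀ {x} → x ∈ A → x ∈ B → ⊥

  ∪-⊆ : {A B C : Subset n} → A ⊆ C → B ⊆ C → A ∪ B ⊆ C
  ∪-⊆ {A = A} {B} A⊆C B⊆C x∈ = [ A⊆C , B⊆C ]′ (x∈p∪q⁻ A B x∈)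

  ∈∪ˡ : {A B : Subset n} → ∀ {x} → x ∈ A → x ∈ A ∪ B
  ∈∪ˡ x∈A = x∈p∪q⁺ (inj₁ x∈A)

  ∈∪ʳ : {A B : Subset n} → ∀ {x} → x ∈ B → x ∈ A ∪ B
  ∈∪ʳ x∈B = x∈p∪q⁺ (inj₂ x∈B)

  #∪-disjoint : (A B : Subset n) → Disjoint A B → # (A ∪ B) ≡ # A + # B
  #∪-disjoint []          []          _ = refl
  #∪-disjoint (true ∷ A)  (true ∷ B)  d = ⊥-elim (d here here)
  #∪-disjoint (true ∷ A)  (false ∷ B) d = cong suc (#∪-disjoint A B (λ x y → d (there x) (there y)))
  #∪-disjoint (false ∷ A) (true ∷ B)  d = trans (cong suc (#∪-disjoint A B (λ x y → d (there x) (there y)))) (sym (+-suc (# A) (# B)))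
  #∪-disjoint (false ∷ A) (false ∷ B) d = #∪-disjoint A B (λ x y → d (there x) (there y))

  #∪-≤ : (A B : Subset n) → # (A ∪ B) ≤ # A + # B
  #∪-≤ []          []          = z≤n
  #∪-≤ (true ∷ A)  (true ∷ B)  = s≤s (≤-trans (#∪-≤ A B) (+-monoʳ-≤ (# A) (n≤1+n (# B))))
  #∪-≤ (true ∷ A)  (false ∷ B) = s≤s (#∪-≤ A B)
  #∪-≤ (false ∷ A) (true ∷ B)  = ≤-trans (s≤s (#∪-≤ A B)) (≤-reflexive (sym (+-suc (# A) (# B))))
  #∪-≤ (false ∷ A) (false ∷ B) = #∪-≤ A B

  #-insert : (A : Subset n) → ∀ {v} → v ∉ A → # (A ∪ ⁅ v ⁆) ≡ suc (# A)
  #-insert A {v} v∉A = trans (#∪-disjoint A ⁅ v ⁆ (λ x∈A x∈v → v∉A (subst (_∈ A) (x∈⁅y⁆⇒x≡y v x∈v) x∈A)))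
    (trans (cong (# A +_) (∣⁅x⁆∣≡1 v)) (+-comm (# A) 1))

  #─ : (S T : Subset n) → T ⊆ S → # (S ─ T) + # T ≡ # S
  #─ []          []          _   = refl
  #─ (true ∷ S)  (true ∷ T)  T⊆S = trans (+-suc (# (S ─ T)) (# T)) (cong suc (#─ S T (drop-∷-⊆ T⊆S)))
  #─ (true ∷ S)  (false ∷ T) T⊆S = cong suc (#─ S T (drop-∷-⊆ T⊆S))
  #─ (false ∷ S) (true ∷ T)  T⊆S with T⊆S here
  ... | ()
  #─ (false ∷ S) (false ∷ T) T⊆S = #─ S T (drop-∷-⊆ T⊆S)

  subset-of-size : (S : Subset n) → ∀ b → b ≤ # S → ∃[ T ] (T ⊆ S × # T ≡ b)
  subset-of-size {n} S zero _ = ∅ , (λ x∈∅ → ⊥-elim (∉⊥ x∈∅)) , ∣⊥∣≡0 n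
  subset-of-size (true ∷ S) (suc b) (s≤s b≤S) with subset-of-size S b b≤S
  ... | T , T⊆S , #T = true ∷ T , s⊆s T⊆S , cong suc #T
  subset-of-size (false ∷ S) (suc b) b≤S with subset-of-size S (suc b) b≤S
  ... | T , T⊆S , #T = false ∷ T , s⊆s T⊆S , #T

  #>0⇒nonempty : (S : Subset n) → 0 < # S → ∃[ v ] v ∈ S
  #>0⇒nonempty {n} S 0<S with nonempty? S
  ... | yes ne = ne
  ... | no  em = contradiction (subst (λ T → 0 < # T) (Empty-unique em) 0<S) (subst (λ m → ¬ (0 < m)) (sym (∣⊥∣≡0 n)) λ ())

  module _ {P : Fin n → Set} (P? : ∀ v → Dec (P v)) where

    ⟪_⟫ : Subset n
    ⟪_⟫ = tabulate (λ v → does (P? v))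

    ∈⟪⟫⁺ : ∀ {v} → P v → v ∈ ⟪_⟫
    ∈⟪⟫⁺ {v} p = lookup⇒[]= v ⟪_⟫ (trans (lookup∘tabulate (λ v → does (P? v)) v) (dec-true (P? v) p))

    ∈⟪⟫⁻ : ∀ {v} → v ∈ ⟪_⟫ → P v
    ∈⟪⟫⁻ {v} v∈ = true⇒ (P? v) (trans (sym (lookup∘tabulate (λ v → does (P? v)) v)) ([]=⇒lookup v∈))
      where
      true⇒ : ∀ {Q : Set} (Q? : Dec Q) → does Q? ≡ true → Q
      true⇒ (yes q) _ = q

  Edge : Outcome n → Fin n → Fin n → Set
  Edge ω u v = edge ω u v ≡ true

  Edge? : (ω : Outcome n) → ∀ u v → Dec (Edge ω u v)
  Edge? ω u v = edge ω u v Bool.≟ true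

  Edge-sym : (ω : Outcome n) → ∀ {u v} → Edge ω u v → Edge ω v u
  Edge-sym ω {u} {v} e = trans (edge-sym ω v u) e

  neighbours : Outcome n → Fin n → Subset n
  neighbours ω v = tabulate (edge ω v)

  Edge⇒∈neighbours : (ω : Outcome n) → ∀ {u v} → Edge ω v u → u ∈ neighbours ω v
  Edge⇒∈neighbours ω {u} {v} e = lookup⇒[]= u (neighbours ω v) (trans (lookup∘tabulate (edge ω v) u) e)

  degree : Outcome n → Subset n → Fin n → ℕ
  degree ω S v = # (S ∩ neighbours ω v)

  sumOver : Subset n → (Fin n → ℕ) → ℕ
  sumOver []          f = 0
  sumOver (true ∷ S)  f = f zero + sumOver S (f ∘ suc)
  sumOver (false ∷ S) f = sumOver S (f ∘ suc)

  sumOver-cong : (S : Subset n) → ∀ {f g} → (∀ v → f v ≡ g v) → sumOver S f ≡ sumOver S g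
  sumOver-cong []          e = refl
  sumOver-cong (true ∷ S)  e = cong₂ _+_ (e zero) (sumOver-cong S (e ∘ suc))
  sumOver-cong (false ∷ S) e = sumOver-cong S (e ∘ suc)

  sumOver-+ : (S : Subset n) → ∀ f g → sumOver S (λ v → f v + g v) ≡ sumOver S f + sumOver S g
  sumOver-+ []          f g = refl
  sumOver-+ (true ∷ S)  f g = trans (cong (f zero + g zero +_) (sumOver-+ S (f ∘ suc) (g ∘ suc)))
    (solve 4 (λ a b c d → (a :+ b) :+ (c :+ d) := (a :+ c) :+ (b :+ d)) refl (f zero) (g zero) (sumOver S (f ∘ suc)) (sumOver S (g ∘ suc)))
    where open +-*-Solver
  sumOver-+ (false ∷ S) f g = sumOver-+ S (f ∘ suc) (g ∘ suc)

  small-term : (S : Subset n) → ∀ D f → sumOver S f < D * # S → ∃[ v ] (v ∈ S × f v < D)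
  small-term []          D f h = contradiction (subst (0 <_) (*-zeroʳ D) h) λ ()
  small-term (false ∷ S) D f h with small-term S D (f ∘ suc) h
  ... | v , v∈S , fv<D = suc v , there v∈S , fv<D
  small-term (true ∷ S)  D f h with f zero <? D
  ... | yes f0<D = zero , here , f0<D
  ... | no  f0≮D with small-term S D (f ∘ suc) (+-cancelˡ-< D (sumOver S (f ∘ suc)) (D * # S)
                        (<-≤-trans (≤-<-trans (+-monoˡ-≤ (sumOver S (f ∘ suc)) (≮⇒≥ f0≮D)) h) (≤-reflexive (*-suc D (# S)))))
  ...   | v , v∈S , fv<D = suc v , there v∈S , fv<D

  -- Each edge from the first vertex into S is counted once in the degree of that vertex and once,
  -- through `bit`, in the degree of its other end.
  handshake : (S : Subset n) (ω : Outcome n) → sumOver S (degree ω S) ≡ 2 * #edges S ω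
  handshake []          []      = refl
  handshake (false ∷ S) (r ∷ ω) = handshake S ω
  handshake (true ∷ S)  (r ∷ ω) = begin
    # (S ∩ tabulate (lookup r)) + sumOver S (λ v → degree (r ∷ ω) (true ∷ S) (suc v))
      ≡⟨ cong₂ (λ T m → # (S ∩ T) + m) (tabulate∘lookup r)
           (trans (sumOver-cong S (λ v → split v (lookup r v) refl)) (sumOver-+ S (λ v → bit (lookup r v)) (degree ω S))) ⟩
    # (S ∩ r) + (sumOver S (λ v → bit (lookup r v)) + sumOver S (degree ω S))
      ≡⟨ cong₂ (λ x y → # (S ∩ r) + (x + y)) (sum-bits S r) (handshake S ω) ⟩
    # (S ∩ r) + (# (S ∩ r) + 2 * #edges S ω)
      ≡⟨ solve 2 (λ x y → x :+ (x :+ con 2 :* y) := con 2 :* (x :+ y)) refl (# (S ∩ r)) (#edges S ω) ⟩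
    2 * (# (S ∩ r) + #edges S ω) ∎
    where
    open ≡-Reasoning
    open +-*-Solver
    bit : Bool → ℕ
    bit true  = 1
    bit false = 0
    split : ∀ v b → lookup r v ≡ b → # ((true ∧ lookup r v) ∷ (S ∩ neighbours ω v)) ≡ bit (lookup r v) + degree ω S v
    split v true  e rewrite e = refl
    split v false e rewrite e = refl
    sum-bits : ∀ {m} (S r : Subset m) → sumOver S (λ v → bit (lookup r v)) ≡ # (S ∩ r)
    sum-bits []          []          = refl
    sum-bits (true ∷ S)  (true ∷ r)  = cong suc (sum-bits S r)
    sum-bits (true ∷ S)  (false ∷ r) = sum-bits S r
    sum-bits (false ∷ S) (b ∷ r)     = sum-bits S r

  -- The function is total and only constrained on S, so that colourings can be restricted and
  -- combined without carrying membership proofs.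
  Colouring : Outcome n → Subset n → (Fin n → ℕ) → ℕ → Set
  Colouring ω S f m = (∀ {v} → v ∈ S → f v < m) × (∀ {u v} → u ∈ S → v ∈ S → Edge ω u v → f u ≢ f v)

  Colourable : Outcome n → Subset n → ℕ → Set
  Colourable ω S m = ∃[ f ] Colouring ω S f m

  Colourable-⊆ : {ω : Outcome n} {S T : Subset n} {m : ℕ} → S ⊆ T → Colourable ω T m → Colourable ω S m
  Colourable-⊆ S⊆T (f , bound , proper) = f , (bound ∘ S⊆T) , λ u∈ v∈ → proper (S⊆T u∈) (S⊆T v∈)

  Colourable-∪ : {ω : Outcome n} {S T : Subset n} {m l : ℕ} → Colourable ω S m → Colourable ω T l → Colourable ω (S ∪ T) (m + l)
  Colourable-∪ {n} {ω} {S} {T} {m} {l} (f , f<m , f-proper) (g , g<l , g-proper) = h , h-bound , h-proper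
    where
    pick : ∀ v → Dec (v ∈ S) → ℕ
    pick v (yes _) = f v
    pick v (no _)  = m + g v
    h : Fin n → ℕ
    h v = pick v (v ∈? S)
    in-T : ∀ {v} → v ∉ S → v ∈ S ∪ T → v ∈ T
    in-T v∉S v∈ = [ (λ v∈S → contradiction v∈S v∉S) , (λ v∈T → v∈T) ]′ (x∈p∪q⁻ S T v∈)
    h-bound : ∀ {v} → v ∈ S ∪ T → h v < m + l
    h-bound {v} v∈ with v ∈? S
    ... | yes v∈S = <-≤-trans (f<m v∈S) (m≤m+n m l)
    ... | no  v∉S = +-monoʳ-< m (g<l (in-T v∉S v∈))
    h-proper : ∀ {u v} → u ∈ S ∪ T → v ∈ S ∪ T → Edge ω u v → h u ≢ h v
    h-proper {u} {v} u∈ v∈ e with u ∈? S | v ∈? S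
    ... | yes u∈S | yes v∈S = f-proper u∈S v∈S e
    ... | yes u∈S | no  v∉S = λ eq → <⇒≢ (<-≤-trans (f<m u∈S) (m≤m+n m (g v))) eq
    ... | no  u∉S | yes v∈S = λ eq → <⇒≢ (<-≤-trans (f<m v∈S) (m≤m+n m (g u))) (sym eq)
    ... | no  u∉S | no  v∉S = λ eq → g-proper (in-T u∉S u∈) (in-T v∉S v∈) e (+-cancelˡ-≡ m (g u) (g v) eq)

  -- Pigeonhole by induction: if the largest colour is taken by some u, both u and this colour are
  -- discarded.
  free-colour : ∀ D (P : Subset n) (f : Fin n → ℕ) → # P < D → ∃[ j ] (j < D × (∀ {u} → u ∈ P → f u ≢ j))
  free-colour (suc D) P f P<D with Fin.any? (λ u → (u ∈? P) ×-dec (f u ≟ D))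
  ... | no  ∄u = D , ≤-refl , λ u∈P fu≡D → ∄u (_ , u∈P , fu≡D)
  ... | yes (u , u∈P , fu≡D) with free-colour D (P - u) f (<-≤-trans (x∈p⇒∣p-x∣<∣p∣ u∈P) (s≤s⁻¹ P<D))
  ...   | j , j<D , free = j , m≤n⇒m≤1+n j<D , free′
    where
    free′ : ∀ {v} → v ∈ P → f v ≢ j
    free′ {v} v∈P fv≡j with v Fin.≟ u
    ... | yes refl = <⇒≢ j<D (trans (sym fv≡j) fu≡D)
    ... | no  v≢u  = free (x∈p∧x≢y⇒x∈p-y v∈P v≢u) fv≡j

  -- A vertex of low degree is set aside and coloured after all others, so a low degree is needed in
  -- every remaining set and not just in S.
  degenerate⇒Colourable : (ω : Outcome n) → ∀ a D →
    (∀ S → 0 < # S → # S ≤ a → ∃[ v ] (v ∈ S × degree ω S v < D)) →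
    ∀ S → # S ≤ a → Colourable ω S D
  degenerate⇒Colourable {n} ω a D low S S≤a = go (# S) S ≤-refl S≤a
    where
    go : ∀ s S → # S ≤ s → # S ≤ a → Colourable ω S D
    go s S S≤s S≤a with # S in eq
    ... | zero = (λ _ → 0) , (λ v∈S → contradiction v∈S (empty v∈S)) , (λ u∈S _ _ → contradiction u∈S (empty u∈S))
      where
      empty : ∀ {v} → v ∈ S → v ∉ S
      empty {v} v∈S = contradiction (≤-trans (≤-reflexive (sym (∣⁅x⁆∣≡1 v)))
        (≤-trans (p⊆q⇒∣p∣≤∣q∣ (λ x∈ → subst (_∈ S) (sym (x∈⁅y⁆⇒x≡y v x∈)) v∈S)) (≤-reflexive eq))) λ ()
    go (suc s) S (s≤s S≤s) S≤a | suc m with low S (subst (0 <_) (sym eq) z<s) (subst (_≤ a) (sym eq) S≤a)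
    ... | v , v∈S , deg<D with go s (S - v) S-v≤s (≤-trans S-v≤m (≤-trans (n≤1+n m) S≤a)) | free-colour D (S ∩ neighbours ω v)
      where
      S-v≤m : # (S - v) ≤ m
      S-v≤m = s≤s⁻¹ (<-≤-trans (x∈p⇒∣p-x∣<∣p∣ v∈S) (≤-reflexive eq))
      S-v≤s : # (S - v) ≤ s
      S-v≤s = ≤-trans S-v≤m S≤s
    ... | f , f<D , f-proper | free with free f deg<D
    ...   | j , j<D , j-free = g , g<D , g-proper
      where
      pick : ∀ u → Dec (u ≡ v) → ℕ
      pick u (yes _) = j
      pick u (no _)  = f u
      g : Fin n → ℕ
      g u = pick u (u Fin.≟ v)
      g<D : ∀ {u} → u ∈ S → g u < D
      g<D {u} u∈S with u Fin.≟ v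
      ... | yes _   = j<D
      ... | no  u≢v = f<D (x∈p∧x≢y⇒x∈p-y u∈S u≢v)
      g-proper : ∀ {u w} → u ∈ S → w ∈ S → Edge ω u w → g u ≢ g w
      g-proper {u} {w} u∈S w∈S e with u Fin.≟ v | w Fin.≟ v
      ... | yes refl | yes refl = λ _ → edge-irrefl ω u e
      ... | yes refl | no  w≢v  = λ j≡fw → j-free (x∈p∩q⁺ (w∈S , Edge⇒∈neighbours ω e)) (sym j≡fw)
      ... | no  u≢v  | yes refl = λ fu≡j → j-free (x∈p∩q⁺ (u∈S , Edge⇒∈neighbours ω (Edge-sym ω e))) fu≡j
      ... | no  u≢v  | no  w≢v  = f-proper (x∈p∧x≢y⇒x∈p-y u∈S u≢v) (x∈p∧x≢y⇒x∈p-y w∈S w≢v) e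

  Colourable-split : (ω : Outcome n) → ∀ a D → (∀ S → # S ≤ a → Colourable ω S D) →
    ∀ j S → # S ≤ j * a → Colourable ω S (j * D)
  Colourable-split ω a D small zero    S S≤0 = Colourable-≤ (small S (≤-trans S≤0 z≤n))
    where
    Colourable-≤ : Colourable ω S D → Colourable ω S 0
    Colourable-≤ (f , _ , proper) = f , (λ {v} v∈S → contradiction (≤-trans (≤-reflexive (sym (∣⁅x⁆∣≡1 v)))
        (≤-trans (p⊆q⇒∣p∣≤∣q∣ (λ x∈ → subst (_∈ S) (sym (x∈⁅y⁆⇒x≡y v x∈)) v∈S)) S≤0)) λ ()) , proper
  Colourable-split ω a D small (suc j) S S≤ with ≤-total (# S) a
  ... | inj₁ S≤a = extend (small S S≤a)
    where
    extend : Colourable ω S D → Colourable ω S (D + j * D)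
    extend (f , f<D , proper) = f , (λ v∈S → <-≤-trans (f<D v∈S) (m≤m+n D (j * D))) , proper
  ... | inj₂ a≤S with subset-of-size S a a≤S
  ...   | T , T⊆S , #T = Colourable-⊆ {ω = ω} S⊆ (Colourable-∪ {ω = ω} (small T (≤-reflexive #T))
            (Colourable-split ω a D small j (S ─ T) (+-cancelʳ-≤ a (# (S ─ T)) (j * a)
              (≤-trans (≤-reflexive (trans (cong (# (S ─ T) +_) (sym #T)) (#─ S T T⊆S))) (≤-trans S≤ (≤-reflexive (+-comm a (j * a))))))))
    where
    S⊆ : S ⊆ T ∪ (S ─ T)
    S⊆ {x} x∈S with x ∈? T
    ... | yes x∈T = ∈∪ˡ x∈T
    ... | no  x∉T = ∈∪ʳ {A = T} (x∈p∧x∉q⇒x∈p─q x∈S x∉T)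

-- Holes as labellings, and connected vertex sets.

module Connectivity where

  open import Defs
  open import Relation.Binary.Core using (Rel)
  open Rationals using (1ℚ) renaming (_*_ to _*ℚ_; *-identityˡ to *ℚ-identityˡ)
  open Probability using (module Weight)
  open Obstructions using (Part; left; right; neither; #left; #right; hole; forbidCross)
  open Degeneracy
  open import Data.Bool.Base using (Bool; true; false)
  open import Data.Empty using (⊥; ⊥-elim)
  open import Data.Fin.Base using (Fin; zero; suc)
  import Data.Fin.Properties as Fin
  open import Data.Fin.Subset using (Subset; _∈_; _∉_; _⊆_; _∪_; _─_; ⁅_⁆) renaming (∣_∣ to #_)
  open import Data.Fin.Subset.Properties
  import Data.List.Base as List
  open import Data.Nat.Base
  open import Data.Nat.Properties
  open import Data.Product using (∃; ∃-syntax; _×_; _,_; proj₁; map₂)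
  open import Data.Sum using (_⊎_; inj₁; inj₂)
  open import Data.Vec.Base using ([]; _∷_; Vec; zipWith; lookup; here; there)
  open import Data.Vec.Properties using ([]=⇒lookup)
  open import Data.Vec.Properties.WithK using ([]=-irrelevant)
  open import Function.Base using ()
  open import Relation.Binary.Construct.Closure.ReflexiveTransitive as Star using (Star; ε; _◅_; _◅◅_)
  open import Relation.Binary.PropositionalEquality
  open import Relation.Nullary using (¬_; Dec; yes; no; contradiction; _×-dec_)

  ─-∉ : ∀ {m} (S D : Subset m) {v} → v ∈ S ─ D → v ∉ D
  ─-∉ (x ∷ S) (true ∷ D)  (there v∈) (there v∈D) = ─-∉ S D v∈ v∈D
  ─-∉ (x ∷ S) (false ∷ D) (there v∈) (there v∈D) = ─-∉ S D v∈ v∈D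

  NoEdge : ∀ {n} → Outcome n → Subset n → Subset n → Set
  NoEdge ω A B = ∀ {u v} → u ∈ A → v ∈ B → ¬ Edge ω u v

  part : Bool → Bool → Part
  part true  _     = left
  part false true  = right
  part false false = neither

  labels : ∀ {n} → Subset n → Subset n → Vec Part n
  labels = zipWith part

  #left-labels : ∀ {n} (A B : Subset n) → #left (labels A B) ≡ # A
  #left-labels []          []          = refl
  #left-labels (true ∷ A)  (b ∷ B)     = cong suc (#left-labels A B)
  #left-labels (false ∷ A) (true ∷ B)  = #left-labels A B
  #left-labels (false ∷ A) (false ∷ B) = #left-labels A B

  #right-labels : ∀ {n} (A B : Subset n) → Disjoint A B → #right (labels A B) ≡ # B
  #right-labels []          []          d = refl
  #right-labels (true ∷ A)  (true ∷ B)  d = ⊥-elim (d here here)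
  #right-labels (true ∷ A)  (false ∷ B) d = #right-labels A B (λ x y → d (there x) (there y))
  #right-labels (false ∷ A) (true ∷ B)  d = cong suc (#right-labels A B (λ x y → d (there x) (there y)))
  #right-labels (false ∷ A) (false ∷ B) d = #right-labels A B (λ x y → d (there x) (there y))

  hole-labels : ∀ {n} (ω : Outcome n) A B → NoEdge ω A B → hole (labels A B) ω ≡ 1ℚ
  hole-labels []      []      []      _  = refl
  hole-labels (r ∷ ω) (b ∷ A) (c ∷ B) no-edge = trans
    (cong₂ _*ℚ_ (row b c r A B (λ { refl v∈B e → no-edge here (there v∈B) (e′ r e) })
                               (λ { _ refl u∈A e → no-edge (there u∈A) here (e′ r e) }))
                (hole-labels ω A B (λ u∈A v∈B → no-edge (there u∈A) (there v∈B))))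
    (*ℚ-identityˡ 1ℚ)
    where
    e′ : ∀ {m} (r : Vec Bool m) {v} → v ∈ r → lookup r v ≡ true
    e′ r = []=⇒lookup
    row : ∀ {m} b c (r : Vec Bool m) (A B : Subset m) →
          (b ≡ true → ∀ {v} → v ∈ B → ¬ (v ∈ r)) → (b ≡ false → c ≡ true → ∀ {v} → v ∈ A → ¬ (v ∈ r)) →
          Weight.rowW forbidCross (part b c) (labels A B) r ≡ 1ℚ
    row b c []          []      []      _ _ = refl
    row b c (false ∷ r) (x ∷ A) (y ∷ B) p q = trans (*ℚ-identityˡ _)
      (row b c r A B (λ e v∈ v∈r → p e (there v∈) (there v∈r)) (λ e e₁ v∈ v∈r → q e e₁ (there v∈) (there v∈r)))
    row b c (true ∷ r)  (x ∷ A) (y ∷ B) p q = trans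
      (cong₂ _*ℚ_ (entry b c x y (λ e e₁ → p e (subst (λ y → zero ∈ y ∷ B) (sym e₁) here) here)
                                 (λ e e₁ e₂ → q e e₁ (subst (λ x → zero ∈ x ∷ A) (sym e₂) here) here))
                  (row b c r A B (λ e v∈ v∈r → p e (there v∈) (there v∈r)) (λ e e₁ v∈ v∈r → q e e₁ (there v∈) (there v∈r))))
      (*ℚ-identityˡ 1ℚ)
      where
      entry : ∀ b c x y → (b ≡ true → y ≡ true → ⊥) → (b ≡ false → c ≡ true → x ≡ true → ⊥) →
              forbidCross (part b c) (part x y) ≡ 1ℚ
      entry true  c     true  y     p q = refl
      entry true  c     false true  p q = ⊥-elim (p refl refl)
      entry true  c     false false p q = refl
      entry false true  true  y     p q = ⊥-elim (q refl refl refl)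
      entry false true  false true  p q = refl
      entry false true  false false p q = refl
      entry false false x     y     p q = refl

  module _ {n : ℕ} (ω : Outcome n) where

    -- Growth by single vertices allows stopping at exactly a vertices: with fewer, holes would not
    -- bound the set of undominated vertices, and with more, sparsity would not bound the chromatic
    -- number.
    data Conn : Subset n → Set where
      single : ∀ v → Conn ⁅ v ⁆
      grow   : ∀ {D u} → Conn D → u ∈ D → ∀ v → Edge ω u v → Conn (D ∪ ⁅ v ⁆)

    private
      Path : (S : Subset n) → Rel (∃ (_∈ S)) _
      Path S = Star (Adj (Induced (graph ω) S))

      lift-path : ∀ {S T} (S⊆T : S ⊆ T) {x y} → Path S x y → Path T (map₂ S⊆T x) (map₂ S⊆T y)
      lift-path S⊆T = Star.gmap (map₂ S⊆T) (λ e → e)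

      -- Vertices of an induced graph carry membership proofs, which are unique.
      end : ∀ {S x y} (p q : x ∈ S) → Path S y (x , p) → Path S y (x , q)
      end p q = subst (λ r → Path _ _ (_ , r)) ([]=-irrelevant p q)

      rooted : ∀ {D} → Conn D → ∃[ r ] (∀ x → Path D r x)
      rooted (single v) = (v , x∈⁅x⁆ v) , λ { (x , x∈) → at x (x∈⁅y⁆⇒x≡y v x∈) x∈ }
        where
        at : ∀ x → x ≡ v → (x∈ : x ∈ ⁅ v ⁆) → Path ⁅ v ⁆ (v , x∈⁅x⁆ v) (x , x∈)
        at x refl x∈ = end (x∈⁅x⁆ v) x∈ ε
      rooted (grow {D} {u} conn u∈D v e) with rooted conn
      ... | r , path = map₂ ∈∪ˡ r , λ { (x , x∈) → at x x∈ (x∈p∪q⁻ D ⁅ v ⁆ x∈) }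
        where
        D′ = D ∪ ⁅ v ⁆
        at : ∀ x (x∈ : x ∈ D′) → x ∈ D ⊎ x ∈ ⁅ v ⁆ → Path D′ (map₂ ∈∪ˡ r) (x , x∈)
        at x x∈ (inj₁ x∈D) = end (∈∪ˡ x∈D) x∈ (lift-path ∈∪ˡ (path (x , x∈D)))
        at x x∈ (inj₂ x∈v) with x∈⁅y⁆⇒x≡y v x∈v
        ... | refl = lift-path ∈∪ˡ (path (u , u∈D)) ◅◅ (e ◅ ε)

    Conn⇒Connected : ∀ {D} → Conn D → Connected (Induced (graph ω) D)
    Conn⇒Connected {D} conn with rooted conn
    ... | r , path = r , λ x y → Star.reverse (λ {x} {y} e → Edge-sym ω e) (path x) ◅◅ path y

    Outgoing : Subset n → Subset n → Set
    Outgoing D S = ∃[ u ] ∃[ v ] (u ∈ D × v ∈ S × Edge ω u v)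

    outgoing? : ∀ D S → Dec (Outgoing D S)
    outgoing? D S = Fin.any? (λ u → Fin.any? (λ v → (u ∈? D) ×-dec ((v ∈? S) ×-dec Edge? ω u v)))

    ¬Outgoing⇒NoEdge : ∀ {D S} → ¬ Outgoing D S → NoEdge ω D S
    ¬Outgoing⇒NoEdge h u∈D v∈S e = h (_ , _ , u∈D , v∈S , e)

    -- A connected D inside S is grown from one vertex until no edge leads from D to the rest of S.
    -- Then S is connected exactly if nothing is left over, because by `stays` no path leaves D.
    -- Decidability is needed to maximise over the connected sets.
    connected? : ∀ S → Dec (Connected (Induced (graph ω) S))
    connected? S with nonempty? S
    ... | no  empty = no λ { ((v , v∈S) , _) → empty (v , v∈S) }
    ... | yes (r , r∈S) = search n ⁅ r ⁆ (λ x∈r → subst (_∈ S) (sym (x∈⁅y⁆⇒x≡y r x∈r)) r∈S) (single r) (m≤n+m n (# ⁅ r ⁆))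
      where
      stays : ∀ {D x y} → D ⊆ S → NoEdge ω D (S ─ D) → Path S x y → proj₁ x ∈ D → proj₁ y ∈ D
      stays D⊆S closed ε x∈D = x∈D
      stays {D} D⊆S closed (_◅_ {j = z , z∈S} e path) x∈D with z ∈? D
      ... | yes z∈D = stays D⊆S closed path z∈D
      ... | no  z∉D = contradiction e (closed x∈D (x∈p∧x∉q⇒x∈p─q z∈S z∉D))
      some : ∀ {D} → Conn D → ∃ (_∈ D)
      some (single v)         = v , x∈⁅x⁆ v
      some (grow _ u∈D _ _) = _ , ∈∪ˡ u∈D
      search : ∀ fuel D → D ⊆ S → Conn D → n ≤ # D + fuel → Dec (Connected (Induced (graph ω) S))
      search fuel D D⊆S conn fuel≤ with outgoing? D (S ─ D)
      search zero D D⊆S conn fuel≤ | yes (u , v , u∈D , v∈ , e) = contradiction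
        (≤-trans (≤-reflexive (sym (#-insert D (─-∉ S D v∈)))) (∣p∣≤n (D ∪ ⁅ v ⁆))) (<⇒≱ (s≤s (subst (n ≤_) (+-identityʳ (# D)) fuel≤)))
      search (suc fuel) D D⊆S conn fuel≤ | yes (u , v , u∈D , v∈ , e) =
        search fuel (D ∪ ⁅ v ⁆) (∪-⊆ D⊆S (λ x∈v → subst (_∈ S) (sym (x∈⁅y⁆⇒x≡y v x∈v)) (p─q⊆p S D v∈))) (grow conn u∈D v e)
          (≤-trans fuel≤ (≤-reflexive (trans (+-suc (# D) fuel) (cong (_+ fuel) (sym (#-insert D (─-∉ S D v∈)))))))
      search fuel D D⊆S conn fuel≤ | no ¬out with nonempty? (S ─ D)
      ... | no  S─D-empty = yes (subst (λ T → Connected (Induced (graph ω) T)) (⊆-antisym D⊆S S⊆D) (Conn⇒Connected conn))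
        where
        S⊆D : S ⊆ D
        S⊆D {x} x∈S with x ∈? D
        ... | yes x∈D = x∈D
        ... | no  x∉D = ⊥-elim (S─D-empty (x , x∈p∧x∉q⇒x∈p─q x∈S x∉D))
      ... | yes (z , z∈) with some conn
      ...   | x , x∈D = no λ { (_ , path) → ─-∉ S D z∈
                (stays D⊆S (¬Outgoing⇒NoEdge ¬out) (path (x , D⊆S x∈D) (z , p─q⊆p S D z∈)) x∈D) }

-- A connected subgraph with many colours and small chromatic number.

module LargeExcess where

  open import Defs
  open Degeneracy
  open Connectivity
  open import Data.Empty using (⊥-elim)
  open import Data.Fin.Base using (Fin; zero; suc; toℕ)
  import Data.Fin.Properties as Fin
  open import Data.Fin.Subset using (Subset; _∈_; _⊆_; _∪_; _─_; ⁅_⁆; ∁; ⊤) renaming (∣_∣ to #_; ⊥ to ∅)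
  open import Data.Fin.Subset.Properties
  import Data.List.Base as List
  open import Data.List.Base using (List; _∷_; allFin; filter; deduplicate)
  open import Data.List.Membership.Propositional using () renaming (_∈_ to _∈ᴸ_)
  open import Data.List.Membership.Propositional.Properties using (∈-allFin; ∈-filter⁺; ∈-filter⁻; ∈-map⁺; ∈-map⁻; ∈-deduplicate⁺; ∈-deduplicate⁻; ∈-lookup)
  open import Data.List.Relation.Unary.All as All using (All)
  open import Data.List.Relation.Unary.AllPairs using (_∷_)
  open import Data.List.Relation.Unary.Any using (index)
  open import Data.List.Relation.Unary.Any.Properties using (lookup-index)
  open import Data.List.Relation.Unary.Unique.Propositional using (Unique)
  open import Data.Nat.Base
  open import Data.Nat.Properties
  open import Data.List.Relation.Unary.Unique.DecPropositional.Properties _≟_ using (deduplicate-!)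
  open import Data.Nat.Solver using (module +-*-Solver)
  open import Data.Product using (∃-syntax; Σ-syntax; _×_; _,_; proj₁; proj₂)
  open import Data.Sum using (_⊎_; inj₁; inj₂; [_,_]′)
  open import Function.Base using ()
  open import Relation.Binary.PropositionalEquality
  open import Relation.Nullary using (¬_; Dec; yes; no; contradiction; ¬?; _×-dec_; _⊎-dec_)
  open import Relation.Nullary.Decidable using (decidable-stable)

  lookup-injective : ∀ {A : Set} {xs : List A} → Unique xs → ∀ i j → List.lookup xs i ≡ List.lookup xs j → i ≡ j
  lookup-injective (x∉ ∷ u) zero    zero    e = refl
  lookup-injective (x∉ ∷ u) zero    (suc j) e = contradiction e (All.lookup x∉ (∈-lookup j))
  lookup-injective (x∉ ∷ u) (suc i) zero    e = contradiction (sym e) (All.lookup x∉ (∈-lookup i))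
  lookup-injective (x∉ ∷ u) (suc i) (suc j) e = cong suc (lookup-injective u i j e)

  module _ {n : ℕ} (c : Fin n → ℕ) where

    colours : Subset n → List ℕ
    colours S = deduplicate _≟_ (List.map c (filter (_∈? S) (allFin n)))

    ∈colours⁺ : ∀ {S v} → v ∈ S → c v ∈ᴸ colours S
    ∈colours⁺ {S} {v} v∈S = ∈-deduplicate⁺ _≟_ (∈-map⁺ c (∈-filter⁺ (_∈? S) (∈-allFin v) v∈S))

    ∈colours⁻ : ∀ {S y} → y ∈ᴸ colours S → ∃[ v ] (v ∈ S × y ≡ c v)
    ∈colours⁻ {S} {y} y∈ with ∈-map⁻ c (∈-deduplicate⁻ _≟_ (List.map c (filter (_∈? S) (allFin n))) y∈)
    ... | v , v∈ , eq = v , proj₂ (∈-filter⁻ (_∈? S) {v = v} {xs = allFin n} v∈) , eq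

    -- Vertices of pairwise different colours, as witnesses for a lower bound on `#colours`; they
    -- can be extended one by one and transferred between colourings.
    Rainbow : ℕ → Subset n → Set
    Rainbow j S = Σ[ g ∈ (Fin j → Fin n) ] ((∀ (i : Fin j) → g i ∈ S) × (∀ i i′ → c (g i) ≡ c (g i′) → i ≡ i′))

    Rainbow⇒≤#colours : ∀ {j S} → Rainbow j S → j ≤ #colours c S
    Rainbow⇒≤#colours {j} {S} (g , g∈S , g-inj) = Fin.injective⇒≤ {f = λ i → index (∈colours⁺ (g∈S i))}
      λ {i} {i′} e → g-inj i i′ (trans (lookup-index (∈colours⁺ (g∈S i)))
        (trans (cong (List.lookup (colours S)) e) (sym (lookup-index (∈colours⁺ (g∈S i′))))))

    #colours-Rainbow : ∀ S → Rainbow (#colours c S) S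
    #colours-Rainbow S = (λ i → proj₁ (rep i)) , (λ i → proj₁ (proj₂ (rep i))) , λ i i′ e →
      lookup-injective (deduplicate-! (List.map c (filter (_∈? S) (allFin n)))) i i′
        (trans (proj₂ (proj₂ (rep i))) (trans e (sym (proj₂ (proj₂ (rep i′))))))
      where
      rep : ∀ i → ∃[ v ] (v ∈ S × List.lookup (colours S) i ≡ c v)
      rep i = ∈colours⁻ (∈-lookup i)

  -- Each colour is renamed to its position in the list of the colours on S.
  colour-index : ∀ {n} (ω : Outcome n) c → Proper (graph ω) c → ∀ S T → (∀ {v} → v ∈ T → ∃[ u ] (u ∈ S × c u ≡ c v)) →
    Colourable ω T (#colours c S)
  colour-index {n} ω c proper S T seen = f , f< , f-proper
    where
    pick : ∀ v → Dec (v ∈ T) → ℕ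
    idx : ∀ v → v ∈ T → Fin (#colours c S)
    idx v v∈T = index (∈colours⁺ c (proj₁ (proj₂ (seen v∈T))))
    pick v (yes v∈T) = toℕ (idx v v∈T)
    pick v (no _)    = 0
    f : Fin n → ℕ
    f v = pick v (v ∈? T)
    f< : ∀ {v} → v ∈ T → f v < #colours c S
    f< {v} v∈T with v ∈? T
    ... | yes v∈T′ = Fin.toℕ<n (idx v v∈T′)
    ... | no  v∉T  = contradiction v∈T v∉T
    c≡ : ∀ {v} (v∈T : v ∈ T) → c v ≡ List.lookup (colours c S) (idx v v∈T)
    c≡ v∈T = trans (sym (proj₂ (proj₂ (seen v∈T)))) (lookup-index (∈colours⁺ c (proj₁ (proj₂ (seen v∈T)))))
    f-proper : ∀ {u v} → u ∈ T → v ∈ T → Edge ω u v → f u ≢ f v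
    f-proper {u} {v} u∈T v∈T e with u ∈? T | v ∈? T
    ... | no  u∉T  | _        = contradiction u∈T u∉T
    ... | yes _    | no  v∉T  = contradiction v∈T v∉T
    ... | yes u∈T′ | yes v∈T′ = λ eq → proper u v e
      (trans (c≡ u∈T′) (trans (cong (List.lookup (colours c S)) (Fin.toℕ-injective eq)) (sym (c≡ v∈T′))))

  -- Colour classes are independent; together with `independent-bound` this gives n ≤ 2aχ.
  classes-bound : ∀ {n} (ω : Outcome n) b → (∀ I → NoEdge ω I I → # I ≤ b) → ∀ k S → Colourable ω S k → # S ≤ k * b
  classes-bound {n} ω b small zero S (f , f<k , proper) = ≤-reflexive
    (trans (cong #_ (Empty-unique {p = S} λ { (v , v∈S) → contradiction (f<k v∈S) λ () })) (∣⊥∣≡0 n))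
  classes-bound {n} ω b small (suc k) S (f , f<k , proper) = begin
    # S                ≤⟨ p⊆q⇒∣p∣≤∣q∣ S⊆ ⟩
    # (last ∪ rest)    ≤⟨ #∪-≤ last rest ⟩
    # last + # rest    ≤⟨ +-mono-≤ (small last last-independent) (classes-bound ω b small k rest (f , rest< , rest-proper)) ⟩
    b + k * b          ∎
    where
    open ≤-Reasoning
    last? = λ v → (v ∈? S) ×-dec (f v ≟ k)
    rest? = λ v → (v ∈? S) ×-dec ¬? (f v ≟ k)
    last rest : Subset n
    last = ⟪ last? ⟫
    rest = ⟪ rest? ⟫
    S⊆ : S ⊆ last ∪ rest
    S⊆ {v} v∈S with f v ≟ k
    ... | yes fv≡k = ∈∪ˡ (∈⟪⟫⁺ last? (v∈S , fv≡k))
    ... | no  fv≢k = ∈∪ʳ {A = last} (∈⟪⟫⁺ rest? (v∈S , fv≢k))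
    last-independent : NoEdge ω last last
    last-independent u∈ v∈ e = proper (proj₁ (∈⟪⟫⁻ last? u∈)) (proj₁ (∈⟪⟫⁻ last? v∈)) e
      (trans (proj₂ (∈⟪⟫⁻ last? u∈)) (sym (proj₂ (∈⟪⟫⁻ last? v∈))))
    rest< : ∀ {v} → v ∈ rest → f v < k
    rest< v∈ = ≤∧≢⇒< (s≤s⁻¹ (f<k (proj₁ (∈⟪⟫⁻ rest? v∈)))) (proj₂ (∈⟪⟫⁻ rest? v∈))
    rest-proper : ∀ {u v} → u ∈ rest → v ∈ rest → Edge ω u v → f u ≢ f v
    rest-proper u∈ v∈ = proper (proj₁ (∈⟪⟫⁻ rest? u∈)) (proj₁ (∈⟪⟫⁻ rest? v∈))

  module Holeless {n : ℕ} (ω : Outcome n) (a : ℕ) (1≤a : 1 ≤ a) (3a≤n : 3 * a ≤ n)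
    (no-hole : ∀ A B → Disjoint A B → # A ≡ a → # B ≡ a → ¬ NoEdge ω A B) where

    no-large-hole : ∀ A B → Disjoint A B → a ≤ # A → a ≤ # B → ¬ NoEdge ω A B
    no-large-hole A B d a≤A a≤B no-edge with subset-of-size A a a≤A | subset-of-size B a a≤B
    ... | A′ , A′⊆A , #A′ | B′ , B′⊆B , #B′ =
      no-hole A′ B′ (λ x y → d (A′⊆A x) (B′⊆B y)) #A′ #B′ (λ u∈ v∈ → no-edge (A′⊆A u∈) (B′⊆B v∈))

    -- More than 2a independent vertices could be divided into two sets of at least a vertices
    -- without an edge between them.
    independent-bound : ∀ I → NoEdge ω I I → # I ≤ 2 * a
    independent-bound I no-edge with # I ≤? 2 * a
    ... | yes I≤2a = I≤2a
    ... | no  I≰2a with subset-of-size I a (≤-trans (m≤m+n a (a + 0)) (<⇒≤ (≰⇒> I≰2a)))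
    ...   | A , A⊆I , #A = ⊥-elim (no-large-hole A (I ─ A) (λ x∈A x∈ → ─-∉ I A x∈ x∈A) (≤-reflexive (sym #A))
              (+-cancelʳ-≤ a a (# (I ─ A)) (≤-trans (≤-reflexive (cong (a +_) (sym (+-identityʳ a)))) (≤-trans (<⇒≤ (≰⇒> I≰2a))
                (≤-reflexive (trans (sym (#─ I A A⊆I)) (cong (# (I ─ A) +_) #A))))))
            (λ u∈ v∈ → no-edge (A⊆I u∈) (p─q⊆p I A v∈)))

    #∁ : ∀ (A : Subset n) → # A + # (∁ A) ≡ n
    #∁ A = trans (cong (# A +_) (∣∁p∣≡n∸∣p∣ A)) (m+[n∸m]≡n (∣p∣≤n A))

    a≤#∁ : ∀ A → # A ≤ 2 * a → a ≤ # (∁ A)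
    a≤#∁ A A≤2a = +-cancelˡ-≤ (2 * a) a (# (∁ A)) (≤-trans (≤-reflexive (+-comm (2 * a) a))
      (≤-trans 3a≤n (≤-trans (≤-reflexive (sym (#∁ A))) (+-monoˡ-≤ (# (∁ A)) A≤2a))))

    -- Z is a union of components that were exhausted before reaching size
    -- a, and D is the connected set which is currently grown.
    connected-set : ∃[ D ] (Conn ω D × # D ≡ a)
    connected-set = search n ∅ ⁅ v₀ ⁆ (λ x∈∅ → ⊥-elim (∉⊥ x∈∅)) (λ x∈∅ → ⊥-elim (∉⊥ x∈∅)) (single v₀)
      (subst (_< a) (sym (∣⊥∣≡0 n)) 1≤a) (subst (_≤ a) (sym (∣⁅x⁆∣≡1 v₀)) 1≤a) (m≤n+m n (# (∅ {n}) + # ⁅ v₀ ⁆))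
      where
      v₀ : Fin n
      v₀ = proj₁ (#>0⇒nonempty (∁ ∅) (<-≤-trans 1≤a (a≤#∁ ∅ (subst (_≤ 2 * a) (sym (∣⊥∣≡0 n)) z≤n))))
      search : ∀ fuel Z D → NoEdge ω Z (∁ Z) → Disjoint Z D → Conn ω D → # Z < a → # D ≤ a → n ≤ # Z + # D + fuel →
        ∃[ D ] (Conn ω D × # D ≡ a)
      search fuel Z D closed Z∩D conn Z<a D≤a fuel≤ with # D ≟ a
      ... | yes #D = D , conn , #D
      ... | no  D≢a with fuel
      -- Every step adds one vertex to Z ∪ D, so without fuel this union would have n vertices,
      -- whereas it has fewer than 2a.
      ...   | zero = contradiction fuel≤ (<⇒≱ (<-≤-trans (subst (_< a + a) (sym (+-identityʳ (# Z + # D))) (+-mono-<-≤ Z<a D≤a))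
                        (≤-trans (≤-trans (m≤m+n (a + a) a) (≤-reflexive (solve 1 (λ a → (a :+ a) :+ a := con 3 :* a) refl a))) 3a≤n)))
        where open +-*-Solver
      ...   | suc fuel with outgoing? ω D (∁ (Z ∪ D))
      ...     | yes (u , v , u∈D , v∈ , e) = search fuel Z (D ∪ ⁅ v ⁆) closed
                  (λ {x} x∈Z x∈ → [ Z∩D x∈Z , (λ x∈v → x∈∁p⇒x∉p v∈ (subst (_∈ Z ∪ D) (x∈⁅y⁆⇒x≡y v x∈v) (∈∪ˡ x∈Z))) ]′ (x∈p∪q⁻ D ⁅ v ⁆ x∈))
                  (grow conn u∈D v e) Z<a (subst (_≤ a) (sym #D′) (≤∧≢⇒< D≤a D≢a))
                  (≤-trans fuel≤ (≤-reflexive (trans (+-suc (# Z + # D) fuel) (trans (cong (_+ fuel) (sym (+-suc (# Z) (# D))))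
                    (cong (λ m → # Z + m + fuel) (sym #D′))))))
        where
        #D′ : # (D ∪ ⁅ v ⁆) ≡ suc (# D)
        #D′ = #-insert D (λ v∈D → x∈∁p⇒x∉p v∈ (∈∪ʳ {A = Z} v∈D))
      ...     | no ¬out = next (<-cmp′ (# Z′) a)
        where
        Z′ : Subset n
        Z′ = Z ∪ D
        #Z′ : # Z′ ≡ # Z + # D
        #Z′ = #∪-disjoint Z D Z∩D
        closed′ : NoEdge ω Z′ (∁ Z′)
        closed′ {u} {v} u∈ v∈ e = [ (λ u∈Z → closed u∈Z (x∉p⇒x∈∁p (λ v∈Z → x∈∁p⇒x∉p v∈ (∈∪ˡ v∈Z))) e)
                                  , (λ u∈D → ¬Outgoing⇒NoEdge ω ¬out u∈D v∈ e) ]′ (x∈p∪q⁻ Z D u∈)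
        Z′≤2a : # Z′ ≤ 2 * a
        Z′≤2a = ≤-trans (≤-reflexive #Z′) (≤-trans (+-mono-≤ (<⇒≤ Z<a) D≤a) (≤-reflexive (cong (a +_) (sym (+-identityʳ a)))))
        <-cmp′ : ∀ m k → m < k ⊎ k ≤ m
        <-cmp′ m k with m <? k
        ... | yes m<k = inj₁ m<k
        ... | no  m≮k = inj₂ (≮⇒≥ m≮k)
        next : # Z′ < a ⊎ a ≤ # Z′ → ∃[ D ] (Conn ω D × # D ≡ a)
        -- No edge leaves Z′, which has between a and 2a vertices, and its complement has at least a
        -- vertices because 3a ≤ n: a hole.
        next (inj₂ a≤Z′) = ⊥-elim (no-large-hole Z′ (∁ Z′) x∈p⇒x∉∁p a≤Z′ (a≤#∁ Z′ Z′≤2a) closed′)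
        next (inj₁ Z′<a) with #>0⇒nonempty (∁ Z′) (<-≤-trans 1≤a (a≤#∁ Z′ Z′≤2a))
        ... | v , v∈ = search fuel Z′ ⁅ v ⁆ closed′ (λ {x} x∈Z′ x∈v → x∈∁p⇒x∉p v∈ (subst (_∈ Z′) (x∈⁅y⁆⇒x≡y v x∈v) x∈Z′)) (single v)
                Z′<a (subst (_≤ a) (sym (∣⁅x⁆∣≡1 v)) 1≤a)
                (≤-trans fuel≤ (≤-reflexive (trans (+-suc (# Z + # D) fuel) (trans (cong (λ m → suc (m + fuel)) (sym #Z′))
                  (cong (_+ fuel) (trans (+-comm 1 (# Z′)) (cong (# Z′ +_) (sym (∣⁅x⁆∣≡1 v)))))))))

    module Collect (core : Subset n) (core-conn : Conn ω core) (#core : # core ≡ a)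
      (D : ℕ) (small : ∀ S → # S ≤ a → Colourable ω S D) (c : Fin n → ℕ) (proper : Proper (graph ω) c)
      (k : ℕ) (k-min : ∀ m → Colourable ω ⊤ m → k ≤ m) where

      private
        Dominated : Fin n → Set
        Dominated v = v ∈ core ⊎ ∃[ u ] (u ∈ core × Edge ω u v)
        dominated? : ∀ v → Dec (Dominated v)
        dominated? v = (v ∈? core) ⊎-dec Fin.any? (λ u → (u ∈? core) ×-dec Edge? ω u v)

        rest : Subset n
        rest = ⟪ (λ v → ¬? (dominated? v)) ⟫

        rest≤a : # rest ≤ a
        rest≤a with # rest ≤? a
        ... | yes h = h
        ... | no  h = ⊥-elim (no-large-hole core rest (λ x∈ x∈r → ∈⟪⟫⁻ (λ v → ¬? (dominated? v)) x∈r (inj₁ x∈)) (≤-reflexive (sym #core)) (<⇒≤ (≰⇒> h))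
          (λ {u} {v} u∈ v∈ e → ∈⟪⟫⁻ (λ v → ¬? (dominated? v)) v∈ (inj₂ (u , u∈ , e))))

        Seen : Subset n → Fin n → Set
        Seen H v = ∃[ u ] (u ∈ H × c u ≡ c v)
        seen? : ∀ H v → Dec (Seen H v)
        seen? H v = Fin.any? (λ u → (u ∈? H) ×-dec (c u ≟ c v))

        -- Either each of the j rounds has contributed a new colour, or all colours of dominated
        -- vertices occur already. The rainbow need not include any colour that occurs only in the
        -- core.
        collect : ∀ j → ∃[ T ] (Conn ω (core ∪ T) × # T ≤ j ×
          (Rainbow c j (core ∪ T) ⊎ (∀ {v} → Dominated v → Seen (core ∪ T) v)))
        collect zero = ∅ , subst (Conn ω) (sym (∪-identityʳ core)) core-conn , ≤-reflexive (∣⊥∣≡0 n) ,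
          inj₁ ((λ ()) , (λ ()) , λ ())
        collect (suc j) with collect j
        ... | T , conn , T≤j , inj₂ all = T , conn , m≤n⇒m≤1+n T≤j , inj₂ all
        ... | T , conn , T≤j , inj₁ (g , g∈ , g-inj) with Fin.any? (λ v → dominated? v ×-dec ¬? (seen? (core ∪ T) v))
        ...   | no ∄v = T , conn , m≤n⇒m≤1+n T≤j , inj₂ λ {v} dom → decidable-stable (seen? (core ∪ T) v) (λ ¬seen → ∄v (v , dom , ¬seen))
        -- Vertices of the core have seen colours. A vertex of an unseen colour thus has a neighbour
        -- in the core, and adding it preserves connectedness.
        ...   | yes (v , inj₁ v∈ , ¬seen) = contradiction (v , ∈∪ˡ v∈ , refl) ¬seen
        ...   | yes (v , inj₂ (u , u∈ , e) , ¬seen) = T ∪ ⁅ v ⁆ , subst (Conn ω) assoc (grow conn (∈∪ˡ u∈) v e) ,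
                  ≤-trans (#∪-≤ T ⁅ v ⁆) (≤-trans (≤-reflexive (trans (cong (# T +_) (∣⁅x⁆∣≡1 v)) (+-comm (# T) 1))) (s≤s T≤j)) ,
                  inj₁ (g′ , g′∈ , g′-inj)
          where
          assoc : (core ∪ T) ∪ ⁅ v ⁆ ≡ core ∪ (T ∪ ⁅ v ⁆)
          assoc = ∪-assoc core T ⁅ v ⁆
          g′ : Fin (suc j) → Fin n
          g′ zero    = v
          g′ (suc i) = g i
          g′∈ : ∀ i → g′ i ∈ core ∪ (T ∪ ⁅ v ⁆)
          g′∈ zero    = subst (v ∈_) assoc (∈∪ʳ {A = core ∪ T} (x∈⁅x⁆ v))
          g′∈ (suc i) = subst (g i ∈_) assoc (∈∪ˡ (g∈ i))
          g′-inj : ∀ i i′ → c (g′ i) ≡ c (g′ i′) → i ≡ i′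
          g′-inj zero    zero     eq = refl
          g′-inj zero    (suc i′) eq = contradiction (g i′ , g∈ i′ , sym eq) ¬seen
          g′-inj (suc i) zero     eq = contradiction (g i , g∈ i , eq) ¬seen
          g′-inj (suc i) (suc i′) eq = cong suc (g-inj i i′ eq)

      large-excess : ∀ j → k ≤ j * a → ∃[ H ] (Connected (Induced (graph ω) H) × k ≤ #colours c H + D × Colourable ω H (D + j * D))
      large-excess j k≤ja with collect k
      ... | T , conn , T≤k , result = core ∪ T , Conn⇒Connected ω conn , many result ,
            Colourable-∪ {ω = ω} (small core (≤-reflexive #core)) (Colourable-split ω a D small j T (≤-trans T≤k k≤ja))
        where
        many : Rainbow c k (core ∪ T) ⊎ (∀ {v} → Dominated v → Seen (core ∪ T) v) → k ≤ #colours c (core ∪ T) + D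
        many (inj₁ rainbow) = ≤-trans (Rainbow⇒≤#colours c rainbow) (m≤m+n _ D)
        -- In this case the colours of c on H suffice for all dominated vertices. With D extra
        -- colours for the others the whole graph is coloured, so minimality of k applies.
        many (inj₂ all)     = k-min _ (Colourable-⊆ {ω = ω} ⊤⊆ (Colourable-∪ {ω = ω}
            (colour-index ω c proper (core ∪ T) (∁ rest) (λ {v} v∈ → all (decidable-stable (dominated? v)
              (λ ¬dom → x∈∁p⇒x∉p v∈ (∈⟪⟫⁺ (λ v → ¬? (dominated? v)) ¬dom)))))
            (small rest rest≤a)))
          where
          ⊤⊆ : ⊤ ⊆ ∁ rest ∪ rest
          ⊤⊆ {v} _ with v ∈? rest
          ... | yes v∈ = ∈∪ʳ {A = ∁ rest} v∈
          ... | no  v∉ = ∈∪ˡ (x∉p⇒x∈∁p v∉)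

-- Existence of χ, φ and φ̂ by finite search.

module ChromaticExtrema where

  open import Defs
  open Probability using (vecs; ∈-vecs)
  open Obstructions using (bools; ∈-bools)
  open Degeneracy
  open Connectivity
  open LargeExcess
  open import Data.Bool.Base using ()
  open import Data.Fin.Base using (Fin; zero; suc; toℕ; fromℕ<)
  import Data.Fin.Properties as Fin
  open import Data.Fin.Subset using (Subset; _∈_; ⁅_⁆; ⊤) renaming (⊥ to ∅)
  open import Data.Fin.Subset.Properties using (_∈?_; ∈⊤)
  open import Data.Integer.Base as ℤ using (ℤ; +_)
  import Data.Integer.Properties as ℤₚ
  open import Data.List.Base using ([]; _∷_; allFin)
  open import Data.List.Membership.Propositional using (find; lose) renaming (_∈_ to _∈ᴸ_)
  open import Data.List.Membership.Propositional.Properties using (∈-allFin)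
  open import Data.List.Relation.Unary.Any using (any?; here; there)
  open import Data.Nat.Base
  open import Data.Nat.Properties
  open import Data.Product using (∃; ∃-syntax; Σ-syntax; _×_; _,_; proj₁; proj₂)
  open import Data.Sum using (inj₁; inj₂)
  open import Data.Unit.Base using (tt) renaming (⊤ to Unit)
  open import Data.Vec.Base as Vec using (Vec; []; _∷_; tabulate; lookup)
  open import Data.Vec.Properties using (lookup∘tabulate)
  open import Function.Base using (_∘_)
  open import Relation.Binary.PropositionalEquality
  open import Relation.Nullary using (Dec; yes; no; contradiction; ¬?; _×-dec_; _→-dec_)
  open import Relation.Nullary.Decidable using (map′)

  least : {P : ℕ → Set} → (∀ m → Dec (P m)) → ∀ m → P m → ∃[ k ] (P k × (∀ j → P j → k ≤ j))
  least {P} P? m Pm = search m 0 (+-identityʳ m) (λ _ _ → z≤n)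
    where
    search : ∀ fuel i → fuel + i ≡ m → (∀ j → P j → i ≤ j) → ∃[ k ] (P k × (∀ j → P j → k ≤ j))
    search zero       i refl lower = i , Pm , lower
    search (suc fuel) i eq lower with P? i
    ... | yes Pi = i , Pi , lower
    ... | no ¬Pi = search fuel (suc i) (trans (+-suc fuel i) eq)
                     λ j Pj → ≤∧≢⇒< (lower j Pj) (λ i≡j → ¬Pi (subst P (sym i≡j) Pj))

  maximum : ∀ {A : Set} (f : A → ℤ) {P : A → Set} → (∀ x → Dec (P x)) → ∃ P → ∀ xs →
    ∃[ x ] (P x × (∀ {y} → y ∈ᴸ xs → P y → f y ℤ.≤ f x))
  maximum f P? (x , Px) []       = x , Px , λ ()
  maximum f P? p        (y ∷ ys) with maximum f P? p ys
  ... | x , Px , above with P? y | ℤₚ.≤-total (f y) (f x)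
  ...   | no ¬Py | _         = x , Px , λ { (here refl) Py → contradiction Py ¬Py ; (there z∈) → above z∈ }
  ...   | yes Py | inj₁ fy≤  = x , Px , λ { (here refl) _ → fy≤ ; (there z∈) → above z∈ }
  ...   | yes Py | inj₂ fx≤  = y , Py , λ { (here refl) _ → ℤₚ.≤-refl ; (there z∈) Pz → ℤₚ.≤-trans (above z∈ Pz) fx≤ }

  anyVec? : ∀ {k n} {P : Vec (Fin k) n → Set} → (∀ v → Dec (P v)) → Dec (∃ P)
  anyVec? {k} {n} P? = map′ (λ p → let v , _ , Pv = find p in v , Pv) (λ { (v , Pv) → lose (∈-vecs ∈-allFin v) Pv })
    (any? P? (vecs (allFin k) n))

  module _ {n : ℕ} (ω : Outcome n) where

    private
      G = graph ω

    colouring? : ∀ S f m → Dec (Colouring ω S f m)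
    colouring? S f m = map′ (λ h {v} → h v) (λ h v → h {v}) (Fin.all? λ v → (v ∈? S) →-dec (f v <? m))
      ×-dec map′ (λ h {u} {v} → h u v) (λ h u v → h {u} {v})
              (Fin.all? λ u → Fin.all? λ v → (u ∈? S) →-dec ((v ∈? S) →-dec (Edge? ω u v →-dec ¬? (f u ≟ f v))))

    colourable? : ∀ S m → Dec (Colourable ω S m)
    colourable? S m = map′ (λ { (v , col) → toℕ ∘ lookup v , col }) (λ { (f , col) → vector f col , vector-col f col })
      -- The palette has one colour more than needed, so that it is nonempty and vertices outside S
      -- can get the default value 0 even if m = 0.
      (anyVec? {suc m} {n} λ v → colouring? S (toℕ ∘ lookup v) m)
      where
      module _ (f : Fin n → ℕ) (col : Colouring ω S f m) where
        entry : ∀ u → Dec (u ∈ S) → Fin (suc m)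
        entry u (yes u∈S) = fromℕ< {f u} (m≤n⇒m≤1+n (proj₁ col u∈S))
        entry u (no _)    = zero
        vector : Vec (Fin (suc m)) n
        vector = tabulate (λ u → entry u (u ∈? S))
        value : ∀ {u} → u ∈ S → toℕ (lookup vector u) ≡ f u
        value {u} u∈S = trans (cong toℕ (lookup∘tabulate (λ u → entry u (u ∈? S)) u)) (entry≡ (u ∈? S))
          where
          entry≡ : ∀ d → toℕ (entry u d) ≡ f u
          entry≡ (yes u∈S) = Fin.toℕ-fromℕ< (m≤n⇒m≤1+n (proj₁ col u∈S))
          entry≡ (no u∉S)  = contradiction u∈S u∉S
        vector-col : Colouring ω S (toℕ ∘ lookup vector) m
        vector-col = (λ u∈S → subst (_< m) (sym (value u∈S)) (proj₁ col u∈S)) ,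
          λ u∈S v∈S e eq → proj₂ col u∈S v∈S e (trans (sym (value u∈S)) (trans eq (value v∈S)))

    colourable-n : ∀ S → Colourable ω S n
    colourable-n S = toℕ , (λ {v} _ → Fin.toℕ<n v) , λ {u} {v} _ _ e eq →
      adj-irrefl G (subst (Edge ω u) (sym (Fin.toℕ-injective eq)) e)

    Induced⇒Colourable : ∀ {S k} → ∃[ c ] Proper {K = Fin k} (Induced G S) c → Colourable ω S k
    Induced⇒Colourable {S} {k} (c , proper) = f , f<k , f-proper
      where
      pick : ∀ v → Dec (v ∈ S) → ℕ
      pick v (yes v∈S) = toℕ (c (v , v∈S))
      pick v (no _)    = 0
      f : Fin n → ℕ
      f v = pick v (v ∈? S)
      f<k : ∀ {v} → v ∈ S → f v < k
      f<k {v} v∈S with v ∈? S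
      ... | yes v∈S′ = Fin.toℕ<n (c (v , v∈S′))
      ... | no  v∉S  = contradiction v∈S v∉S
      f-proper : ∀ {u v} → u ∈ S → v ∈ S → Edge ω u v → f u ≢ f v
      f-proper {u} {v} u∈S v∈S e with u ∈? S | v ∈? S
      ... | no  u∉S  | _        = contradiction u∈S u∉S
      ... | yes _    | no  v∉S  = contradiction v∈S v∉S
      ... | yes u∈S′ | yes v∈S′ = λ eq → proper (u , u∈S′) (v , v∈S′) e (Fin.toℕ-injective eq)

    Colourable⇒Induced : ∀ {S k} → Colourable ω S k → ∃[ c ] Proper {K = Fin k} (Induced G S) c
    Colourable⇒Induced (f , f<k , proper) = (λ { (v , v∈S) → fromℕ< (f<k v∈S) }) ,
      λ { (u , u∈S) (v , v∈S) e eq → proper u∈S v∈S e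
            (trans (sym (Fin.toℕ-fromℕ< (f<k u∈S))) (trans (cong toℕ eq) (Fin.toℕ-fromℕ< (f<k v∈S)))) }

    chromatic : ∀ S → ∃[ k ] (Colourable ω S k × (∀ m → Colourable ω S m → k ≤ m))
    chromatic S = least (colourable? S) n (colourable-n S)

    χ : Subset n → ℕ
    χ S = proj₁ (chromatic S)

    χ≤ : ∀ S {m} → Colourable ω S m → χ S ≤ m
    χ≤ S {m} = proj₂ (proj₂ (chromatic S)) m

    χ-induced : ∀ S → IsChromaticNumber (Induced G S) (χ S)
    χ-induced S = Colourable⇒Induced (proj₁ (proj₂ (chromatic S))) , λ m c → χ≤ S (Induced⇒Colourable c)

    χ-unique : ∀ S {k} → IsChromaticNumber (Induced G S) k → k ≡ χ S
    χ-unique S (c , k≤) = ≤-antisym (k≤ (χ S) (proj₁ (χ-induced S))) (χ≤ S (Induced⇒Colourable c))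

    -- This is not an instance of `χ-induced`: the vertices here are bare elements of `Fin n`,
    -- without proofs of membership in ⊤.
    χ-graph : IsChromaticNumber G (χ ⊤)
    χ-graph = from (proj₁ (proj₂ (chromatic ⊤))) , λ m c → χ≤ ⊤ (to c)
      where
      from : ∀ {k} → Colourable ω ⊤ k → ∃[ c ] Proper {K = Fin k} G c
      from (f , f<k , proper) = (λ v → fromℕ< (f<k (∈⊤ {x = v}))) , λ u v e eq → proper ∈⊤ ∈⊤ e
        (trans (sym (Fin.toℕ-fromℕ< (f<k ∈⊤))) (trans (cong toℕ eq) (Fin.toℕ-fromℕ< (f<k ∈⊤))))
      to : ∀ {k} → ∃[ c ] Proper {K = Fin k} G c → Colourable ω ⊤ k
      to (c , proper) = (λ v → toℕ (c v)) , (λ {v} _ → Fin.toℕ<n (c v)) , λ {u} {v} _ _ e eq → proper u v e (Fin.toℕ-injective eq)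

    excess : (Fin n → ℕ) → Subset n → ℤ
    excess c S = + #colours c S ℤ.- + χ S

    IsExcess-excess : ∀ c S → IsExcess G c S (excess c S)
    IsExcess-excess c S = χ S , χ-induced S , refl

    excess-unique : ∀ c S {z} → IsExcess G c S z → z ≡ excess c S
    excess-unique c S (k , is-χ , z≡) = trans z≡ (cong (λ m → + #colours c S ℤ.- + m) (χ-unique S is-χ))

    -- The min-max is carried out once for a decidable family Q of vertex sets: all sets give φ, the
    -- connected ones φ̂.
    module MinMax {Q : Subset n → Set} (Q? : ∀ S → Dec (Q S)) (Q-some : ∃ Q) where

      best : (c : Fin n → ℕ) → ∃[ S ] (Q S × (∀ {T} → T ∈ᴸ vecs bools n → Q T → excess c T ℤ.≤ excess c S))
      best c = maximum (excess c) Q? Q-some (vecs bools n)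

      Φ : (Fin n → ℕ) → ℤ
      Φ c = excess c (proj₁ (best c))

      Φ-attained : ∀ c → Q (proj₁ (best c))
      Φ-attained c = proj₁ (proj₂ (best c))

      ≤Φ : ∀ c S → Q S → excess c S ℤ.≤ Φ c
      ≤Φ c S = proj₂ (proj₂ (best c)) (∈-vecs ∈-bools S)

      IsMax : (Fin n → ℕ) → ℤ → Set
      IsMax c = IsGreatest ℤ._≤_ (λ z → ∃[ S ] (Q S × IsExcess G c S z))

      Φ-isMax : ∀ c → IsMax c (Φ c)
      Φ-isMax c = (proj₁ (best c) , Φ-attained c , IsExcess-excess c (proj₁ (best c))) ,
        λ { z (S , QS , is-exc) → subst (ℤ._≤ Φ c) (sym (excess-unique c S is-exc)) (≤Φ c S QS) }

      -- Only the partition into colour classes matters, so each colouring may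
      -- be replaced by the one that maps a vertex to the first vertex of its class.
      private
        class : (c : Fin n → ℕ) → ∀ v → ∃[ k ] ((∃[ w ] (toℕ w ≡ k × c w ≡ c v)) × (∀ j → ∃[ w ] (toℕ w ≡ j × c w ≡ c v) → k ≤ j))
        class c v = least (λ k → Fin.any? λ w → (toℕ w ≟ k) ×-dec (c w ≟ c v)) (toℕ v) (v , refl , refl)

        first : (c : Fin n → ℕ) → Fin n → Fin n
        first c v = proj₁ (proj₁ (proj₂ (class c v)))

        first-kernel⁻ : ∀ c {u v} → first c u ≡ first c v → c u ≡ c v
        first-kernel⁻ c {u} {v} eq = trans (sym (proj₂ (proj₂ (proj₁ (proj₂ (class c u))))))
          (trans (cong c eq) (proj₂ (proj₂ (proj₁ (proj₂ (class c v))))))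

        first-kernel⁺ : ∀ c {u v} → c u ≡ c v → first c u ≡ first c v
        first-kernel⁺ c {u} {v} eq with class c u | class c v
        ... | k , (w , w≡ , cw) , k≤ | l , (x , x≡ , cx) , l≤ = Fin.toℕ-injective
          (trans w≡ (trans (≤-antisym (k≤ l (x , x≡ , trans cx (sym eq))) (l≤ k (w , w≡ , trans cw eq))) (sym x≡)))

        normal : (Fin n → ℕ) → Vec (Fin n) n
        normal c = tabulate (first c)

        decode : Vec (Fin n) n → Fin n → ℕ
        decode v u = toℕ (lookup v u)

        kernel⁻ : ∀ c {u v} → decode (normal c) u ≡ decode (normal c) v → c u ≡ c v
        kernel⁻ c {u} {v} eq = first-kernel⁻ c (trans (sym (lookup∘tabulate (first c) u))
          (trans (Fin.toℕ-injective eq) (lookup∘tabulate (first c) v)))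

        kernel⁺ : ∀ c {u v} → c u ≡ c v → decode (normal c) u ≡ decode (normal c) v
        kernel⁺ c {u} {v} eq = cong toℕ (trans (lookup∘tabulate (first c) u) (trans (first-kernel⁺ c eq) (sym (lookup∘tabulate (first c) v))))

        #colours-≤ : (c c′ : Fin n → ℕ) → (∀ {u v} → c′ u ≡ c′ v → c u ≡ c v) → (S : Subset n) → #colours c S ≤ #colours c′ S
        #colours-≤ c c′ kernel S with #colours-Rainbow c S
        ... | g , g∈S , g-inj = Rainbow⇒≤#colours c′ {S = S} (g , g∈S , λ i i′ e → g-inj i i′ (kernel {g i} {g i′} e))

        excess-normal : ∀ c S → excess (decode (normal c)) S ≡ excess c S
        excess-normal c S = cong (λ m → + m ℤ.- + χ S)
          (≤-antisym (#colours-≤ (decode (normal c)) c (λ {u} {v} → kernel⁺ c {u} {v}) S) (#colours-≤ c (decode (normal c)) (λ {u} {v} → kernel⁻ c {u} {v}) S))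

        proper? : ∀ v → Dec (Proper G (decode v))
        proper? v = Fin.all? λ x → Fin.all? λ y → Edge? ω x y →-dec ¬? (decode v x ≟ decode v y)

        some-proper : ∃[ v ] Proper G (decode v)
        some-proper = tabulate (λ v → v) , λ u v e eq → adj-irrefl G (subst (Edge ω u) (sym (trans (sym (lookup∘tabulate (λ v → v) u))
          (trans (Fin.toℕ-injective eq) (lookup∘tabulate (λ v → v) v)))) e)

        optimal : ∃[ v ] (Proper G (decode v) × (∀ {w} → w ∈ᴸ vecs (allFin n) n → Proper G (decode w) →
                    ℤ.- Φ (decode w) ℤ.≤ ℤ.- Φ (decode v)))
        optimal = maximum (λ v → ℤ.- Φ (decode v)) proper? some-proper (vecs (allFin n) n)

      optimum : Fin n → ℕ
      optimum = decode (proj₁ optimal)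

      optimum-proper : Proper G optimum
      optimum-proper = proj₁ (proj₂ optimal)

      minΦ : ℤ
      minΦ = Φ optimum

      minΦ≤ : ∀ c → Proper G c → ∀ {x} → IsMax c x → minΦ ℤ.≤ x
      minΦ≤ c proper {x} (_ , greatest) = ℤₚ.≤-trans (ℤₚ.neg-cancel-≤ (proj₂ (proj₂ optimal) (∈-vecs ∈-allFin (normal c))
        (λ u v e eq → proper u v e (kernel⁻ c eq))))
        (greatest _ (proj₁ (best c′) , Φ-attained c′ , subst (IsExcess G c (proj₁ (best c′))) (sym (excess-normal c (proj₁ (best c′)))) (IsExcess-excess c (proj₁ (best c′)))))
        where
        c′ = decode (normal c)

      minΦ-isLeast : IsLeast ℤ._≤_ (λ z → ∃[ c ] (Proper G c × IsMax c z)) minΦ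
      minΦ-isLeast = (optimum , optimum-proper , Φ-isMax optimum) , λ { x (c , proper , is-max) → minΦ≤ c proper is-max }

    private
      module All  = MinMax {λ _ → Unit} (λ _ → yes tt) (∅ , tt)

    φ : ℤ
    φ = All.minΦ

    φ-isφ : Isφ G φ
    φ-isφ = (All.optimum , All.optimum-proper , drop (All.Φ-isMax All.optimum)) ,
      λ { x (c , proper , is-max) → All.minΦ≤ c proper (insert is-max) }
      where
      drop : ∀ {c z} → All.IsMax c z → Isφ-of G c z
      drop ((S , _ , is-exc) , greatest) = (S , is-exc) , λ { z (T , is-exc′) → greatest z (T , tt , is-exc′) }
      insert : ∀ {c z} → Isφ-of G c z → All.IsMax c z
      insert ((S , is-exc) , greatest) = (S , tt , is-exc) , λ { z (T , _ , is-exc′) → greatest z (T , is-exc′) }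

    -- Without a vertex no induced subgraph is connected, and the maximum defining φ̂ would range
    -- over the empty set.
    module _ (v₀ : Fin n) where

      private
        module Con = MinMax {λ S → Connected (Induced G S)} (connected? ω) (⁅ v₀ ⁆ , Conn⇒Connected ω (single v₀))

      φ̂ : ℤ
      φ̂ = Con.minΦ

      φ̂-isφ̂ : Isφ̂ G φ̂
      φ̂-isφ̂ = Con.minΦ-isLeast

      -- The colouring that is optimal for φ competes in φ̂, and its best connected set is among the
      -- sets considered for φ.
      φ̂≤φ : φ̂ ℤ.≤ φ
      φ̂≤φ = ℤₚ.≤-trans (Con.minΦ≤ All.optimum All.optimum-proper (Con.Φ-isMax All.optimum))
        (All.≤Φ All.optimum (proj₁ (Con.best All.optimum)) tt)

      ≤φ̂ : ∀ B → (∀ c → Proper G c → ∃[ S ] (Connected (Induced G S) × B ℤ.≤ excess c S)) → B ℤ.≤ φ̂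
      ≤φ̂ B large = ℤₚ.≤-trans (proj₂ (proj₂ witness)) (Con.≤Φ Con.optimum (proj₁ witness) (proj₁ (proj₂ witness)))
        where
        witness : ∃[ S ] (Connected (Induced G S) × B ℤ.≤ excess Con.optimum S)
        witness = large Con.optimum Con.optimum-proper

-- The loss χ - φ̂ in comparison with χ/t.

module Deficit where

  open import Defs using (Outcome; graph; Connected; Induced; Proper; #colours)
  open Obstructions using (badness; no-hole; sparse)
  open Rationals using (1ℚ) renaming (_<_ to _<ℚ_)
  open Degeneracy
  open Connectivity
  open LargeExcess
  open ChromaticExtrema
  open import Data.Fin.Base using ()
  open import Data.Fin.Subset using (_∈_; ⊤) renaming (∣_∣ to #_)
  open import Data.Fin.Subset.Properties using (∣⊤∣≡n)
  open import Data.Integer.Base as ℤ using (ℤ; +_)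
  import Data.Integer.Properties as ℤₚ
  import Data.Integer.Solver as ℤSolver
  open import Data.Nat.Base
  open import Data.Nat.DivMod using (m≡m%n+[m/n]*n; m%n<n; m/n*n≤m)
  open import Data.Nat.Properties
  open import Data.Nat.Solver using (module +-*-Solver)
  open import Data.Product using (∃-syntax; _×_; _,_; proj₁; proj₂)
  open import Relation.Binary.PropositionalEquality
  open import Relation.Nullary using (¬_)

  module _ {n : ℕ} (ω : Outcome n) (a d : ℕ) .{{_ : NonZero a}} (3a≤n : 3 * a ≤ n) (good : badness a d ω <ℚ 1ℚ) where

    private
      1≤a : 1 ≤ a
      1≤a = >-nonZero⁻¹ a

      holeless : ∀ A B → Disjoint A B → # A ≡ a → # B ≡ a → ¬ NoEdge ω A B
      holeless A B disj #A #B no-edge = no-hole a d ω good (labels A B) (trans (#left-labels A B) #A)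
        (trans (#right-labels A B disj) #B) (hole-labels ω A B no-edge)

      low-degree : ∀ S → 0 < # S → # S ≤ a → ∃[ v ] (v ∈ S × degree ω S v < 2 * d)
      low-degree S 0<S S≤a with # S in eq
      ... | suc j = small-term S (2 * d) (degree ω S) (≤-trans (≤-reflexive (cong suc (handshake S ω)))
        (≤-trans (*-monoʳ-< 2 (sparse a d ω good S j eq S≤a)) (≤-reflexive (sym (*-assoc 2 d (# S))))))

      small : ∀ S → # S ≤ a → Colourable ω S (2 * d)
      small = degenerate⇒Colourable ω a (2 * d) low-degree

      open Holeless ω a 1≤a 3a≤n holeless

    n≤χ*2a : n ≤ χ ω ⊤ * (2 * a)
    n≤χ*2a = subst (_≤ χ ω ⊤ * (2 * a)) (∣⊤∣≡n n)
      (classes-bound ω (2 * a) independent-bound (χ ω ⊤) ⊤ (proj₁ (proj₂ (chromatic ω ⊤))))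

    -- In units of 2d colours: one for the colours missing on H, one for the core, and 1 + χ/a for
    -- the pieces of the collected vertices.
    deficit : ℕ
    deficit = 2 * d * (3 + χ ω ⊤ / a)

    χ-deficit≤φ̂ : ∀ v₀ → + χ ω ⊤ ℤ.- + deficit ℤ.≤ φ̂ ω v₀
    χ-deficit≤φ̂ v₀ = ≤φ̂ ω v₀ (+ χ ω ⊤ ℤ.- + deficit) large
      where
      k = χ ω ⊤
      D = 2 * d
      j = suc (k / a)
      k≤ja : k ≤ j * a
      k≤ja = ≤-trans (≤-reflexive (m≡m%n+[m/n]*n k a)) (+-monoˡ-≤ (k / a * a) (<⇒≤ (m%n<n k a)))
      large : ∀ c → Proper (graph ω) c → ∃[ H ] (Connected (Induced (graph ω) H) × + k ℤ.- + deficit ℤ.≤ excess ω c H)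
      large c proper = H , proj₁ (proj₂ found) , bound
        where
        set : ∃[ core ] (Conn ω core × # core ≡ a)
        set = connected-set
        found : ∃[ H ] (Connected (Induced (graph ω) H) × k ≤ #colours c H + D × Colourable ω H (D + j * D))
        found = Collect.large-excess (proj₁ set) (proj₁ (proj₂ set)) (proj₂ (proj₂ set)) D small c proper k (λ m → χ≤ ω ⊤ {m}) j k≤ja
        H = proj₁ found
        k≤ : k ≤ #colours c H + D
        k≤ = proj₁ (proj₂ (proj₂ found))
        χH≤ : χ ω H ≤ D + j * D
        χH≤ = χ≤ ω H (proj₂ (proj₂ (proj₂ found)))
        k+χH≤ : k + χ ω H ≤ #colours c H + deficit
        k+χH≤ = ≤-trans (+-mono-≤ k≤ χH≤) (≤-reflexive
          (solve 3 (λ c D m → c :+ D :+ (D :+ (con 1 :+ m) :* D) := c :+ D :* (con 3 :+ m)) refl (#colours c H) D (k / a)))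
          where open +-*-Solver
        bound : + k ℤ.- + deficit ℤ.≤ excess ω c H
        bound = ℤ-transfer k (χ ω H) (#colours c H) deficit k+χH≤
          where
          ℤ-transfer : ∀ k x c e → k + x ≤ c + e → + k ℤ.- + e ℤ.≤ + c ℤ.- + x
          ℤ-transfer k x c e h = ℤₚ.≤-trans (ℤₚ.≤-reflexive (sym (cancelʳ (+ k) (+ e) (+ x))))
            (ℤₚ.≤-trans (ℤₚ.+-monoˡ-≤ (ℤ.- (+ e ℤ.+ + x)) (ℤ.+≤+ h))
              (ℤₚ.≤-reflexive (trans (cong (λ s → + (c + e) ℤ.+ ℤ.- s) (ℤₚ.+-comm (+ e) (+ x))) (cancelʳ (+ c) (+ x) (+ e)))))
            where
            module Z = ℤSolver.+-*-Solver
            cancelʳ : ∀ a b y → (a ℤ.+ y) ℤ.+ ℤ.- (b ℤ.+ y) ≡ a ℤ.+ ℤ.- b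
            cancelʳ = Z.solve 3 (λ a b y → (a Z.:+ y) Z.:+ Z.:- (b Z.:+ y) Z.:= a Z.:+ Z.:- b) refl

  -- The polynomial P(t) = t³ + 3t² + 9t + 13 satisfies P(t+1) + t³ = 2 P(t), so it at most doubles
  -- in each step; 13 is P(0).
  t³≤ : ∀ t → t * t * t ≤ 2 ^ t * 13
  t³≤ t = ≤-trans (m≤m+n (t * t * t) (3 * t * t + 9 * t + 13)) (lemma t)
    where
    open +-*-Solver
    lemma : ∀ t → t * t * t + (3 * t * t + 9 * t + 13) ≤ 2 ^ t * 13
    lemma zero    = ≤-refl
    lemma (suc t) = ≤-trans (≤-trans (m≤m+n _ (t * t * t)) (≤-reflexive
      (solve 1 (λ t → ((con 1 :+ t) :* (con 1 :+ t) :* (con 1 :+ t) :+ (con 3 :* (con 1 :+ t) :* (con 1 :+ t) :+ con 9 :* (con 1 :+ t) :+ con 13)) :+ t :* t :* t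
         := con 2 :* (t :* t :* t :+ (con 3 :* t :* t :+ con 9 :* t :+ con 13))) refl t)))
      (≤-trans (*-monoʳ-≤ 2 (lemma t)) (≤-reflexive (sym (*-assoc 2 (2 ^ t) 13))))

  -- The induction starts from 24 · 8 = 192 ≤ 256. The factor 24 is twice that of 3a = 12tw, because
  -- w 2^t may be as large as 2n.
  24t≤2^t : ∀ t → 8 ≤ t → 24 * t ≤ 2 ^ t
  24t≤2^t t 8≤t with m≤n⇒∃[o]m+o≡n 8≤t
  ... | o , refl = lemma o
    where
    lemma : ∀ o → 24 * (8 + o) ≤ 2 ^ (8 + o)
    lemma zero    = m≤m+n 192 64
    lemma (suc o) = ≤-trans (≤-trans (≤-reflexive (trans (cong (24 *_) (+-suc 8 o)) (*-suc 24 (8 + o))))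
      (+-mono-≤ {24} {2 ^ (8 + o)} (≤-trans (m≤m*n 24 (8 + o)) (lemma o)) (lemma o)))
      (≤-reflexive (trans (cong (λ x → 2 ^ (8 + o) + x) (sym (+-identityʳ (2 ^ (8 + o))))) (cong (2 ^_) (sym (+-suc 8 o)))))

  module _ (n w t k : ℕ) (1≤t : 1 ≤ t) (1≤w : 1 ≤ w) (w2^t≤2n : w * 2 ^ t ≤ 2 * n) (t≤4w : t ≤ 4 * w) where

    private instance
      t≢0 : NonZero t
      t≢0 = >-nonZero 1≤t
      w≢0 : NonZero w
      w≢0 = >-nonZero 1≤w

    3a≤n : 8 ≤ t → 3 * (4 * t * w) ≤ n
    3a≤n 8≤t = *-cancelˡ-≤ 2 (≤-trans (≤-reflexive (solve 2 (λ t w → con 2 :* (con 3 :* (con 4 :* t :* w)) := w :* (con 24 :* t)) refl t w))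
      (≤-trans (*-monoʳ-≤ w (24t≤2^t t 8≤t)) w2^t≤2n))
      where open +-*-Solver

    -- With 8d ≤ 1312t the left side is at most 1312t² (3 + χ/a). Here t² ≤ 208χ, from t³ ≤ 13 · 2^t
    -- and 2^t ≤ 16tχ, and also t² ≤ a. The total is 208 · 3936 + 1312 = 820000. The factor 4t
    -- stands for an upper bound on log(np).
    deficit-bound : .{{_ : NonZero (4 * t * w)}} → n ≤ k * (2 * (4 * t * w)) →
      4 * t * (2 * (163 * t + 1) * (3 + k / (4 * t * w))) ≤ k * 820000
    deficit-bound n≤ = begin
      4 * t * (2 * (163 * t + 1) * (3 + m))
        ≡⟨ solve 3 (λ t d m → con 4 :* t :* (con 2 :* d :* (con 3 :+ m)) := t :* d :* con 8 :* con 3 :+ t :* d :* con 8 :* m) refl t (163 * t + 1) m ⟩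
      t * (163 * t + 1) * 8 * 3 + t * (163 * t + 1) * 8 * m
        ≤⟨ +-mono-≤ (*-monoˡ-≤ 3 U≤) (*-monoˡ-≤ m U≤) ⟩
      t * t * 1312 * 3 + t * t * 1312 * m
        ≤⟨ +-mono-≤ (≤-trans (≤-reflexive (*-assoc (t * t) 1312 3)) (*-monoˡ-≤ 3936 t²≤208k))
                    (≤-trans (*-monoˡ-≤ m (*-monoˡ-≤ 1312 t²≤a)) (≤-trans (≤-reflexive (solve 3 (λ a c m → a :* c :* m := m :* a :* c) refl a 1312 m))
                      (*-monoˡ-≤ 1312 (m/n*n≤m k a)))) ⟩
      k * 208 * 3936 + k * 1312
        ≡⟨ cong (_+ k * 1312) (*-assoc k 208 3936) ⟩
      k * 818688 + k * 1312
        ≡⟨ sym (*-distribˡ-+ k 818688 1312) ⟩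
      k * 820000 ∎
      where
      open ≤-Reasoning
      open +-*-Solver
      a m : ℕ
      a = 4 * t * w
      m = k / a
      U≤ : t * (163 * t + 1) * 8 ≤ t * t * 1312
      U≤ = ≤-trans (*-monoˡ-≤ 8 (*-monoʳ-≤ t (+-monoʳ-≤ (163 * t) 1≤t)))
        (≤-reflexive (solve 1 (λ t → t :* (con 163 :* t :+ t) :* con 8 := t :* t :* con 1312) refl t))
      t²≤a : t * t ≤ a
      t²≤a = ≤-trans (*-monoʳ-≤ t t≤4w) (≤-reflexive (solve 2 (λ t w → t :* (con 4 :* w) := con 4 :* t :* w) refl t w))
      2^t≤ : 2 ^ t ≤ 16 * t * k
      2^t≤ = *-cancelˡ-≤ w (≤-trans w2^t≤2n (≤-trans (*-monoʳ-≤ 2 n≤)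
        (≤-reflexive (solve 3 (λ t w k → con 2 :* (k :* (con 2 :* (con 4 :* t :* w))) := w :* (con 16 :* t :* k)) refl t w k))))
      t²≤208k : t * t ≤ k * 208
      t²≤208k = *-cancelʳ-≤ (t * t) (k * 208) t (≤-trans (t³≤ t) (≤-trans (*-monoˡ-≤ 13 2^t≤)
        (≤-reflexive (solve 2 (λ t k → con 16 :* t :* k :* con 13 := k :* con 208 :* t) refl t k))))

-- Logarithms of reals given by Cauchy sequences.

module Logarithms where

  open import Defs using (ℝ; mkℝ; seq; cauchy; IsCauchy; fromℚ; fromℕ; _+ᴿ_; _^ᴿ_; _≤ᴿ_; _<ᴿ_; _⟶_; IsLog; expPartialSum)
  open Rationals
  open Exponential
  open NegativeExponential
  open ChromaticExtrema using (least)
  import Data.Rational.Base as ℚ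
  open import Data.Integer.Base using (+_)
  open import Data.Nat.Base as ℕ using (ℕ; zero; suc)
  import Data.Nat.Properties as ℕₚ
  open import Data.Product using (∃-syntax; _×_; _,_; proj₁; proj₂)
  open import Data.Sum using (_⊎_; inj₁; inj₂)
  open import Relation.Binary.PropositionalEquality using (_≡_; refl; sym; trans; cong; cong₂; subst; subst₂)
  open import Relation.Nullary using (¬_; contradiction)

  seq-^ : ∀ x k i → seq (x ^ᴿ k) i ≡ seq x i ^ k
  seq-^ x zero    i = refl
  seq-^ x (suc k) i = trans (*≡ (seq x i) (seq (x ^ᴿ k) i)) (cong (seq x i *_) (seq-^ x k i))

  seq-exp : ∀ x N i → seq (expPartialSum x N) i ≡ e N (seq x i)
  seq-exp x zero    i = refl
  seq-exp x (suc k) i = trans (+≡ (seq (expPartialSum x k) i) _)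
    (cong₂ _+_ (seq-exp x k i) (trans (*≡ (seq (x ^ᴿ k) i) _) (cong₂ _*_ (seq-^ x k i) (1/!≡ k))))

  ≤ᴿ-intro : ∀ {x y} → (∀ ε → 0ℚ < ε → ∃[ N ] (∀ i → N ℕ.≤ i → seq x i ≤ seq y i + ε)) → x ≤ᴿ y
  ≤ᴿ-intro {x} {y} h ε 0<ε = proj₁ (h ε 0<ε) , λ i N≤i →
    subst (seq x i ≤_) (sym (+≡ (seq y i) ε)) (proj₂ (h ε 0<ε) i N≤i)

  ≤ᴿ-elim : ∀ {x y} → x ≤ᴿ y → ∀ ε → 0ℚ < ε → ∃[ N ] (∀ i → N ℕ.≤ i → seq x i ≤ seq y i + ε)
  ≤ᴿ-elim {x} {y} h ε 0<ε = proj₁ (h ε 0<ε) , λ i N≤i →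
    subst (seq x i ≤_) (+≡ (seq y i) ε) (proj₂ (h ε 0<ε) i N≤i)

  <ᴿ-elim : ∀ {x y} → x <ᴿ y → ∃[ δ ] (0ℚ < δ × ∃[ N ] (∀ i → N ℕ.≤ i → seq x i + δ ≤ seq y i))
  <ᴿ-elim {x} {y} (δ , 0<δ , N , h) = δ , 0<δ , N , λ i N≤i → subst (_≤ seq y i) (+≡ (seq x i) δ) (h i N≤i)

  cauchy-≤ : ∀ x ε → 0ℚ < ε → ∃[ N ] (∀ i j → N ℕ.≤ i → N ℕ.≤ j → seq x i ≤ seq x j + ε)
  cauchy-≤ x ε 0<ε = proj₁ (cauchy x ε 0<ε) , λ i j i≥ j≥ → proj₁ (∣-∣≤⁻ (proj₂ (cauchy x ε 0<ε) i j i≥ j≥))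

  ⟶-elim : ∀ {f x} → f ⟶ x → ∀ ε → 0ℚ < ε → ∃[ N ] (∀ k → N ℕ.≤ k → ∃[ I ] (∀ i → I ℕ.≤ i → seq x i ≤ seq (f k) i + (ε + ε)))
  ⟶-elim {f} {x} h ε 0<ε = proj₁ (h ε 0<ε) , λ k N≤k →
    let I , bound = ≤ᴿ-elim {x} {f k +ᴿ fromℚ ε} (proj₂ (proj₂ (h ε 0<ε) k N≤k)) ε 0<ε in
    I , λ i I≤i → ≤-trans (bound i I≤i) (≤-reflexive (trans (cong (_+ ε) (+≡ (seq (f k) i) ε)) (+-assoc (seq (f k) i) ε ε)))

  0<½ : 0ℚ < ½
  0<½ = positive⁻¹ ½

  -- Negative values of l are excluded by e(-y) ≤ 3/2 < 2.
  log-lower : ∀ n m l → IsLog (fromℕ n) l → 2 ℕ.^ suc m ℕ.≤ n → ∃[ I ] (∀ i → I ℕ.≤ i → ι m * ½ ≤ seq l i)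
  log-lower n m l is-log 2^m<n = I₀ ℕ.⊔ I₁ , λ i I≤i → bound i (ℕₚ.m⊔n≤o⇒m≤o I₀ I₁ I≤i) (ℕₚ.m⊔n≤o⇒n≤o I₀ I₁ I≤i)
    where
    ⅛ : ℚ
    ⅛ = ¼ ℚ.* ½
    0<⅛ : 0ℚ < ⅛
    0<⅛ = positive⁻¹ ⅛
    0<1 : 0ℚ < 1ℚ
    0<1 = positive⁻¹ 1ℚ
    I₀ : ℕ
    I₀ = proj₁ (cauchy-≤ l 1ℚ 0<1)
    X : ℕ
    X = suc (proj₁ (archimedean (1ℚ - seq l I₀)))
    -X≤l : ∀ i → I₀ ℕ.≤ i → 0ℚ - seq l i ≤ ι X
    -X≤l i I₀≤i = ≤-trans (≤-cert ((seq l i + 1ℚ) - seq l I₀) (0≤- (proj₂ (cauchy-≤ l 1ℚ 0<1) I₀ i ℕₚ.≤-refl I₀≤i))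
        (solve 2 (λ a b → (con 0ℚ :- a) :+ ((a :+ con 1ℚ) :- b) := con 1ℚ :- b) refl (seq l i) (seq l I₀)))
      (≤-trans (proj₂ (archimedean (1ℚ - seq l I₀))) (ι-mono (ℕₚ.n≤1+n _)))
    open Negative X (ℕ.s≤s ℕ.z≤n)
    N₀ N₁ N : ℕ
    N₀ = proj₁ eventually-e-negative
    lim : ∃[ N ] (∀ k → N ℕ.≤ k → ∃[ I ] (∀ i → I ℕ.≤ i → seq (fromℕ n) i ≤ seq (expPartialSum l k) i + (⅛ + ⅛)))
    lim = ⟶-elim {expPartialSum l} {fromℕ n} is-log ⅛ 0<⅛
    N₁ = proj₁ lim
    N = suc (N₀ ℕ.⊔ N₁)
    I₁ : ℕ
    I₁ = proj₁ (proj₂ lim N (ℕₚ.m≤n⇒m≤1+n (ℕₚ.m≤n⊔m N₀ N₁)))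
    n≤ : ∀ i → I₁ ℕ.≤ i → ι 2 * ι 2 ^ m ≤ e N (seq l i) + ¼
    n≤ i I₁≤i = ≤-trans (≤-trans (≤-reflexive (sym (ι-^ 2 (suc m)))) (ι-mono 2^m<n))
      (≤-trans (≤-reflexive (sym (ι≡ n))) (≤-trans (proj₂ (proj₂ lim N (ℕₚ.m≤n⇒m≤1+n (ℕₚ.m≤n⊔m N₀ N₁))) i I₁≤i)
        (≤-reflexive (cong₂ _+_ (seq-exp l N i) (sym (+≡ ⅛ ⅛))))))
    1≤2^m : 1ℚ ≤ ι 2 ^ m
    1≤2^m = 1≤^ m (subst (_≤ ι 2) ι1≡1 (ι-mono (ℕₚ.n≤1+n 1)))
    too-small : ∀ i → I₁ ℕ.≤ i → ¬ (e N (seq l i) ≤ ι 2 ^ m + ½)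
    too-small i I₁≤i e≤ = <-irrefl refl (<-≤-trans 0<¼ (≤-cert
      (((e N (seq l i) + ¼) - 2ℚ * ι 2 ^ m) + ((ι 2 ^ m + ½) - e N (seq l i)) + (ι 2 ^ m - 1ℚ))
      (0≤+ (0≤+ (0≤- (subst (λ c → c * ι 2 ^ m ≤ e N (seq l i) + ¼) ι2≡2 (n≤ i I₁≤i))) (0≤- e≤)) (0≤- 1≤2^m))
      (solve 2 (λ E P → con ¼ :+ (((E :+ con ¼) :- con 2ℚ :* P) :+ ((P :+ con ½) :- E) :+ (P :- con 1ℚ)) := con 0ℚ) refl (e N (seq l i)) (ι 2 ^ m))))
    bound : ∀ i → I₀ ℕ.≤ i → I₁ ℕ.≤ i → ι m * ½ ≤ seq l i
    -- If l < m/2, then the partial sum is at most 2^m for l ≥ 0 and at most 3/2 for l ≤ 0. Either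
    -- is too far below 2^(m+1) for the precision 1/4.
    bound i I₀≤i I₁≤i = ≮⇒≥ λ l<m → too-small i I₁≤i (small l<m (≤-total 0ℚ (seq l i)))
      where
      small : seq l i < ι m * ½ → 0ℚ ≤ seq l i ⊎ seq l i ≤ 0ℚ → e N (seq l i) ≤ ι 2 ^ m + ½
      small l<m (inj₁ 0≤l) = ≤-trans (≤-trans (e-mono N 0≤l (<⇒≤ l<m)) (e≤2^ N m)) (≤-cert ½ 0≤½ refl)
      small l<m (inj₂ l≤0) = ≤-trans (≤-reflexive (cong (e N) (solve 1 (λ l → l := con 0ℚ :- (con 0ℚ :- l)) refl (seq l i))))
        (≤-trans (proj₂ eventually-e-negative (N₀ ℕ.⊔ N₁) (ℕₚ.m≤m⊔n N₀ N₁) (0ℚ - seq l i) (0≤- l≤0) (-X≤l i I₀≤i)) (+-monoˡ-≤ ½ 1≤2^m))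

  module Logarithm (x : ℝ) (X I : ℕ) (1≤X : 1 ℕ.≤ X) (8≤x : ∀ i → I ℕ.≤ i → ι 8 ≤ seq x i) (x≤X : ∀ i → I ℕ.≤ i → seq x i ≤ ι X) where
    open Tail X 1≤X

    private
      index : ℕ → ℕ
      index i = suc (suc (I ℕ.+ i))

      I≤index : ∀ i → I ℕ.≤ index i
      I≤index i = ℕₚ.m≤n⇒m≤1+n (ℕₚ.m≤n⇒m≤1+n (ℕₚ.m≤m+n I i))

      i≤index : ∀ i → i ℕ.≤ index i
      i≤index i = ℕₚ.m≤n⇒m≤1+n (ℕₚ.m≤n⇒m≤1+n (ℕₚ.m≤n+m i I))

      mesh : ℕ → ℚ
      mesh i = proj₁ (inv (0<ι {suc i} (ℕ.s≤s ℕ.z≤n)))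

      mesh*≡1 : ∀ i → mesh i * ι (suc i) ≡ 1ℚ
      mesh*≡1 i = proj₂ (proj₂ (inv (0<ι {suc i} (ℕ.s≤s ℕ.z≤n))))

      0≤mesh : ∀ i → 0ℚ ≤ mesh i
      0≤mesh i = <⇒≤ (proj₁ (proj₂ (inv (0<ι {suc i} (ℕ.s≤s ℕ.z≤n)))))

      mesh-small : ∀ ε → 0ℚ < ε → ∃[ G ] (∀ i → G ℕ.≤ i → mesh i ≤ ε)
      mesh-small ε 0<ε = proj₁ (archimedean δ) , λ i G≤i → *-cancelʳ (0<ι {suc i} (ℕ.s≤s ℕ.z≤n))
        (≤-trans (≤-reflexive (trans (mesh*≡1 i) (trans (sym δε≡1) (*-comm δ ε))))
          (*-monoˡ (<⇒≤ 0<ε) (≤-trans (proj₂ (archimedean δ)) (ι-mono (ℕₚ.m≤n⇒m≤1+n G≤i)))))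
        where
        δ : ℚ
        δ = proj₁ (inv 0<ε)
        δε≡1 : δ * ε ≡ 1ℚ
        δε≡1 = proj₂ (proj₂ (inv 0<ε))

      mesh≤1 : ∀ i → mesh i ≤ 1ℚ
      mesh≤1 i = ≤-trans (subst (_≤ mesh i * ι (suc i)) (trans (cong (mesh i *_) ι1≡1) (*-identityʳ (mesh i)))
        (*-monoˡ (0≤mesh i) (ι-mono {1} {suc i} (ℕ.s≤s ℕ.z≤n)))) (≤-reflexive (mesh*≡1 i))

      1+X≤e : ∀ k → 1ℚ + ι X ≤ e (suc (suc k)) (ι X)
      1+X≤e k = ≤-trans (≤-reflexive (cong₂ _+_ (sym (e-zero (suc k))) (solve 1 (λ a → a := a :- con 0ℚ) refl (ι X)))) (e-slope k ≤-refl (0≤ι X))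

      opaque
        -- The i-th approximation of the logarithm is the multiple of 1/(i+1) at which the partial
        -- sum passes the approximation of x. A crossing exists because the sum is 1 at 0 and at
        -- least 1 + X at X.
        grid : ∀ i → ∃[ j ] (e (index i) (ι j * mesh i) ≤ seq x (index i) × seq x (index i) < e (index i) (ι (suc j) * mesh i))
        grid i = crossing (least (λ k → seq x m <? e m (ι k * mesh i)) (X ℕ.* suc i) top)
          where
          m : ℕ
          m = index i
          top : seq x m < e m (ι (X ℕ.* suc i) * mesh i)
          top = ≤-<-trans (x≤X m (I≤index i)) (<-≤-trans (subst (ι X <_) (ι-suc X) (ι-mono-< (ℕₚ.n<1+n X)))
            (≤-trans (1+X≤e (I ℕ.+ i)) (≤-reflexive (cong (e m) (sym (trans (cong (_* mesh i) (ι-* X (suc i)))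
              (trans (*-assoc (ι X) (ι (suc i)) (mesh i)) (trans (cong (ι X *_) (trans (*-comm (ι (suc i)) (mesh i)) (mesh*≡1 i))) (*-identityʳ (ι X))))))))))
          crossing : ∃[ k ] (seq x m < e m (ι k * mesh i) × (∀ j → seq x m < e m (ι j * mesh i) → k ℕ.≤ j)) →
            ∃[ j ] (e m (ι j * mesh i) ≤ seq x m × seq x m < e m (ι (suc j) * mesh i))
          crossing (zero , x<e , _) = contradiction (<-≤-trans x<e (≤-trans (≤-reflexive
              (trans (cong (e m) (trans (cong (_* mesh i) ι0≡0) (zeroˡ (mesh i)))) (trans (e-zero (suc (I ℕ.+ i))) (sym ι1≡1))))
              (≤-trans (ι-mono {1} {8} (ℕ.s≤s ℕ.z≤n)) (8≤x m (I≤index i))))) (<-irrefl refl)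
          crossing (suc j , x<e , minimal) = j , ≮⇒≥ (λ x<e′ → contradiction (minimal j x<e′) (ℕₚ.<⇒≱ (ℕₚ.n<1+n j))) , x<e

      l : ℕ → ℚ
      l i = ι (proj₁ (grid i)) * mesh i

      0≤l : ∀ i → 0ℚ ≤ l i
      0≤l i = 0≤* (0≤ι (proj₁ (grid i))) (0≤mesh i)

      e-l≤x : ∀ i → e (index i) (l i) ≤ seq x (index i)
      e-l≤x i = proj₁ (proj₂ (grid i))

      x<e-l+mesh : ∀ i → seq x (index i) < e (index i) (l i + mesh i)
      x<e-l+mesh i = subst (λ a → seq x (index i) < e (index i) a) (trans (cong (_* mesh i) (ι-suc (proj₁ (grid i))))
        (solve 2 (λ j g → (con 1ℚ :+ j) :* g := j :* g :+ g) refl (ι (proj₁ (grid i))) (mesh i))) (proj₂ (proj₂ (grid i)))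

      l≤X : ∀ i → l i ≤ ι X
      l≤X i = ≮⇒≥ λ X<l → <-irrefl refl (<-≤-trans (subst (ι X <_) (ι-suc X) (ι-mono-< (ℕₚ.n<1+n X)))
        (≤-trans (1+X≤e (I ℕ.+ i)) (≤-trans (e-mono (index i) (0≤ι X) (<⇒≤ X<l)) (≤-trans (e-l≤x i) (x≤X (index i) (I≤index i))))))

      0≤l+mesh : ∀ i → 0ℚ ≤ l i + mesh i
      0≤l+mesh i = 0≤+ (0≤l i) (0≤mesh i)

      -- If l i′ lies beyond l i + mesh i, then `e-slope`, applied to a partial sum long enough for
      -- both, bounds the gap by the difference of the values. The tail estimate accounts for the
      -- terms missing at i′.
      l-compare : ∀ i i′ η → 2 ℕ.* X ℕ.≤ i′ → 0ℚ ≤ η → seq x (index i′) ≤ seq x (index i) + η →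
        l i′ ≤ l i + (mesh i + η + u (index i′) * 2ℚ)
      l-compare i i′ η 2X≤i′ 0≤η x′≤ = compare (≤-total (l i′) (l i + mesh i))
        where
        m m′ M : ℕ
        m = index i
        m′ = index i′
        M = suc (suc (m ℕ.+ m′))
        a U : ℚ
        a = l i + mesh i
        U = u m′ * 2ℚ
        0≤U : 0ℚ ≤ U
        0≤U = 0≤* (0≤u (index i′)) 0≤2
        compare : l i′ ≤ a ⊎ a ≤ l i′ → l i′ ≤ l i + (mesh i + η + U)
        compare (inj₁ h) = ≤-trans h (≤-cert (η + U) (0≤+ 0≤η 0≤U) (solve 4 (λ l g η U → (l :+ g) :+ (η :+ U) := l :+ (g :+ η :+ U)) refl (l i) (mesh i) η U))
        compare (inj₂ h) = ≤-cert ((e M (l i′) - (e M a + (l i′ - a))) + (e M a - seq x m) + ((e m′ (l i′) + U) - e M (l i′)) + (seq x m′ - e m′ (l i′)) + ((seq x m + η) - seq x m′))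
          (0≤+ (0≤+ (0≤+ (0≤+ (0≤- (e-slope (m ℕ.+ m′) (0≤l+mesh i) h))
            (0≤- (≤-trans (<⇒≤ (x<e-l+mesh i)) (e-mono-index (0≤l+mesh i) (ℕₚ.m≤n⇒m≤1+n (ℕₚ.m≤n⇒m≤1+n (ℕₚ.m≤m+n m m′)))))))
            (0≤- (tail (0≤l i′) (l≤X i′) (ℕₚ.≤-trans 2X≤i′ (i≤index i′)) (ℕₚ.m≤n⇒m≤1+n (ℕₚ.m≤n⇒m≤1+n (ℕₚ.m≤n+m m′ m))))))
            (0≤- (e-l≤x i′))) (0≤- x′≤))
          (solve 10 (λ l′ l g η U eM eMa x x′ e′ → l′ :+ ((eM :- (eMa :+ (l′ :- (l :+ g)))) :+ (eMa :- x) :+ ((e′ :+ U) :- eM) :+ (x′ :- e′) :+ ((x :+ η) :- x′)) := l :+ (g :+ η :+ U))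
            refl (l i′) (l i) (mesh i) η U (e M (l i′)) (e M a) (seq x m) (seq x m′) (e m′ (l i′)))

      l-cauchy : IsCauchy l
      l-cauchy ε 0<ε = G ℕ.⊔ (U ℕ.⊔ N) , λ i i′ i≥ i′≥ → ∣-∣≤⁺ (close i′ i i′≥ i≥) (close i i′ i≥ i′≥)
        where
        δ : ℚ
        δ = ε * ¼
        0<δ : 0ℚ < δ
        0<δ = 0<* 0<ε 0<¼
        G U N : ℕ
        G = proj₁ (mesh-small δ 0<δ)
        U = proj₁ (u-small δ 0<δ)
        N = proj₁ (cauchy-≤ x δ 0<δ)
        close : ∀ i i′ → G ℕ.⊔ (U ℕ.⊔ N) ℕ.≤ i → G ℕ.⊔ (U ℕ.⊔ N) ℕ.≤ i′ → l i′ ≤ l i + ε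
        close i i′ i≥ i′≥ = ≤-trans (l-compare i i′ δ (ℕₚ.≤-trans (proj₁ (proj₂ (u-small δ 0<δ))) U≤i′) (<⇒≤ 0<δ)
            (proj₂ (cauchy-≤ x δ 0<δ) (index i′) (index i) (ℕₚ.≤-trans (N≤ i′≥) (i≤index i′)) (ℕₚ.≤-trans (N≤ i≥) (i≤index i))))
          (+-monoʳ-≤ (l i) (≤-trans (+-mono-≤ (+-monoˡ-≤ δ (proj₂ (mesh-small δ 0<δ) i (ℕₚ.m⊔n≤o⇒m≤o G (U ℕ.⊔ N) i≥)))
              (*-monoʳ 0≤2 (proj₂ (proj₂ (u-small δ 0<δ)) (index i′) (ℕₚ.≤-trans U≤i′ (i≤index i′)))))
            (≤-reflexive (solve 1 (λ ε → ε :* con ¼ :+ ε :* con ¼ :+ ε :* con ¼ :* con 2ℚ := ε) refl ε))))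
          where
          N≤ : ∀ {k} → G ℕ.⊔ (U ℕ.⊔ N) ℕ.≤ k → N ℕ.≤ k
          N≤ k≥ = ℕₚ.m⊔n≤o⇒n≤o U N (ℕₚ.m⊔n≤o⇒n≤o G (U ℕ.⊔ N) k≥)
          U≤i′ : U ℕ.≤ i′
          U≤i′ = ℕₚ.m⊔n≤o⇒m≤o U N (ℕₚ.m⊔n≤o⇒n≤o G (U ℕ.⊔ N) i′≥)

    log : ℝ
    log = mkℝ l l-cauchy

    private
      E : ℚ
      E = ι 2 ^ (2 ℕ.* suc X)

      e≤E : ∀ k i → e k (l i + mesh i) ≤ E
      e≤E k i = ≤-trans (e-mono k (0≤l+mesh i) (≤-trans (+-mono-≤ (l≤X i) (mesh≤1 i)) (≤-reflexive
          (trans (+-comm (ι X) 1ℚ) (trans (sym (ι-suc X)) (trans (sym (*-identityʳ (ι (suc X)))) (trans (cong (ι (suc X) *_) (*≡ 2ℚ ½))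
            (trans (solve 3 (λ x a b → x :* (a :* b) := a :* x :* b) refl (ι (suc X)) 2ℚ ½)
              (cong (_* ½) (trans (cong (_* ι (suc X)) (sym ι2≡2)) (sym (ι-* 2 (suc X)))))))))))))
        (e≤2^ k (2 ℕ.* suc X))

      upper : ∀ ε → 0ℚ < ε → ∀ N ε′ → 0ℚ < ε′ → ∃[ J ] (∀ i → J ℕ.≤ i → e N (l i) ≤ seq x i + ε + ε′)
      upper ε 0<ε N ε′ 0<ε′ = U ℕ.⊔ K , λ i J≤i → let U≤i = ℕₚ.m⊔n≤o⇒m≤o U K J≤i ; K≤i = ℕₚ.m⊔n≤o⇒n≤o U K J≤i ; m = index i in begin
        e N (l i)                        ≤⟨ e-mono-index (0≤l i) (ℕₚ.m≤m+n N m) ⟩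
        e (N ℕ.+ m) (l i)                ≤⟨ tail (0≤l i) (l≤X i) (ℕₚ.≤-trans (proj₁ (proj₂ small)) (ℕₚ.≤-trans U≤i (i≤index i))) (ℕₚ.m≤n+m m N) ⟩
        e m (l i) + u m * 2ℚ             ≤⟨ +-mono-≤ (≤-trans (e-l≤x i) (proj₂ (cauchy-≤ x ε 0<ε) m i (ℕₚ.≤-trans K≤i (i≤index i)) K≤i))
                                              (*-monoʳ 0≤2 (proj₂ (proj₂ small) m (ℕₚ.≤-trans U≤i (i≤index i)))) ⟩
        seq x i + ε + ε′ * ½ * 2ℚ        ≡⟨ solve 2 (λ a b → a :+ b :* con ½ :* con 2ℚ := a :+ b) refl (seq x i + ε) ε′ ⟩
        seq x i + ε + ε′                 ∎
        where
        open ≤-Reasoning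
        small : ∃[ U ] (2 ℕ.* X ℕ.≤ U × (∀ M → U ℕ.≤ M → u M ≤ ε′ * ½))
        small = u-small (ε′ * ½) (0<* 0<ε′ 0<½)
        U K : ℕ
        U = proj₁ small
        K = proj₁ (cauchy-≤ x ε 0<ε)

      -- The number of terms depends on ε only. The rounding to the grid costs mesh times the slope
      -- bound `E`, which is absorbed by ε′ as i grows.
      lower : ∀ ε → 0ℚ < ε → ∃[ N₀ ] (∀ N → N₀ ℕ.≤ N → ∀ ε′ → 0ℚ < ε′ → ∃[ J ] (∀ i → J ℕ.≤ i → seq x i ≤ e N (l i) + ε + ε′))
      lower ε 0<ε = N₀ , λ N N₀≤N ε′ 0<ε′ →
        let 0<E = 0<^ (2 ℕ.* suc X) (0<ι {2} (ℕ.s≤s ℕ.z≤n))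
            F , 0<F , FE≡1 = inv 0<E
            K , close = cauchy-≤ x (ε′ * ½) (0<* 0<ε′ 0<½)
            G , fine = mesh-small (ε′ * ½ * F) (0<* (0<* 0<ε′ 0<½) 0<F)
        in K ℕ.⊔ G , λ i J≤i → let K≤i = ℕₚ.m⊔n≤o⇒m≤o K G J≤i ; G≤i = ℕₚ.m⊔n≤o⇒n≤o K G J≤i ; m = index i in begin
        seq x i                                                  ≤⟨ close i m K≤i (ℕₚ.≤-trans K≤i (i≤index i)) ⟩
        seq x m + ε′ * ½                                         ≤⟨ +-monoˡ-≤ (ε′ * ½) (≤-trans (<⇒≤ (x<e-l+mesh i))
                                                                      (e-upper (suc (I ℕ.+ i)) (0≤l i) (≤-cert (mesh i) (0≤mesh i) refl))) ⟩
        e m (l i) + ((l i + mesh i) - l i) * e (suc (I ℕ.+ i)) (l i + mesh i) + ε′ * ½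
          ≤⟨ +-monoˡ-≤ (ε′ * ½) (+-mono-≤ (≤-trans (e-mono-index (0≤l i) (ℕₚ.m≤n+m m N)) (tail (0≤l i) (l≤X i) (ℕₚ.≤-trans (proj₁ (proj₂ small)) N₀≤N) (ℕₚ.m≤m+n N m)))
               (≤-trans (*-monoˡ (subst (0ℚ ≤_) (solve 2 (λ a b → b := (a :+ b) :- a) refl (l i) (mesh i)) (0≤mesh i)) (e≤E (suc (I ℕ.+ i)) i))
                 (≤-trans (≤-reflexive (cong (_* E) (solve 2 (λ a b → (a :+ b) :- a := b) refl (l i) (mesh i)))) (*-monoʳ (<⇒≤ 0<E) (fine i G≤i))))) ⟩
        e N (l i) + u N * 2ℚ + ε′ * ½ * F * E + ε′ * ½
          ≤⟨ +-monoˡ-≤ (ε′ * ½) (+-mono-≤ (+-monoʳ-≤ (e N (l i)) (*-monoʳ 0≤2 (proj₂ (proj₂ small) N N₀≤N))) (≤-reflexive (trans (*-assoc (ε′ * ½) F E) (cong (ε′ * ½ *_) FE≡1)))) ⟩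
        e N (l i) + ε * ½ * 2ℚ + ε′ * ½ * 1ℚ + ε′ * ½            ≡⟨ solve 3 (λ a b c → a :+ b :* con ½ :* con 2ℚ :+ c :* con ½ :* con 1ℚ :+ c :* con ½ := a :+ b :+ c) refl (e N (l i)) ε ε′ ⟩
        e N (l i) + ε + ε′                                       ∎
        where
        open ≤-Reasoning
        small : ∃[ U ] (2 ℕ.* X ℕ.≤ U × (∀ M → U ℕ.≤ M → u M ≤ ε * ½))
        small = u-small (ε * ½) (0<* 0<ε 0<½)
        N₀ : ℕ
        N₀ = proj₁ small

    isLog : IsLog x log
    isLog ε 0<ε = proj₁ (lower ε 0<ε) , λ N N₀≤N →
      ≤ᴿ-intro {expPartialSum log N} {x +ᴿ fromℚ ε} (λ ε′ 0<ε′ → proj₁ (upper ε 0<ε N ε′ 0<ε′) , λ i J≤i →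
        subst₂ _≤_ (sym (seq-exp log N i)) (cong (_+ ε′) (sym (+≡ (seq x i) ε))) (proj₂ (upper ε 0<ε N ε′ 0<ε′) i J≤i)) ,
      ≤ᴿ-intro {x} {expPartialSum log N +ᴿ fromℚ ε} (λ ε′ 0<ε′ → proj₁ (proj₂ (lower ε 0<ε) N N₀≤N ε′ 0<ε′) , λ i J≤i →
        subst (seq x i ≤_) (cong (_+ ε′) (trans (cong (_+ ε) (sym (seq-exp log N i))) (sym (+≡ (seq (expPartialSum log N) i) ε))))
          (proj₂ (proj₂ (lower ε 0<ε) N N₀≤N ε′ 0<ε′) i J≤i))

    -- The number 8 comes from here: if l < 1/2, then l + mesh ≤ 3/2, where the sum is at most 2³.
    -- The bound holds at every index, so that the reciprocal can be taken termwise.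
    ½≤log : ∀ i → ½ ≤ seq log i
    ½≤log i = ≮⇒≥ λ l<½ → <-irrefl refl (<-≤-trans (x<e-l+mesh i) (≤-trans (e-mono (index i) (0≤l+mesh i) (l+mesh≤ l<½)) (≤-trans (e≤2^ (index i) 3)
        (≤-trans (≤-reflexive (sym (ι-^ 2 3))) (8≤x (index i) (I≤index i))))))
      where
      l+mesh≤ : l i < ½ → l i + mesh i ≤ ι 3 * ½
      l+mesh≤ l<½ = ≤-trans (+-mono-≤ (<⇒≤ l<½) (mesh≤1 i)) (≤-reflexive (sym (trans (cong (_* ½) (trans (ι-suc 2) (cong (_+_ 1ℚ) ι2≡2)))
        (trans (solve 2 (λ a b → (con 1ℚ :+ b) :* a := a :+ b :* a) refl ½ 2ℚ) (cong (_+_ ½) (sym (*≡ 2ℚ ½)))))))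

    -- By `2^≤e` the exponential of T is at least 2^T, provided the partial sum has at least T + 1
    -- terms.
    log≤ : ∀ T → (∀ i → I ℕ.≤ i → seq x i ≤ ι (2 ℕ.^ T)) → ∀ i → suc T ℕ.≤ i → seq log i ≤ ι T
    log≤ T x≤ i T<i = ≮⇒≥ λ T<l → <-irrefl refl (<-≤-trans (0<diff T<l) (diff≤0 T<l))
      where
      m : ℕ
      m = index i
      0<diff : ι T < l i → 0ℚ < l i - ι T
      0<diff T<l = subst (_< l i - ι T) (+-inverseʳ (ι T)) (+-monoˡ-< (- ι T) T<l)
      diff≤0 : ι T < l i → l i - ι T ≤ 0ℚ
      diff≤0 T<l = ≤-cert ((e m (l i) - (e m (ι T) + (l i - ι T))) + (e m (ι T) - ι (2 ℕ.^ T)) + (ι (2 ℕ.^ T) - seq x m) + (seq x m - e m (l i)))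
        (0≤+ (0≤+ (0≤+ (0≤- (e-slope (I ℕ.+ i) (0≤ι T) (<⇒≤ T<l)))
          (0≤- (≤-trans (≤-reflexive (ι-^ 2 T)) (≤-trans (2^≤e T) (e-mono-index (0≤ι T) (ℕₚ.≤-trans T<i (i≤index i)))))))
          (0≤- (x≤ m (I≤index i)))) (0≤- (e-l≤x i)))
        (solve 5 (λ d el et p x → d :+ ((el :- (et :+ d)) :+ (et :- p) :+ (p :- x) :+ (x :- el)) := con 0ℚ) refl (l i - ι T) (e m (l i)) (e m (ι T)) (ι (2 ℕ.^ T)) (seq x m))

-- Integer parameters for the density: w ≈ 1/p and 2^t ≈ np.

module Scales where

  open import Defs
  open Rationals
  open Logarithms
  open ObstructionMeans using (½≤1)
  open ChromaticExtrema using (least)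
  import Data.Rational.Base as ℚ
  open import Data.Bool.Base using ()
  open import Data.Fin.Base using (zero)
  open import Data.Integer.Base using (+_)
  open import Data.Nat.Base as ℕ using (ℕ; zero; suc)
  import Data.Nat.Properties as ℕₚ
  open import Data.Product using (∃-syntax; Σ-syntax; _×_; _,_; proj₁; proj₂)
  open import Relation.Binary.PropositionalEquality using (_≡_; refl; sym; trans; cong; cong₂; subst; subst₂)
  open import Relation.Nullary using (contradiction)

  -- The number m is about log₂ n. The conditions on p concern all approximations from index I on.
  record Params (n : ℕ) (p : ℝ) : Set where
    field
      m w t I   : ℕ
      n<2^      : n ℕ.< 2 ℕ.^ (2 ℕ.+ m)
      1≤w       : 1 ℕ.≤ w
      8≤t       : 8 ℕ.≤ t
      n≤w2^t    : n ℕ.≤ w ℕ.* 2 ℕ.^ t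
      w2^t≤2n   : w ℕ.* 2 ℕ.^ t ℕ.≤ 2 ℕ.* n
      t≤4w      : t ℕ.≤ 4 ℕ.* w
      m≤3*2^t   : m ℕ.≤ 3 ℕ.* 2 ℕ.^ t
      0≤p       : ∀ i → I ℕ.≤ i → 0ℚ ≤ seq p i
      p≤1       : ∀ i → I ℕ.≤ i → seq p i ≤ 1ℚ
      1≤wp      : ∀ i → I ℕ.≤ i → 1ℚ ≤ ι w * seq p i
      wp≤5      : ∀ i → I ℕ.≤ i → ι w * seq p i ≤ ι 5
      8≤np      : ∀ i → I ℕ.≤ i → ι 8 ≤ ι n * seq p i

  Hypothesis : ℕ → ℝ → Set
  Hypothesis n p = ∃[ logn ] ∃[ lower ] ∃[ upper ]
    (IsLog (fromℕ n) logn
     × IsQuotient (fromℕ 2 *ᴿ logn) (fromℕ n) lower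
     × IsQuotient 1ᴿ (logn ^ᴿ 2) upper
     × lower <ᴿ p
     × p <ᴿ upper)

  n<2^n : ∀ n → n ℕ.< 2 ℕ.^ n
  n<2^n zero    = ℕ.s≤s ℕ.z≤n
  n<2^n (suc n) = ℕₚ.≤-trans (ℕₚ.+-mono-≤ (ℕₚ.m^n>0 2 n) (n<2^n n)) (ℕₚ.≤-reflexive (cong (λ k → 2 ℕ.^ n ℕ.+ k) (sym (ℕₚ.+-identityʳ (2 ℕ.^ n)))))

  binary-size : ∀ n → 1 ℕ.≤ n → ∃[ k ] (2 ℕ.^ k ℕ.≤ n × n ℕ.< 2 ℕ.^ suc k)
  binary-size n 1≤n = split (least (λ k → n ℕₚ.<? 2 ℕ.^ k) n (n<2^n n))
    where
    split : ∃[ k ] (n ℕ.< 2 ℕ.^ k × (∀ j → n ℕ.< 2 ℕ.^ j → k ℕ.≤ j)) → ∃[ k ] (2 ℕ.^ k ℕ.≤ n × n ℕ.< 2 ℕ.^ suc k)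
    split (zero  , n<1 , _)       = contradiction n<1 (ℕₚ.≤⇒≯ 1≤n)
    split (suc k , n< , minimal) = k , ℕₚ.≮⇒≥ (λ n<′ → ℕₚ.<-irrefl refl (minimal k n<′)) , n<

  -- With m ≈ log₂ n: np ≥ 2 log n ≥ m, and pm² ≤ 4 p log² n ≤ 4 up to the
  -- precision of the approximations.
  density : ∀ n m p → 2 ℕ.^ suc m ℕ.≤ n → Hypothesis n p →
    ∃[ I ] (∀ i → I ℕ.≤ i → ι m ≤ ι n * seq p i × seq p i * (ι m * ι m) ≤ ι 8)
  density n m p 2^m<n (logn , lower , upper , is-log , (_ , _ , low) , (_ , up , _) , l<p , p<u)
    with <ᴿ-elim {lower} {p} l<p | <ᴿ-elim {p} {upper} p<u
  ... | δ , 0<δ , I₁ , h₁ | δ′ , 0<δ′ , I₂ , h₂ = I , λ i I≤i → np i I≤i , pm² i I≤i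
    where
    0<1 : 0ℚ < 1ℚ
    0<1 = positive⁻¹ 1ℚ
    1≤n : 1 ℕ.≤ n
    1≤n = ℕₚ.≤-trans (ℕₚ.m^n>0 2 (suc m)) 2^m<n
    logn≥ = log-lower n m logn is-log 2^m<n
    -- The precision is the gap δ between `lower` and p. After multiplication by n ≥ 1 the gap
    -- outweighs this error.
    low≥ = ≤ᴿ-elim {fromℕ 2 *ᴿ logn} {lower *ᴿ fromℕ n} low δ 0<δ
    up≤ = ≤ᴿ-elim {upper *ᴿ logn ^ᴿ 2} {1ᴿ} up 1ℚ 0<1
    I : ℕ
    I = (I₁ ℕ.⊔ I₂) ℕ.⊔ (proj₁ logn≥ ℕ.⊔ (proj₁ low≥ ℕ.⊔ proj₁ up≤))
    module _ (i : ℕ) (I≤i : I ℕ.≤ i) where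
      private
        l lo hi q : ℚ
        l = seq logn i
        lo = seq lower i
        hi = seq upper i
        q = seq p i
        I≤₁ = ℕₚ.m⊔n≤o⇒m≤o (I₁ ℕ.⊔ I₂) _ I≤i
        I≤₂ = ℕₚ.m⊔n≤o⇒n≤o (I₁ ℕ.⊔ I₂) _ I≤i
        I≤₃ = ℕₚ.m⊔n≤o⇒n≤o (proj₁ logn≥) _ I≤₂
        m/2≤l : ι m * ½ ≤ l
        m/2≤l = proj₂ logn≥ i (ℕₚ.m⊔n≤o⇒m≤o (proj₁ logn≥) _ I≤₂)
        lo≥ : 2ℚ * l ≤ lo * ι n + δ
        lo≥ = subst₂ _≤_ (trans (*≡ (+ 2 ℚ./ 1) l) (cong (_* l) (trans (ι≡ 2) ι2≡2))) (cong (_+ δ) (trans (*≡ lo (+ n ℚ./ 1)) (cong (lo *_) (ι≡ n))))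
          (proj₂ low≥ i (ℕₚ.m⊔n≤o⇒m≤o (proj₁ low≥) _ I≤₃))
        hi≤ : hi * (l * l) ≤ 2ℚ
        hi≤ = subst₂ _≤_ (trans (*≡ hi (seq (logn ^ᴿ 2) i)) (cong (hi *_) (trans (seq-^ logn 2 i) (cong (l *_) (*-identityʳ l))))) (sym (+≡ 1ℚ 1ℚ))
          (proj₂ up≤ i (ℕₚ.m⊔n≤o⇒n≤o (proj₁ low≥) _ I≤₃))
        q≤hi : q ≤ hi
        q≤hi = ≤-trans (≤-cert δ′ (<⇒≤ 0<δ′) refl) (h₂ i (ℕₚ.m⊔n≤o⇒n≤o I₁ I₂ I≤₁))
      np : ι m ≤ ι n * q
      np = ≤-cert ((q - (lo + δ)) * ι n + ((lo * ι n + δ) - 2ℚ * l) + (l - ι m * ½) * 2ℚ + (ι n - 1ℚ) * δ)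
        (0≤+ (0≤+ (0≤+ (0≤* (0≤- (h₁ i (ℕₚ.m⊔n≤o⇒m≤o I₁ I₂ I≤₁))) (0≤ι n)) (0≤- lo≥)) (0≤* (0≤- m/2≤l) 0≤2))
          (0≤* (0≤- (subst (_≤ ι n) ι1≡1 (ι-mono 1≤n))) (<⇒≤ 0<δ)))
        (solve 6 (λ m q lo δ n l → m :+ ((q :- (lo :+ δ)) :* n :+ ((lo :* n :+ δ) :- con 2ℚ :* l) :+ (l :- m :* con ½) :* con 2ℚ :+ (n :- con 1ℚ) :* δ) := n :* q)
          refl (ι m) q lo δ (ι n) l)
      private
        0≤q : 0ℚ ≤ q
        0≤q = *-cancelʳ (0<ι 1≤n) (≤-trans (≤-reflexive (zeroˡ (ι n))) (≤-trans (0≤ι m) (≤-trans np (≤-reflexive (*-comm (ι n) q)))))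
        0≤m/2 : 0ℚ ≤ ι m * ½
        0≤m/2 = 0≤* (0≤ι m) 0≤½
      pm² : q * (ι m * ι m) ≤ ι 8
      pm² = ≤-trans (≤-cert ((2ℚ - hi * (l * l)) * (2ℚ * 2ℚ) + (hi - q) * (l * l) * (2ℚ * 2ℚ) + q * (l * l - (ι m * ½) * (ι m * ½)) * (2ℚ * 2ℚ))
          (0≤+ (0≤+ (0≤* (0≤- hi≤) 0≤4) (0≤* (0≤* (0≤- q≤hi) (0≤* 0≤l 0≤l)) 0≤4))
            (0≤* (0≤* 0≤q (0≤- (*-mono 0≤m/2 0≤l m/2≤l m/2≤l))) 0≤4))
          (solve 4 (λ q m hi l → q :* (m :* m) :+ ((con 2ℚ :- hi :* (l :* l)) :* (con 2ℚ :* con 2ℚ) :+ (hi :- q) :* (l :* l) :* (con 2ℚ :* con 2ℚ) :+ q :* (l :* l :- (m :* con ½) :* (m :* con ½)) :* (con 2ℚ :* con 2ℚ))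
            := con 2ℚ :* (con 2ℚ :* con 2ℚ)) refl q (ι m) hi l))
        (≤-reflexive (sym (trans (ι-* 2 4) (cong₂ _*_ ι2≡2 (trans (ι-* 2 2) (cong₂ _*_ ι2≡2 ι2≡2))))))
        where
        0≤l : 0ℚ ≤ l
        0≤l = ≤-trans 0≤m/2 m/2≤l
        0≤4 : 0ℚ ≤ 2ℚ * 2ℚ
        0≤4 = 0≤* 0≤2 0≤2

  module MakeParams (n m : ℕ) (p : ℝ) (2^m<n : 2 ℕ.^ suc m ℕ.≤ n) (n<2^m : n ℕ.< 2 ℕ.^ (2 ℕ.+ m)) (768≤m : 768 ℕ.≤ m)
    (I : ℕ) (dense : ∀ i → I ℕ.≤ i → ι m ≤ ι n * seq p i × seq p i * (ι m * ι m) ≤ ι 8) where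

    1≤n : 1 ℕ.≤ n
    1≤n = ℕₚ.≤-trans (ℕₚ.m^n>0 2 (suc m)) 2^m<n

    8≤m : 8 ℕ.≤ m
    8≤m = ℕₚ.≤-trans (ℕₚ.m≤m+n 8 760) 768≤m

    0<m : 0ℚ < ι m
    0<m = 0<ι (ℕₚ.≤-trans (ℕₚ.m≤m+n 1 7) 8≤m)

    h c : ℚ
    h = proj₁ (inv (0<ι 1≤n))
    c = ι m * h
    0<h : 0ℚ < h
    0<h = proj₁ (proj₂ (inv (0<ι 1≤n)))
    hn≡1 : h * ι n ≡ 1ℚ
    hn≡1 = proj₂ (proj₂ (inv (0<ι 1≤n)))
    0<c : 0ℚ < c
    0<c = 0<* 0<m 0<h

    c≤p : ∀ i → I ℕ.≤ i → c ≤ seq p i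
    c≤p i I≤i = ≤-trans (*-monoʳ (<⇒≤ 0<h) (proj₁ (dense i I≤i))) (≤-reflexive
      (trans (solve 3 (λ n q h → n :* q :* h := q :* (h :* n)) refl (ι n) (seq p i) h) (trans (cong (seq p i *_) hn≡1) (*-identityʳ (seq p i)))))

    0≤p : ∀ i → I ℕ.≤ i → 0ℚ ≤ seq p i
    0≤p i I≤i = ≤-trans (<⇒≤ 0<c) (c≤p i I≤i)

    p≤1 : ∀ i → I ℕ.≤ i → seq p i ≤ 1ℚ
    p≤1 i I≤i = *-cancelʳ (0<ι {8} (ℕ.s≤s ℕ.z≤n)) (≤-trans (*-monoˡ (0≤p i I≤i) (≤-trans (ι-mono 8≤m)
      (≤-trans (≤-reflexive (trans (sym (*-identityʳ (ι m))) (cong (ι m *_) (sym ι1≡1)))) (*-monoˡ (0≤ι m) (ι-mono (ℕₚ.≤-trans (ℕₚ.m≤m+n 1 7) 8≤m))))))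
      (≤-trans (proj₂ (dense i I≤i)) (≤-reflexive (sym (*-identityˡ (ι 8))))))

    near : ∃[ N ] (∀ i j → N ℕ.≤ i → N ℕ.≤ j → seq p i ≤ seq p j + c * ½)
    near = cauchy-≤ p (c * ½) (0<* 0<c 0<½)

    J : ℕ
    J = I ℕ.⊔ proj₁ near

    I≤ : ∀ {i} → J ℕ.≤ i → I ℕ.≤ i
    I≤ = ℕₚ.m⊔n≤o⇒m≤o I (proj₁ near)

    -- As p ≥ c > 0, the absolute precision c/2 is also a relative one: approximations from J on
    -- agree up to a factor 3/2.
    compare : ∀ i j → J ℕ.≤ i → J ℕ.≤ j → seq p i ≤ seq p j + seq p j * ½
    compare i j J≤i J≤j = ≤-trans (proj₂ near i j (ℕₚ.m⊔n≤o⇒n≤o I (proj₁ near) J≤i) (ℕₚ.m⊔n≤o⇒n≤o I (proj₁ near) J≤j))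
      (+-monoʳ-≤ (seq p j) (*-monoʳ 0≤½ (c≤p j (I≤ J≤j))))

    q : ℚ
    q = seq p J

    0<q : 0ℚ < q
    0<q = <-≤-trans 0<c (c≤p J (I≤ ℕₚ.≤-refl))

    opaque
      -- The least w with wq ≥ 2 overshoots by at most q ≤ 1. The range from 2 to 3, widened by the
      -- factor 3/2 in both directions, stays within the required range from 1 to 5.
      width : ∃[ w ] (2ℚ ≤ ι w * q × ι w * q ≤ 2ℚ + 1ℚ)
      width = split (least (λ k → 2ℚ ≤? ι k * q) K enough)
        where
        r : ℚ
        r = proj₁ (inv 0<q)
        K : ℕ
        K = proj₁ (archimedean (2ℚ * r))
        enough : 2ℚ ≤ ι K * q
        enough = ≤-trans (≤-reflexive (sym (trans (*-assoc 2ℚ r q) (trans (cong (2ℚ *_) (proj₂ (proj₂ (inv 0<q)))) (*-identityʳ 2ℚ)))))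
          (*-monoʳ (<⇒≤ 0<q) (proj₂ (archimedean (2ℚ * r))))
        split : ∃[ k ] (2ℚ ≤ ι k * q × (∀ j → 2ℚ ≤ ι j * q → k ℕ.≤ j)) → ∃[ w ] (2ℚ ≤ ι w * q × ι w * q ≤ 2ℚ + 1ℚ)
        split (zero  , 2≤ , _)       = contradiction (<-≤-trans (positive⁻¹ 2ℚ) (≤-trans 2≤ (≤-reflexive (trans (cong (_* q) ι0≡0) (zeroˡ q))))) (<-irrefl refl)
        split (suc k , 2≤ , minimal) = suc k , 2≤ , ≤-trans (≤-reflexive (trans (cong (_* q) (ι-suc k)) (solve 2 (λ k q → (con 1ℚ :+ k) :* q := k :* q :+ q) refl (ι k) q)))
          (+-mono-≤ (<⇒≤ (≰⇒> (λ 2≤′ → ℕₚ.<-irrefl refl (minimal k 2≤′)))) (p≤1 J (I≤ ℕₚ.≤-refl)))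

    w : ℕ
    w = proj₁ width

    2≤wq : 2ℚ ≤ ι w * q
    2≤wq = proj₁ (proj₂ width)

    wq≤3 : ι w * q ≤ 2ℚ + 1ℚ
    wq≤3 = proj₂ (proj₂ width)

    1≤w : 1 ℕ.≤ w
    1≤w = ι-cancel-< (*-cancel-< (<-≤-trans (≤-<-trans (≤-reflexive (trans (cong (_* q) ι0≡0) (zeroˡ q))) (positive⁻¹ 2ℚ)) 2≤wq))
      where
      *-cancel-< : ι 0 * q < ι w * q → ι 0 < ι w
      *-cancel-< h = ≰⇒> λ w≤0 → <-irrefl refl (<-≤-trans h (*-monoʳ (<⇒≤ 0<q) w≤0))

    1≤wp : ∀ i → J ℕ.≤ i → 1ℚ ≤ ι w * seq p i
    1≤wp i J≤i = *-cancelʳ {c = 1ℚ + ½} 0<1+½ (≤-trans (≤-reflexive (*-identityˡ (1ℚ + ½)))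
      (≤-trans (+-monoʳ-≤ 1ℚ ½≤1) (≤-trans (≤-reflexive (sym (+≡ 1ℚ 1ℚ))) (≤-trans 2≤wq (≤-trans (*-monoˡ (0≤ι w) (compare J i ℕₚ.≤-refl J≤i))
        (≤-reflexive (solve 2 (λ w q → w :* (q :+ q :* con ½) := w :* q :* (con 1ℚ :+ con ½)) refl (ι w) (seq p i))))))))
      where
      0<1+½ : 0ℚ < 1ℚ + ½
      0<1+½ = subst (0ℚ <_) (+≡ 1ℚ ½) (positive⁻¹ (1ℚ ℚ.+ ½))

    ι5≡ : ι 5 ≡ 1ℚ + 2ℚ * 2ℚ
    ι5≡ = trans (ι-suc 4) (cong (_+_ 1ℚ) (trans (ι-* 2 2) (cong₂ _*_ ι2≡2 ι2≡2)))

    ι3≡ : ι 3 ≡ 2ℚ + 1ℚ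
    ι3≡ = trans (ι-suc 2) (trans (cong (_+_ 1ℚ) ι2≡2) (+-comm 1ℚ 2ℚ))

    wp≤5 : ∀ i → J ℕ.≤ i → ι w * seq p i ≤ ι 5
    wp≤5 i J≤i = ≤-trans (≤-trans (*-monoˡ (0≤ι w) (compare i J J≤i ℕₚ.≤-refl)) (≤-cert (((2ℚ + 1ℚ) - ι w * q) * (1ℚ + ½) + ½)
        (0≤+ (0≤* (0≤- wq≤3) (0≤+ 0≤1 0≤½)) 0≤½)
        (solve 2 (λ w q → w :* (q :+ q :* con ½) :+ (((con 2ℚ :+ con 1ℚ) :- w :* q) :* (con 1ℚ :+ con ½) :+ con ½) := con 1ℚ :+ con 2ℚ :* con 2ℚ) refl (ι w) q)))
      (≤-reflexive (sym ι5≡))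

    wm≤3n : w ℕ.* m ℕ.≤ 3 ℕ.* n
    wm≤3n = ι-cancel-≤ (≤-trans (≤-reflexive (ι-* w m)) (≤-trans (*-monoˡ (0≤ι w) (proj₁ (dense J (I≤ ℕₚ.≤-refl))))
      (≤-trans (≤-reflexive (solve 3 (λ w n q → w :* (n :* q) := w :* q :* n) refl (ι w) (ι n) q)) (≤-trans (*-monoʳ (0≤ι n) wq≤3)
        (≤-reflexive (trans (cong (_* ι n) (sym ι3≡)) (sym (ι-* 3 n))))))))

    -- From qm² ≤ 8 ≤ 4wq. Through this bound p < 1/log² n leads to `t≤4w`, since t ≤ m + 2.
    m²≤4w : m ℕ.* m ℕ.≤ 4 ℕ.* w
    m²≤4w = ι-cancel-≤ (*-cancelʳ 0<q (≤-trans (≤-reflexive (trans (*-comm (ι (m ℕ.* m)) q) (cong (q *_) (ι-* m m))))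
      (≤-trans (proj₂ (dense J (I≤ ℕₚ.≤-refl))) (≤-trans (≤-reflexive (trans (ι-* 4 2) (cong (ι 4 *_) ι2≡2))) (≤-trans (*-monoˡ (0≤ι 4) 2≤wq)
        (≤-reflexive (trans (sym (*-assoc (ι 4) (ι w) q)) (cong (_* q) (sym (ι-* 4 w))))))))))

    opaque
      exponent : ∃[ t ] (n ℕ.≤ w ℕ.* 2 ℕ.^ suc t × w ℕ.* 2 ℕ.^ t ℕ.< n)
      exponent = split (least (λ t → n ℕₚ.≤? w ℕ.* 2 ℕ.^ t) n (ℕₚ.≤-trans (ℕₚ.<⇒≤ (n<2^n n)) (ℕₚ.m≤n*m (2 ℕ.^ n) w {{ℕ.>-nonZero 1≤w}})))
        where
        split : ∃[ t ] (n ℕ.≤ w ℕ.* 2 ℕ.^ t × (∀ j → n ℕ.≤ w ℕ.* 2 ℕ.^ j → t ℕ.≤ j)) → ∃[ t ] (n ℕ.≤ w ℕ.* 2 ℕ.^ suc t × w ℕ.* 2 ℕ.^ t ℕ.< n)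
        -- The exponent is positive: n ≤ w would give 8n ≤ wm ≤ 3n.
        split (zero , n≤w , _) = contradiction (ℕₚ.≤-trans (ℕₚ.*-monoˡ-≤ 8 (ℕₚ.≤-trans n≤w (ℕₚ.≤-reflexive (ℕₚ.*-identityʳ w))))
            (ℕₚ.≤-trans (ℕₚ.*-monoʳ-≤ w 8≤m) wm≤3n)) (ℕₚ.<⇒≱ (subst (3 ℕ.* n ℕ.<_) (ℕₚ.*-comm 8 n) (ℕₚ.*-monoˡ-< n {{ℕ.>-nonZero 1≤n}} (ℕₚ.m≤m+n 4 4))))
        split (suc t , n≤ , minimal) = t , n≤ , ℕₚ.≰⇒> (λ n≤′ → ℕₚ.<-irrefl refl (minimal t n≤′))

    t : ℕ
    t = suc (proj₁ exponent)

    n≤w2^t : n ℕ.≤ w ℕ.* 2 ℕ.^ t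
    n≤w2^t = proj₁ (proj₂ exponent)

    w2^t<n : w ℕ.* 2 ℕ.^ proj₁ exponent ℕ.< n
    w2^t<n = proj₂ (proj₂ exponent)

    w2^t≤2n : w ℕ.* 2 ℕ.^ t ℕ.≤ 2 ℕ.* n
    w2^t≤2n = ℕₚ.≤-trans (ℕₚ.≤-reflexive (trans (sym (ℕₚ.*-assoc w 2 (2 ℕ.^ proj₁ exponent))) (trans (cong (ℕ._* 2 ℕ.^ proj₁ exponent) (ℕₚ.*-comm w 2))
      (ℕₚ.*-assoc 2 w (2 ℕ.^ proj₁ exponent))))) (ℕₚ.*-monoʳ-≤ 2 (ℕₚ.<⇒≤ w2^t<n))

    m≤3*2^t : m ℕ.≤ 3 ℕ.* 2 ℕ.^ t
    m≤3*2^t = ℕₚ.*-cancelˡ-≤ w {{ℕ.>-nonZero 1≤w}} (ℕₚ.≤-trans wm≤3n (ℕₚ.≤-trans (ℕₚ.*-monoʳ-≤ 3 n≤w2^t)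
      (ℕₚ.≤-reflexive (trans (sym (ℕₚ.*-assoc 3 w (2 ℕ.^ t))) (trans (cong (ℕ._* 2 ℕ.^ t) (ℕₚ.*-comm 3 w)) (ℕₚ.*-assoc w 3 (2 ℕ.^ t)))))))

    8≤t : 8 ℕ.≤ t
    8≤t = ℕₚ.≮⇒≥ λ t<8 → ℕₚ.<⇒≱ {384} {768} (ℕₚ.m≤m+n 385 383) (ℕₚ.≤-trans 768≤m (ℕₚ.≤-trans m≤3*2^t
      (ℕₚ.*-monoʳ-≤ 3 (ℕₚ.^-monoʳ-≤ 2 (ℕ.s≤s⁻¹ t<8)))))

    t≤4w : t ℕ.≤ 4 ℕ.* w
    t≤4w = ℕₚ.≤-trans t≤m+2 (ℕₚ.≤-trans (ℕₚ.+-monoʳ-≤ 2 (ℕₚ.≤-reflexive (sym (ℕₚ.+-identityʳ m))))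
      (ℕₚ.≤-trans (ℕₚ.+-monoˡ-≤ (m ℕ.+ 0) (ℕₚ.≤-trans (ℕₚ.m≤m+n 2 6) 8≤m)) (ℕₚ.≤-trans (ℕₚ.*-monoˡ-≤ m (ℕₚ.≤-trans (ℕₚ.m≤m+n 2 6) 8≤m)) m²≤4w)))
      where
      t≤m+2 : t ℕ.≤ 2 ℕ.+ m
      t≤m+2 = ℕₚ.≮⇒≥ λ m+2<t → ℕₚ.<⇒≱ (ℕₚ.<-trans w2^t<n n<2^m) (ℕₚ.≤-trans (ℕₚ.^-monoʳ-≤ 2 (ℕ.s≤s⁻¹ m+2<t))
        (ℕₚ.m≤n*m (2 ℕ.^ proj₁ exponent) w {{ℕ.>-nonZero 1≤w}}))

    params : Params n p
    params = record
      { m = m ; w = w ; t = t ; I = J ; n<2^ = n<2^m ; 1≤w = 1≤w ; 8≤t = 8≤t ; n≤w2^t = n≤w2^t ; w2^t≤2n = w2^t≤2n ; t≤4w = t≤4w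
      ; m≤3*2^t = m≤3*2^t ; 0≤p = λ i J≤i → 0≤p i (I≤ J≤i) ; p≤1 = λ i J≤i → p≤1 i (I≤ J≤i) ; 1≤wp = 1≤wp ; wp≤5 = wp≤5
      ; 8≤np = λ i J≤i → ≤-trans (ι-mono 8≤m) (proj₁ (dense i (I≤ J≤i))) }

  -- m ≥ 768 = 3 · 2⁸ forces t ≥ 8.
  make-params : ∀ n p → 2 ℕ.^ 770 ℕ.≤ n → Hypothesis n p → Params n p
  make-params n p large hyp = from (binary-size n 1≤n)
    where
    1≤n : 1 ℕ.≤ n
    1≤n = ℕₚ.≤-trans (ℕₚ.m^n>0 2 770) large
    from : ∃[ k ] (2 ℕ.^ k ℕ.≤ n × n ℕ.< 2 ℕ.^ suc k) → Params n p
    from (zero  , _   , n<2) = contradiction large (ℕₚ.<⇒≱ (ℕₚ.<-≤-trans n<2 (ℕₚ.^-monoʳ-≤ 2 {1} {770} (ℕ.s≤s ℕ.z≤n))))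
    from (suc m , 2^m , n<)  = MakeParams.params n m p 2^m n< (ℕₚ.≮⇒≥ λ m<768 → ℕₚ.<⇒≱ n<
      (ℕₚ.≤-trans (ℕₚ.^-monoʳ-≤ 2 (ℕₚ.m≤n⇒m≤1+n (ℕ.s≤s m<768))) large))
      (proj₁ (density n m p 2^m hyp)) (proj₂ (density n m p 2^m hyp))

-- The typical event, its consequences and its probability.

module Typicality where

  open import Defs
  open Rationals
  open NegativeExponential using (¼; 0<¼)
  open Logarithms
  open Scales
  open Probability using (seq-Pr)
  open Obstructions using (badness)
  open ObstructionMeans using (½^*2^)
  open FailureProbability using (good; good⇒badness<1; good≤1; module Failure)
  open ChromaticExtrema using (χ; χ-graph; φ; φ̂; φ-isφ; φ̂-isφ̂; φ̂≤φ)
  open Deficit using (n≤χ*2a; deficit; χ-deficit≤φ̂; 3a≤n; deficit-bound)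
  import Data.Rational.Base as ℚ
  open import Data.Bool.Base using (Bool; true; false)
  open import Data.Fin.Base using (Fin; fromℕ<)
  open import Data.Fin.Subset using (⊤)
  open import Data.Integer.Base as ℤ using (ℤ; +_)
  open import Data.Nat.Base as ℕ using (ℕ)
  import Data.Nat.Properties as ℕₚ
  open import Data.Product using (∃-syntax; Σ-syntax; _×_; _,_; proj₁; proj₂)
  open import Relation.Binary.PropositionalEquality using (_≡_; refl; sym; trans; cong; cong₂; subst; subst₂)
  open import Relation.Nullary using (Dec; yes; no; contradiction)

  module Reciprocal (x : ℝ) (½≤x : ∀ i → ½ ≤ seq x i) where

    0<x : ∀ i → 0ℚ < seq x i
    0<x i = <-≤-trans 0<½ (½≤x i)

    r : ℕ → ℚ
    r i = proj₁ (inv (0<x i))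

    0≤r : ∀ i → 0ℚ ≤ r i
    0≤r i = <⇒≤ (proj₁ (proj₂ (inv (0<x i))))

    rx≡1 : ∀ i → r i * seq x i ≡ 1ℚ
    rx≡1 i = proj₂ (proj₂ (inv (0<x i)))

    r≤2 : ∀ i → r i ≤ 2ℚ
    r≤2 i = *-cancelʳ 0<½ (≤-trans (*-monoˡ (0≤r i) (½≤x i)) (≤-reflexive (trans (rx≡1 i) (*≡ 2ℚ ½))))

    -- The difference of two reciprocals is r i · r j times that of the arguments, and r ≤ 2 makes
    -- the factor at most 4.
    r-cauchy : IsCauchy r
    r-cauchy ε 0<ε = proj₁ close , λ i j i≥ j≥ → ∣-∣≤⁺ (near i j i≥ j≥) (near j i j≥ i≥)
      where
      close : ∃[ N ] (∀ i j → N ℕ.≤ i → N ℕ.≤ j → seq x i ≤ seq x j + ε * ¼)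
      close = cauchy-≤ x (ε * ¼) (0<* 0<ε 0<¼)
      near : ∀ i j → proj₁ close ℕ.≤ i → proj₁ close ℕ.≤ j → r i ≤ r j + ε
      near i j i≥ j≥ = begin
        r i                                    ≡⟨ sym (*-identityʳ (r i)) ⟩
        r i * 1ℚ                               ≡⟨ cong (r i *_) (sym (rx≡1 j)) ⟩
        r i * (r j * seq x j)                  ≡⟨ sym (*-assoc (r i) (r j) (seq x j)) ⟩
        r i * r j * seq x j                    ≤⟨ *-monoˡ (0≤* (0≤r i) (0≤r j)) (proj₂ close j i j≥ i≥) ⟩
        r i * r j * (seq x i + ε * ¼)          ≡⟨ solve 4 (λ a b x e → a :* b :* (x :+ e) := b :* (a :* x) :+ a :* b :* e) refl (r i) (r j) (seq x i) (ε * ¼) ⟩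
        r j * (r i * seq x i) + r i * r j * (ε * ¼) ≤⟨ +-mono-≤ (≤-reflexive (trans (cong (r j *_) (rx≡1 i)) (*-identityʳ (r j))))
                                                    (*-monoʳ (0≤* (<⇒≤ 0<ε) (<⇒≤ 0<¼)) (*-mono (0≤r i) 0≤2 (r≤2 i) (r≤2 j))) ⟩
        r j + 2ℚ * 2ℚ * (ε * ¼)                ≡⟨ solve 2 (λ a e → a :+ con 2ℚ :* con 2ℚ :* (e :* con ¼) := a :+ e) refl (r j) ε ⟩
        r j + ε                                ∎
        where open ≤-Reasoning

    reciprocalᴿ : ℝ
    reciprocalᴿ = mkℝ r r-cauchy

    quotient : ∀ C → IsQuotient (fromℕ C) x (fromℕ C *ᴿ reciprocalᴿ)
    quotient C = (½ , 0<½ , 0 , λ i _ → ≤-trans (≤-reflexive (trans (+≡ 0ℚ ½) (+-identityˡ ½))) (½≤x i)) ,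
      ≤ᴿ-intro {y} {fromℕ C} (λ ε 0<ε → 0 , λ i _ → ≤-trans (≤-reflexive (eq i)) (≤-cert ε (<⇒≤ 0<ε) refl)) ,
      ≤ᴿ-intro {fromℕ C} {y} (λ ε 0<ε → 0 , λ i _ → ≤-trans (≤-reflexive (sym (eq i))) (≤-cert ε (<⇒≤ 0<ε) refl))
      where
      y : ℝ
      y = fromℕ C *ᴿ reciprocalᴿ *ᴿ x
      eq : ∀ i → seq y i ≡ seq (fromℕ C) i
      eq i = trans (*≡ (seq (fromℕ C *ᴿ reciprocalᴿ) i) (seq x i)) (trans (cong (_* seq x i) (*≡ (seq (fromℕ C) i) (r i)))
        (trans (*-assoc (seq (fromℕ C) i) (r i) (seq x i)) (trans (cong (seq (fromℕ C) i *_) (rx≡1 i)) (*-identityʳ (seq (fromℕ C) i)))))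

  Conclusion : ℝ → (ℕ → ℝ) → ∀ n → SimpleGraph (Fin n) → Set
  Conclusion C p n G = ∃[ χ ] ∃[ φ ] ∃[ φ̂ ] ∃[ lognp ] ∃[ t ]
    (IsChromaticNumber G χ
     × Isφ G φ
     × Isφ̂ G φ̂
     × IsLog (fromℕ n *ᴿ p n) lognp
     × IsQuotient C lognp t
     × φ̂ ℤ.≤ φ
     × fromℕ χ *ᴿ (1ᴿ -ᴿ t) ≤ᴿ fromℤ φ̂)

  opaque
    constant : ℕ
    constant = 820000

    constant≡ : constant ≡ 820000
    constant≡ = refl

  opaque
    Likely : ∀ {n} → ℝ → ℚ → (Outcome n → Bool) → Set
    Likely p ε E = ∃[ I ] (∀ i → I ℕ.≤ i → seq (Pr p E) i ≤ 1ℚ × 1ℚ ≤ seq (Pr p E) i + ε)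

    likely-intro : ∀ {n} p ε (E : Outcome n → Bool) I → (∀ i → I ℕ.≤ i → seq (Pr p E) i ≤ 1ℚ) →
      (∀ i → I ℕ.≤ i → 1ℚ ≤ seq (Pr p E) i + ε) → Likely p ε E
    likely-intro p ε E I upper lower = I , λ i I≤i → upper i I≤i , lower i I≤i

    Likely⇒≃1 : ∀ {n} p ε → 0ℚ < ε → (E : Outcome n → Bool) → Likely p ε E →
      Pr p E ≤ᴿ 1ᴿ +ᴿ fromℚ ε × 1ᴿ ≤ᴿ Pr p E +ᴿ fromℚ ε
    Likely⇒≃1 p ε 0<ε E (I , bounds) =
      ≤ᴿ-intro {Pr p E} {1ᴿ +ᴿ fromℚ ε} (λ ε′ 0<ε′ → I , λ i I≤i →
        ≤-trans (proj₁ (bounds i I≤i)) (≤-trans (≤-cert (ε + ε′) (0≤+ (<⇒≤ 0<ε) (<⇒≤ 0<ε′)) (sym (+-assoc 1ℚ ε ε′)))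
          (≤-reflexive (cong (_+ ε′) (sym (+≡ 1ℚ ε)))))) ,
      ≤ᴿ-intro {1ᴿ} {Pr p E +ᴿ fromℚ ε} (λ ε′ 0<ε′ → I , λ i I≤i →
        ≤-trans (proj₂ (bounds i I≤i)) (≤-cert ε′ (<⇒≤ 0<ε′) (cong (_+ ε′) (sym (+≡ (seq (Pr p E) i) ε)))))

  module Typical (n : ℕ) (p : ℝ) (P : Params n p) (1≤n : 1 ℕ.≤ n) where
    open Params P

    1≤t : 1 ℕ.≤ t
    1≤t = ℕₚ.≤-trans (ℕₚ.m≤m+n 1 7) 8≤t

    a d : ℕ
    a = 4 ℕ.* t ℕ.* w
    d = 163 ℕ.* t ℕ.+ 1

    typical : Outcome n → Bool
    typical = good a d

    np : ℝ
    np = fromℕ n *ᴿ p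

    private
      np≡ : ∀ i → seq np i ≡ ι n * seq p i
      np≡ i = trans (*≡ (+ n ℚ./ 1) (seq p i)) (cong (_* seq p i) (ι≡ n))

      -- The factor wp ≤ 5 is rounded up to 2³. This bounds log(np) by 3 + t, hence by 4t.
      np≤ : ∀ i → I ℕ.≤ i → seq np i ≤ ι (2 ℕ.^ (3 ℕ.+ t))
      np≤ i I≤i = begin
        seq np i                            ≡⟨ np≡ i ⟩
        ι n * seq p i                       ≤⟨ *-monoʳ (0≤p i I≤i) (ι-mono n≤w2^t) ⟩
        ι (w ℕ.* 2 ℕ.^ t) * seq p i         ≡⟨ trans (cong (_* seq p i) (ι-* w (2 ℕ.^ t))) (solve 3 (λ w x q → w :* x :* q := (w :* q) :* x) refl (ι w) (ι (2 ℕ.^ t)) (seq p i)) ⟩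
        (ι w * seq p i) * ι (2 ℕ.^ t)       ≤⟨ *-monoʳ (0≤ι (2 ℕ.^ t)) (≤-trans (wp≤5 i I≤i) (ι-mono (ℕₚ.m≤m+n 5 3))) ⟩
        ι 8 * ι (2 ℕ.^ t)                   ≡⟨ sym (ι-* 8 (2 ℕ.^ t)) ⟩
        ι (8 ℕ.* 2 ℕ.^ t)                   ≡⟨ cong ι (sym (ℕₚ.^-distribˡ-+-* 2 3 t)) ⟩
        ι (2 ℕ.^ (3 ℕ.+ t))                 ∎
        where open ≤-Reasoning

    open Logarithm np (2 ℕ.^ (3 ℕ.+ t)) I (ℕₚ.m^n>0 2 (3 ℕ.+ t)) (λ i I≤i → ≤-trans (8≤np i I≤i) (≤-reflexive (sym (np≡ i)))) np≤
    open Reciprocal log ½≤log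

    private
      instance
        a≢0 : ℕ.NonZero a
        a≢0 = ℕ.>-nonZero (ℕₚ.*-mono-≤ (ℕₚ.*-mono-≤ {1} {4} (ℕ.s≤s ℕ.z≤n) 1≤t) 1≤w)

      v₀ : Fin n
      v₀ = fromℕ< 1≤n

      3+t≤4t : 3 ℕ.+ t ℕ.≤ 4 ℕ.* t
      3+t≤4t = ℕₚ.≤-trans (ℕₚ.+-monoˡ-≤ t (ℕₚ.*-monoʳ-≤ 3 1≤t)) (ℕₚ.≤-reflexive (ℕₚ.+-comm (3 ℕ.* t) t))

      1≤4tr : ∀ i → 4 ℕ.+ t ℕ.≤ i → 1ℚ ≤ ι (4 ℕ.* t) * r i
      1≤4tr i i≥ = ≤-trans (≤-reflexive (trans (sym (rx≡1 i)) (*-comm (r i) (seq log i)))) (*-monoʳ (0≤r i) (≤-trans (log≤ (3 ℕ.+ t) np≤ i i≥) (ι-mono 3+t≤4t)))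

    -- Because 4t is at least log(np), a deficit X with 4tX ≤ kC is at most kC / log(np).
    bound : ∀ k X z → 4 ℕ.* t ℕ.* X ℕ.≤ k ℕ.* constant → + k ℤ.- + X ℤ.≤ z →
      fromℕ k *ᴿ (1ᴿ -ᴿ (fromℕ constant *ᴿ reciprocalᴿ)) ≤ᴿ fromℤ z
    bound k X z 4tX≤ k-X≤z = ≤ᴿ-intro {fromℕ k *ᴿ (1ᴿ -ᴿ (fromℕ constant *ᴿ reciprocalᴿ))} {fromℤ z} λ ε 0<ε → 4 ℕ.+ t , λ i i≥ →
      ≤-trans (≤-reflexive (lhs i)) (≤-trans
        (≤-cert ((Z + ι X - ι k) + (ι k * ι constant * r i - ι X))
          (0≤+ (0≤- (difference-≤ k X z k-X≤z)) (0≤- (X≤ i i≥)))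
          (solve 5 (λ k c r z x → k :* (con 1ℚ :- c :* r) :+ ((z :+ x :- k) :+ (k :* c :* r :- x)) := z) refl (ι k) (ι constant) (r i) Z (ι X)))
        (≤-cert ε (<⇒≤ 0<ε) refl))
      where
      Z : ℚ
      Z = z ℚ./ 1
      lhs : ∀ i → seq (fromℕ k *ᴿ (1ᴿ -ᴿ (fromℕ constant *ᴿ reciprocalᴿ))) i ≡ ι k * (1ℚ - ι constant * r i)
      lhs i = trans (*≡ (+ k ℚ./ 1) _) (cong₂ _*_ (ι≡ k) (trans (+≡ 1ℚ _) (cong (_+_ 1ℚ) (trans (-≡ _) (cong -_ (trans (*≡ (+ constant ℚ./ 1) (r i)) (cong (_* r i) (ι≡ constant))))))))
      X≤ : ∀ i → 4 ℕ.+ t ℕ.≤ i → ι X ≤ ι k * ι constant * r i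
      X≤ i i≥ = begin
        ι X                         ≡⟨ sym (*-identityʳ (ι X)) ⟩
        ι X * 1ℚ                    ≤⟨ *-monoˡ (0≤ι X) (1≤4tr i i≥) ⟩
        ι X * (ι (4 ℕ.* t) * r i)   ≡⟨ solve 3 (λ x t r → x :* (t :* r) := t :* x :* r) refl (ι X) (ι (4 ℕ.* t)) (r i) ⟩
        ι (4 ℕ.* t) * ι X * r i     ≡⟨ cong (_* r i) (sym (ι-* (4 ℕ.* t) X)) ⟩
        ι (4 ℕ.* t ℕ.* X) * r i     ≤⟨ *-monoʳ (0≤r i) (ι-mono 4tX≤) ⟩
        ι (k ℕ.* constant) * r i    ≡⟨ cong (_* r i) (ι-* k constant) ⟩
        ι k * ι constant * r i      ∎
        where open ≤-Reasoning

    typical⇒conclusion : ∀ ω → typical ω ≡ true → ∃[ χ ] ∃[ φ ] ∃[ φ̂ ] ∃[ lognp ] ∃[ t ]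
      (IsChromaticNumber (graph ω) χ × Isφ (graph ω) φ × Isφ̂ (graph ω) φ̂ × IsLog np lognp
       × IsQuotient (fromℕ constant) lognp t × φ̂ ℤ.≤ φ × fromℕ χ *ᴿ (1ᴿ -ᴿ t) ≤ᴿ fromℤ φ̂)
    typical⇒conclusion ω is-typical = χ ω ⊤ , φ ω , φ̂ ω v₀ , log , fromℕ constant *ᴿ reciprocalᴿ ,
      χ-graph ω , φ-isφ ω , φ̂-isφ̂ ω v₀ , isLog , quotient constant , φ̂≤φ ω v₀ ,
      bound (χ ω ⊤) (deficit ω a d 3a≤ is-good) (φ̂ ω v₀)
        (subst (λ C → 4 ℕ.* t ℕ.* deficit ω a d 3a≤ is-good ℕ.≤ χ ω ⊤ ℕ.* C) (sym constant≡)
          (deficit-bound n w t (χ ω ⊤) 1≤t 1≤w w2^t≤2n t≤4w (n≤χ*2a ω a d 3a≤ is-good)))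
        (χ-deficit≤φ̂ ω a d 3a≤ is-good v₀)
      where
      is-good : badness a d ω < 1ℚ
      is-good = good⇒badness<1 a d ω is-typical
      3a≤ : 3 ℕ.* a ℕ.≤ n
      3a≤ = 3a≤n n w t (χ ω ⊤) 1≤t 1≤w w2^t≤2n t≤4w 8≤t

    Pr≤1 : ∀ i → I ℕ.≤ i → seq (Pr p typical) i ≤ 1ℚ
    Pr≤1 i I≤i = ≤-trans (≤-reflexive (seq-Pr p i typical)) (good≤1 (seq p i) (0≤p i I≤i) (p≤1 i I≤i) {n} a d)

    -- The failure estimate is applied at each rational density `seq p i` separately, with the same
    -- w, t and event throughout.
    1≤Pr : ∀ i → I ℕ.≤ i → 1ℚ ≤ seq (Pr p typical) i + (½ ^ t + ½ ^ t)
    1≤Pr i I≤i = ≤-trans (Failure.Ex-good (seq p i) (0≤p i I≤i) (p≤1 i I≤i) n w t 1≤n 1≤w 1≤t n≤w2^t (1≤wp i I≤i) (wp≤5 i I≤i))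
      (≤-reflexive (cong (_+ (½ ^ t + ½ ^ t)) (sym (seq-Pr p i typical))))

    -- That t tends to infinity with n is expressed by m ≤ 3 · 2^t: if m ≥ K ≥ 6/ε, then 2^t ≥ 2/ε.
    failure≤ : ∀ ε → 0ℚ < ε → ∀ K → ι 6 ≤ ε * ι K → 2 ℕ.^ (2 ℕ.+ K) ℕ.≤ n → ½ ^ t + ½ ^ t ≤ ε
    failure≤ ε 0<ε K 6≤εK large = *-cancelʳ (0<^ t (0<ι {2} (ℕ.s≤s ℕ.z≤n))) (*-cancelʳ (0<ι {3} (ℕ.s≤s ℕ.z≤n)) (begin
      (½ ^ t + ½ ^ t) * ι 2 ^ t * ι 3   ≡⟨ cong (_* ι 3) (trans (*-distribʳ-+ (ι 2 ^ t) (½ ^ t) (½ ^ t)) (trans (cong₂ _+_ (½^*2^ t) (½^*2^ t)) (trans (sym (+≡ 1ℚ 1ℚ)) (sym ι2≡2)))) ⟩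
      ι 2 * ι 3                         ≡⟨ sym (ι-* 2 3) ⟩
      ι 6                               ≤⟨ 6≤εK ⟩
      ε * ι K                           ≤⟨ *-monoˡ (<⇒≤ 0<ε) (ι-mono (ℕₚ.≤-trans K≤m m≤3*2^t)) ⟩
      ε * ι (3 ℕ.* 2 ℕ.^ t)             ≡⟨ cong (ε *_) (trans (ι-* 3 (2 ℕ.^ t)) (cong (ι 3 *_) (ι-^ 2 t))) ⟩
      ε * (ι 3 * ι 2 ^ t)               ≡⟨ solve 3 (λ e a b → e :* (a :* b) := e :* b :* a) refl ε (ι 3) (ι 2 ^ t) ⟩
      ε * ι 2 ^ t * ι 3                 ∎))
      where
      open ≤-Reasoning
      K≤m : K ℕ.≤ m
      K≤m = ℕₚ.≮⇒≥ λ m<K → ℕₚ.<⇒≱ n<2^ (ℕₚ.≤-trans (ℕₚ.^-monoʳ-≤ 2 (ℕₚ.+-monoʳ-≤ 2 (ℕₚ.<⇒≤ m<K))) large)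

    likely : ∀ ε → 0ℚ < ε → ∀ K → ι 6 ≤ ε * ι K → 2 ℕ.^ (2 ℕ.+ K) ℕ.≤ n → Likely p ε typical
    likely ε 0<ε K 6≤εK large = likely-intro p ε typical I Pr≤1
      λ i I≤i → ≤-trans (1≤Pr i I≤i) (+-monoʳ-≤ (seq (Pr p typical) i) (failure≤ ε 0<ε K 6≤εK large))

  module _ (p : ℕ → ℝ) (n₀ : ℕ) (hyp : ∀ n → n₀ ℕ.≤ n → Hypothesis n (p n)) where

    opaque
      n₁ : ℕ
      n₁ = n₀ ℕ.⊔ 2 ℕ.^ 770

      n₀≤n₁ : n₀ ℕ.≤ n₁
      n₀≤n₁ = ℕₚ.m≤m⊔n n₀ (2 ℕ.^ 770)

      large : ∀ {n} → n₁ ℕ.≤ n → 2 ℕ.^ 770 ℕ.≤ n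
      large = ℕₚ.≤-trans (ℕₚ.m≤n⊔m n₀ (2 ℕ.^ 770))

      params : ∀ n → n₁ ℕ.≤ n → Params n (p n)
      params n n₁≤n = make-params n (p n) (large n₁≤n) (hyp n (ℕₚ.≤-trans n₀≤n₁ n₁≤n))

      1≤ : ∀ {n} → n₁ ℕ.≤ n → 1 ℕ.≤ n
      1≤ n₁≤n = ℕₚ.≤-trans (ℕₚ.m^n>0 2 770) (large n₁≤n)

    module T n (n₁≤n : n₁ ℕ.≤ n) = Typical n (p n) (params n n₁≤n) (1≤ n₁≤n)

    -- Below n₁ nothing is known about p, and the empty event is used.
    event : ∀ n → Dec (n₁ ℕ.≤ n) → Σ[ E ∈ (Outcome n → Bool) ]
      ((∀ ω → E ω ≡ true → Conclusion (fromℕ constant) p n (graph ω))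
       × (n₁ ℕ.≤ n → ∀ ε → 0ℚ < ε → ∀ K → ι 6 ≤ ε * ι K → 2 ℕ.^ (2 ℕ.+ K) ℕ.≤ n → Likely (p n) ε E))
    event n (yes n₁≤n) = T.typical n n₁≤n , T.typical⇒conclusion n n₁≤n , λ _ → T.likely n n₁≤n
    event n (no n₁≰n)  = (λ _ → false) , (λ _ ()) , λ n₁≤n → contradiction n₁≤n n₁≰n

    E : ∀ n → Outcome n → Bool
    E n = proj₁ (event n (n₁ ℕₚ.≤? n))

    E-likely : ∀ ε → 0ℚ < ε → ∃[ N ] (∀ n → N ℕ.≤ n → Likely (p n) ε (E n))
    E-likely ε 0<ε = n₁ ℕ.⊔ 2 ℕ.^ (2 ℕ.+ K) , λ n N≤n → proj₂ (proj₂ (event n (n₁ ℕₚ.≤? n)))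
      (ℕₚ.m⊔n≤o⇒m≤o n₁ (2 ℕ.^ (2 ℕ.+ K)) N≤n) ε 0<ε K 6≤εK (ℕₚ.m⊔n≤o⇒n≤o n₁ (2 ℕ.^ (2 ℕ.+ K)) N≤n)
      where
      r : ℚ
      r = proj₁ (inv 0<ε)
      K : ℕ
      -- At least 6/ε; the threshold 2^(2+K) for n then ensures m ≥ K.
      K = proj₁ (archimedean (ι 6 * r))
      6≤εK : ι 6 ≤ ε * ι K
      6≤εK = ≤-trans (≤-reflexive (trans (sym (*-identityʳ (ι 6))) (trans (cong (ι 6 *_) (sym (proj₂ (proj₂ (inv 0<ε)))))
        (solve 3 (λ s r e → s :* (r :* e) := e :* (s :* r)) refl (ι 6) r ε)))) (*-monoˡ (<⇒≤ 0<ε) (proj₂ (archimedean (ι 6 * r))))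

    aas : AAS p (Conclusion (fromℕ constant) p)
    aas = E , (λ n → proj₁ (proj₂ (event n (n₁ ℕₚ.≤? n)))) , λ ε 0<ε →
      proj₁ (E-likely ε 0<ε) , λ n N≤n → Likely⇒≃1 (p n) ε 0<ε (E n) (proj₂ (E-likely ε 0<ε) n N≤n)

  0<constant : 0ᴿ <ᴿ fromℕ constant
  0<constant = 1ℚ , positive⁻¹ 1ℚ , 0 , λ _ _ → subst₂ _≤_ (trans (sym (+-identityˡ 1ℚ)) (sym (+≡ 0ℚ 1ℚ))) (sym (ι≡ constant))
    (subst (_≤ ι constant) ι1≡1 (ι-mono (subst (1 ℕ.≤_) (sym constant≡) (ℕ.s≤s ℕ.z≤n))))

open import Defs
open import Data.Nat.Base using (ℕ; _≤_)
open import Data.Integer.Base as ℤ using (ℤ)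
open import Data.Product using (∃-syntax; _×_; _,_)
open Typicality using (constant; 0<constant; aas)

theorem4p6 : (p : ℕ → ℝ) →
    (∃[ n₀ ] (∀ n → n₀ ≤ n →
    ∃[ logn ] ∃[ lower ] ∃[ upper ]
    (IsLog (fromℕ n) logn
    × IsQuotient (fromℕ 2 *ᴿ logn) (fromℕ n) lower
    × IsQuotient 1ᴿ (logn ^ᴿ 2) upper
    × lower <ᴿ p n
    × p n <ᴿ upper))) →
    ∃[ C ] (0ᴿ <ᴿ C ×
    AAS p (λ n G →
    ∃[ χ ] ∃[ φ ] ∃[ φ̂ ] ∃[ lognp ] ∃[ t ]
    (IsChromaticNumber G χ
    × Isφ G φ
    × Isφ̂ G φ̂
    × IsLog (fromℕ n *ᴿ p n) lognp
    × IsQuotient C lognp t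
    × φ̂ ℤ.≤ φ
    × fromℕ χ *ᴿ (1ᴿ -ᴿ t) ≤ᴿ fromℤ φ̂)))
theorem4p6 p (n₀ , hyp) = fromℕ constant , 0<constant , aas p n₀ hyp
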